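{- For every $\varepsilon>0$ there is $N$ such that for every integer $n\ge N$ and every non-averaging set $A\subseteq[n]=\{1,\dots,n\}$ we have $|A|\le n^{1/4+\varepsilon}$. In particular, $h(n)=n^{1/4+o(1)}$, i.e. for every $\varepsilon>0$ and all sufficiently large $n$, $n^{1/4-\varepsilon}\le h(n)\le n^{1/4+\varepsilon}$.
   Context: A set $A$ of integers is non-averaging if there is no element $a\in A$ which can be written as the average of the elements of a nonempty subset of $A$ not containing $a$. Equivalently, there are no distinct $x_0,x_1,\dots,x_k\in A$ with $k\ge 2$ and $kx_0=x_1+\dots+x_k$. For a positive integer $n$, $h(n)$ denotes the largest size of a non-averaging subset of $[n]=\{1,\dots,n\}$. -}

module Defs where

open import Data.Nat using (ℕ; _≤_; _*_)
open import Data.List using (List; []; length)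
open import Data.Nat.ListAction using (sum)
open import Data.List.Membership.Propositional using (_∈_; _∉_)
open import Data.List.Relation.Binary.Sublist.Propositional using (_⊆_)
open import Data.List.Relation.Unary.All using (All)
open import Data.List.Relation.Unary.Unique.Propositional using (Unique)
open import Data.Product using (Σ; _×_; ∃-syntax)
open import Relation.Nullary using (¬_)
open import Relation.Binary.PropositionalEquality using (_≡_; _≢_)

-- A finite set of natural numbers is represented by a duplicate-free list;
-- its cardinality is the length of the list.

SubsetOfRange : ℕ → List ℕ → Set
SubsetOfRange n A = Unique A × All (λ x → 1 ≤ x × x ≤ n) A

-- A is non-averaging: there is no a ∈ A and no nonempty subset S ⊆ A
-- (a sublist of the duplicate-free list A, hence a subset) with a ∉ S
-- such that a is the average of S, i.e. |S| · a = Σ S.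
NonAveraging : List ℕ → Set
NonAveraging A =
  ¬ (∃[ a ] ∃[ S ] (a ∈ A × S ⊆ A × a ∉ S × S ≢ [] × length S * a ≡ sum S))

{-# OPTIONS --safe #-}
-- Upper bound. Write E_k(B) for the set of k-fold sums of differences of elements of B. If A ⊆ [n] has more
-- than n ^ p/q > n ^ 1/4 elements, choose k and B ⊆ A with |B| = k s, where s is a power of log n, so that
-- |E_k(B)| / k ^ (5 − 1/2p) is minimal. Greedily chosen pairs of elements of B have a set of choice sums that
-- contains a translate of E_n₀(B) with k / n₀ at most a power of log n, although they use up only a small part of B. Hence if the
-- elements of some subset Y of the rest, together with one choice from each pair, have a sum which differs from
-- a multiple of an element a by an element of E_n₀(B), then changing the choices makes a the exact average.
--
-- The sets E_m(B) are described by boundedly many generators without short relations, so that the elements of B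
-- acquire coordinates ξ in ℤ ^ d which are additive up to a small error. If some a is deep, that is, if in every
-- direction many elements of B lie beyond a, then repeatedly adding blocks of elements on the far side steers
-- the sum towards a multiple of a, which is a contradiction. If no a is deep, then each a has a direction f in
-- which few elements lie beyond it; since a ↦ f is nearly monotone along ξ, many elements of B lie in a thin slab
-- around one of them, and the translates of the k′-fold differences of the slab that fit into E_k(B) are so many
-- that minimality is violated: the exponents of the thickness compare as d² − 5d + 6 = (d − 2)(d − 3) ≥ 0.
--
-- Lower bound. A = { x + M x² : 1 ≤ x ≤ m } with M > m²: averaging relations hold separately for the base M digits x
-- and x², which contradicts the strict convexity of x².
module Submission where

open import Defs
open import Data.Nat
open import Data.Nat.Properties
open import Data.Nat.DivMod using (_/_; _%_; m≡m%n+[m/n]*n; m%n<n; m/n*n≤m; /-mono-≤; m*n/n≡m; m<n*o⇒m/o<n)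
open import Data.Nat.Induction using (<-rec)
open import Data.Nat.ListAction using (sum)
open import Data.Nat.ListAction.Properties using (sum-↭; sum-++)
open import Data.Nat.Tactic.RingSolver using () renaming (solve-∀ to ℕ-ring)
import Data.Integer as ℤ
open ℤ using (ℤ; +_; -[1+_]; ∣_∣; 0ℤ; +≤+; drop‿+≤+)
open import Data.Integer.Tactic.RingSolver using () renaming (solve-∀ to ℤ-ring)
open import Data.Fin using (Fin; toℕ; punchIn; punchOut) renaming (zero to fz; suc to fs)
open import Data.Vec using (Vec; []; _∷_; lookup)
open import Data.List using (List; []; _∷_; [_]; _++_; map; filter; length; take; drop; upTo; deduplicate; cartesianProductWith; cartesianProduct)
open import Data.List.Properties using (length-map; length-++; length-upTo; length-take; length-drop; take++drop≡id; map-++; length-filter; ++-assoc; filter-++; length-++-≤ˡ)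
open import Data.List.Membership.Propositional using (_∈_; _∉_; find; lose)
open import Data.List.Membership.Propositional.Properties using (∈-map⁺; ∈-map⁻; ∈-++⁺ˡ; ∈-++⁺ʳ; ∈-++⁻; ∈-filter⁺; ∈-filter⁻; ∈-upTo⁺; ∈-upTo⁻; ∈-deduplicate⁺; ∈-deduplicate⁻; ∈-cartesianProductWith⁺; ∈-cartesianProductWith⁻; ∈-cartesianProduct⁻; ∈-∃++; ∈-length; ∈-lookup)
open import Data.List.Relation.Unary.Any using (here; there; any?; index)
open import Data.List.Relation.Unary.All using (All; []; _∷_)
open import Data.List.Relation.Unary.AllPairs using (AllPairs; []; _∷_)
open import Data.List.Relation.Unary.Unique.Propositional using (Unique)
open import Data.List.Relation.Unary.Unique.DecPropositional.Properties using (deduplicate-!)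
open import Data.List.Relation.Binary.Permutation.Propositional using (_↭_; ↭-refl; ↭-sym; ↭-trans; ↭-reflexive; prep; swap)
open import Data.List.Relation.Binary.Permutation.Propositional.Properties using (∈-resp-↭; shift; ↭-length; shifts; ++⁺ˡ; filter-↭)
open import Data.Product using (Σ; ∃-syntax; _×_; _,_; proj₁; proj₂)
open import Data.Sum using (_⊎_; inj₁; inj₂)
open import Data.Empty using (⊥; ⊥-elim)
open import Function using (_∘_; id; case_of_)
open import Relation.Nullary using (¬_; Dec; yes; no; contradiction)
open import Relation.Nullary.Decidable using (¬?; _×-dec_; decidable-stable)
open import Relation.Binary.PropositionalEquality using (_≡_; _≢_; refl; sym; trans; cong; cong₂; subst; subst₂; module ≡-Reasoning)
open import Data.Fin.Properties using (toℕ<n; toℕ-injective; punchIn-punchOut)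
open import Data.Vec.Functional using (insertAt)
open import Data.Vec.Functional.Properties using (insertAt-lookup; insertAt-punchIn)
open import Data.List.Relation.Binary.Sublist.Propositional.Properties using (filter-⊆; Any-resp-⊆; length-mono-≤)
open import Relation.Binary.Definitions using (tri<; tri≈; tri>)
import Data.Integer.Properties as ℤₚ
open import Data.List.Relation.Unary.Any.Properties using (lookup-index)
import Data.List
import Data.Fin
import Data.List.Relation.Unary.All as All
import Data.List.Relation.Unary.All.Properties as All
import Data.List.Relation.Unary.Unique.Propositional.Properties as Unique

-- Counting in lists

-- The exponent 5 is 1 + 4. Trivially |E_k(A)| ≤ 3 k n, and |A| > n ^ (p / q) with q ≤ 4 p - 1 makes
-- n at most k ^ (4 - 1/p) up to powers of log n. Half of the gain 1/p swallows these powers, the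
-- other half is built into the quantity that is minimised. The second half decides the proof: for d
-- = 2 and d = 3 the exponents of the thickness tie, and only this gain can pay for the losses.
-- Losses are therefore kept to fixed powers of h, a power of two of order log n, and the thickness
-- is a power of h whose exponent is a multiple of p times these losses. Short relations cannot be
-- excluded at a prescribed scale. If one occurs, a generator is eliminated, but the error grows to
-- the whole range of coefficients considered so far. So every number of generators has its own
-- window of scales. The windows are stacked below k, and since the number of generators is at most
-- a constant D, their total height is a fixed power of h. The inequality to be proved is decidable,
-- so the argument is a refutation. Statements about all directions or all relations are never
-- decided; their failures go to continuations with values in ⊥.

∈⇒↭ : ∀ {A : Set} {x : A} {xs} → x ∈ xs → ∃[ ys ] xs ↭ x ∷ ys
∈⇒↭ {x = x} x∈xs with ∈-∃++ x∈xs
... | ys , zs , refl = ys ++ zs , shift x ys zs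

Unique-↭ : ∀ {A : Set} {xs ys : List A} → xs ↭ ys → Unique xs → Unique ys
Unique-↭ _↭_.refl u = u
Unique-↭ (prep x p) (x∉ ∷ u) =
  All.tabulate (λ y∈ → All.lookup x∉ (∈-resp-↭ (↭-sym p) y∈)) ∷ Unique-↭ p u
Unique-↭ (swap x y p) ((x≢y ∷ x∉) ∷ (y∉ ∷ u)) =
  ((λ e → x≢y (sym e)) ∷ All.tabulate (λ z∈ → All.lookup y∉ (∈-resp-↭ (↭-sym p) z∈)))
  ∷ (All.tabulate (λ z∈ → All.lookup x∉ (∈-resp-↭ (↭-sym p) z∈)) ∷ Unique-↭ p u)
Unique-↭ (_↭_.trans p q) u = Unique-↭ q (Unique-↭ p u)

Unique-++ˡ : ∀ {A : Set} (xs : List A) {ys} → Unique (xs ++ ys) → Unique xs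
Unique-++ˡ []       u        = []
Unique-++ˡ (x ∷ xs) (x∉ ∷ u) = All.++⁻ˡ xs x∉ ∷ Unique-++ˡ xs u

Unique-++ʳ : ∀ {A : Set} (xs : List A) {ys} → Unique (xs ++ ys) → Unique ys
Unique-++ʳ []       u       = u
Unique-++ʳ (x ∷ xs) (_ ∷ u) = Unique-++ʳ xs u

Unique-disjoint : ∀ {A : Set} (xs : List A) {ys x} → Unique (xs ++ ys) → x ∈ xs → x ∈ ys → ⊥
Unique-disjoint (x ∷ xs) (x∉ ∷ u) (here refl) x∈ys = All.lookup (All.++⁻ʳ xs x∉) x∈ys refl
Unique-disjoint (_ ∷ xs) (_ ∷ u) (there x∈xs) x∈ys = Unique-disjoint xs u x∈xs x∈ys

length-injection : ∀ {A B : Set} (f : A → B) {xs ys} → Unique xs →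
  (∀ {x} → x ∈ xs → f x ∈ ys) →
  (∀ {x x′} → x ∈ xs → x′ ∈ xs → f x ≡ f x′ → x ≡ x′) → length xs ≤ length ys
length-injection f {[]} u into inj = z≤n
length-injection f {x ∷ xs} {ys} (x∉ ∷ u) into inj with ∈⇒↭ (into (here refl))
... | ys′ , p = ≤-trans (s≤s (length-injection f u into′ (λ a b → inj (there a) (there b))))
                        (≤-reflexive (sym (↭-length p)))
  where
  into′ : ∀ {z} → z ∈ xs → f z ∈ ys′
  into′ z∈ with ∈-resp-↭ p (into (there z∈))
  ... | here fz≡fx = contradiction (sym (inj (there z∈) (here refl) fz≡fx)) (All.lookup x∉ z∈)
  ... | there h    = h

length-⊆ : ∀ {A : Set} {xs ys : List A} → Unique xs → (∀ {x} → x ∈ xs → x ∈ ys) →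
  length xs ≤ length ys
length-⊆ u sub = length-injection id u sub (λ _ _ e → e)

length-cartesianProductWith : ∀ {A B C : Set} (f : A → B → C) (xs : List A) (ys : List B) →
  length (cartesianProductWith f xs ys) ≡ length xs * length ys
length-cartesianProductWith f []       ys = refl
length-cartesianProductWith f (x ∷ xs) ys =
  trans (length-++ (map (f x) ys)) (cong₂ _+_ (length-map (f x) ys) (length-cartesianProductWith f xs ys))

length-packing : ∀ {A B C : Set} (f : A → B → C) {xs ys zs} → Unique xs → Unique ys →
  (∀ {x y} → x ∈ xs → y ∈ ys → f x y ∈ zs) →
  (∀ {x x′ y y′} → x ∈ xs → x′ ∈ xs → y ∈ ys → y′ ∈ ys → f x y ≡ f x′ y′ → x ≡ x′ × y ≡ y′) →
  length xs * length ys ≤ length zs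
length-packing f {xs} {ys} {zs} u v into inj = subst (_≤ length zs) (length-cartesianProductWith _,_ xs ys)
  (length-injection (λ p → f (proj₁ p) (proj₂ p)) (Unique.cartesianProduct⁺ u v)
    (λ p∈ → case ∈-cartesianProduct⁻ xs ys p∈ of λ (x∈ , y∈) → into x∈ y∈)
    (λ {p} {p′} p∈ p′∈ e → case ∈-cartesianProduct⁻ xs ys p∈ of λ (x∈ , y∈) →
      case ∈-cartesianProduct⁻ xs ys p′∈ of λ (x′∈ , y′∈) →
      case inj x∈ x′∈ y∈ y′∈ e of λ (e₁ , e₂) → cong₂ _,_ e₁ e₂))

ℤ-cancelˡ : ∀ a {u v} → a ℤ.+ u ≡ a ℤ.+ v → u ≡ v
ℤ-cancelˡ a {u} {v} e = trans (sym (l a u)) (trans (cong (ℤ._- a) e) (l a v))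
  where
  l : ∀ a u → a ℤ.+ u ℤ.- a ≡ u
  l = ℤ-ring

ℤ-cancelʳ : ∀ a {u v} → u ℤ.+ a ≡ v ℤ.+ a → u ≡ v
ℤ-cancelʳ a {u} {v} e = ℤ-cancelˡ a (trans (ℤₚ.+-comm a u) (trans e (ℤₚ.+-comm v a)))

∣i∣≤n⇒0≤i+n : ∀ i {n} → ∣ i ∣ ≤ n → 0ℤ ℤ.≤ i ℤ.+ + n
∣i∣≤n⇒0≤i+n (+ m) p = +≤+ z≤n
∣i∣≤n⇒0≤i+n -[1+ m ] {n} p = subst (0ℤ ℤ.≤_) (sym (ℤₚ.⊖-≥ p)) (+≤+ z≤n)

length-interval : ∀ {xs : List ℤ} n → Unique xs → (∀ {x} → x ∈ xs → ∣ x ∣ ≤ n) →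
  length xs ≤ suc (n + n)
length-interval {xs} n u bd = subst (length xs ≤_) (length-upTo _)
  (length-injection (λ x → ∣ x ℤ.+ + n ∣) u
    (λ {x} x∈ → ∈-upTo⁺ (s≤s (≤-trans (ℤₚ.∣i+j∣≤∣i∣+∣j∣ x (+ n)) (+-monoˡ-≤ n (bd x∈)))))
    (λ x∈ y∈ e → ℤ-cancelʳ (+ n) (trans (sym (pos x∈)) (trans (cong +_ e) (pos y∈)))))
  where
  pos : ∀ {x} → x ∈ xs → + ∣ x ℤ.+ + n ∣ ≡ x ℤ.+ + n
  pos {x} x∈ = ℤₚ.0≤i⇒+∣i∣≡i (∣i∣≤n⇒0≤i+n x (bd x∈))

count : ∀ {A : Set} {P : A → Set} → (∀ x → Dec (P x)) → List A → ℕ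
count P? xs = length (filter P? xs)

module _ {A : Set} {P : A → Set} (P? : ∀ x → Dec (P x)) where

  count-++ : ∀ xs ys → count P? (xs ++ ys) ≡ count P? xs + count P? ys
  count-++ xs ys = trans (cong length (filter-++ P? xs ys)) (length-++ (filter P? xs))

  count-reject : ∀ {x} xs → ¬ P x → count P? (x ∷ xs) ≡ count P? xs
  count-reject {x} xs ¬p with P? x
  ... | yes p = contradiction p ¬p
  ... | no _  = refl

  count-none : ∀ xs → (∀ {x} → x ∈ xs → ¬ P x) → count P? xs ≡ 0
  count-none []       h = refl
  count-none (x ∷ xs) h = trans (count-reject xs (h (here refl))) (count-none xs (h ∘ there))

  count-partition : ∀ xs → length xs ≡ count P? xs + count (¬? ∘ P?) xs
  count-partition [] = refl
  count-partition (x ∷ xs) with P? x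
  ... | yes _ = cong suc (count-partition xs)
  ... | no _  = trans (cong suc (count-partition xs)) (sym (+-suc _ _))

length-two-filters : ∀ {A : Set} {P Q : A → Set} (P? : ∀ x → Dec (P x)) (Q? : ∀ x → Dec (Q x)) xs →
  length xs ≤ count P? xs + (count Q? xs + count (λ x → ¬? (P? x) ×-dec ¬? (Q? x)) xs)
length-two-filters P? Q? [] = z≤n
length-two-filters P? Q? (x ∷ xs) with P? x | Q? x
... | yes _ | no _  = s≤s (length-two-filters P? Q? xs)
... | yes _ | yes _ = s≤s (≤-trans (length-two-filters P? Q? xs)
                       (+-monoʳ-≤ (count P? xs) (+-monoˡ-≤ (count (λ x → ¬? (P? x) ×-dec ¬? (Q? x)) xs) (n≤1+n (count Q? xs)))))
... | no _  | yes _ = ≤-trans (s≤s (length-two-filters P? Q? xs)) (≤-reflexive (sym (+-suc _ _)))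
... | no _  | no _  = ≤-trans (s≤s (length-two-filters P? Q? xs))
    (≤-reflexive (trans (sym (+-suc _ _)) (cong (λ z → count P? xs + z) (sym (+-suc _ _)))))

∑ : ∀ {A : Set} → (A → ℕ) → List A → ℕ
∑ f xs = sum (map f xs)

∑-≤ : ∀ {A : Set} (f : A → ℕ) c xs → (∀ {x} → x ∈ xs → f x ≤ c) → ∑ f xs ≤ length xs * c
∑-≤ f c []       h = z≤n
∑-≤ f c (x ∷ xs) h = +-mono-≤ (h (here refl)) (∑-≤ f c xs (h ∘ there))

∑-≥ : ∀ {A : Set} (f : A → ℕ) c xs → (∀ {x} → x ∈ xs → c ≤ f x) → length xs * c ≤ ∑ f xs
∑-≥ f c []       h = z≤n
∑-≥ f c (x ∷ xs) h = +-mono-≤ (h (here refl)) (∑-≥ f c xs (h ∘ there))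

∑-+ : ∀ {A : Set} (f g : A → ℕ) xs → ∑ (λ x → f x + g x) xs ≡ ∑ f xs + ∑ g xs
∑-+ f g [] = refl
∑-+ f g (x ∷ xs) = trans (cong (λ z → f x + g x + z) (∑-+ f g xs)) (e (f x) (g x) (∑ f xs) (∑ g xs))
  where
  e : ∀ a b c d → a + b + (c + d) ≡ a + c + (b + d)
  e = ℕ-ring

∑-cong : ∀ {A : Set} {f g : A → ℕ} xs → (∀ x → f x ≡ g x) → ∑ f xs ≡ ∑ g xs
∑-cong []       e = refl
∑-cong (x ∷ xs) e = cong₂ _+_ (e x) (∑-cong xs e)

module _ {A B : Set} {R : A → B → Set} (R? : ∀ x y → Dec (R x y)) where

  double-count : ∀ xs ys → ∑ (λ x → count (R? x) ys) xs ≡ ∑ (λ y → count (λ x → R? x y) xs) ys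
  double-count [] ys = sym (zeros ys)
    where
    zeros : ∀ ys → ∑ (λ y → count (λ x → R? x y) []) ys ≡ 0
    zeros []       = refl
    zeros (_ ∷ ys) = zeros ys
  double-count (x ∷ xs) ys = begin
    count (R? x) ys + ∑ (λ x → count (R? x) ys) xs
      ≡⟨ cong₂ _+_ (indicators ys) (double-count xs ys) ⟩
    ∑ (λ y → count (λ x → R? x y) [ x ]) ys + ∑ (λ y → count (λ x → R? x y) xs) ys
      ≡⟨ ∑-+ (λ y → count (λ x → R? x y) [ x ]) _ ys ⟨
    ∑ (λ y → count (λ x → R? x y) [ x ] + count (λ x → R? x y) xs) ys
      ≡⟨ ∑-cong ys (λ y → count-++ (λ x → R? x y) [ x ] xs) ⟨
    ∑ (λ y → count (λ x → R? x y) (x ∷ xs)) ys ∎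
    where
    open ≡-Reasoning
    indicators : ∀ ys → count (R? x) ys ≡ ∑ (λ y → count (λ x → R? x y) [ x ]) ys
    indicators [] = refl
    indicators (y ∷ ys) with R? x y
    ... | yes _ = cong suc (indicators ys)
    ... | no _  = indicators ys

-- Iterated difference sets

_∈?_ : ∀ (x : ℤ) xs → Dec (x ∈ xs)
x ∈? xs = any? (x ℤₚ.≟_) xs

differences : List ℕ → List ℤ
differences B = cartesianProductWith (λ b b′ → + b ℤ.- + b′) B B

abstract
  -- Duplicates are removed at every step, so that `length (E B n)` is a cardinality; the whole
  -- argument compares these lengths.
  E : List ℕ → ℕ → List ℤ
  E B zero    = [ 0ℤ ]
  E B (suc n) = deduplicate ℤₚ._≟_ (cartesianProductWith ℤ._+_ (differences B) (E B n))

  E-unique : ∀ {B} n → Unique (E B n)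
  E-unique zero    = [] ∷ []
  E-unique (suc n) = deduplicate-! ℤₚ._≟_ _

  E-suc⁺ : ∀ {B n b b′ y} → b ∈ B → b′ ∈ B → y ∈ E B n → + b ℤ.- + b′ ℤ.+ y ∈ E B (suc n)
  E-suc⁺ b∈ b′∈ y∈ = ∈-deduplicate⁺ ℤₚ._≟_
    (∈-cartesianProductWith⁺ ℤ._+_ (∈-cartesianProductWith⁺ (λ b b′ → + b ℤ.- + b′) b∈ b′∈) y∈)

  E-suc⁻ : ∀ {B n z} → z ∈ E B (suc n) →
    ∃[ b ] ∃[ b′ ] ∃[ y ] b ∈ B × b′ ∈ B × y ∈ E B n × z ≡ + b ℤ.- + b′ ℤ.+ y
  E-suc⁻ {B} {n} z∈ with ∈-cartesianProductWith⁻ ℤ._+_ (differences B) (E B n) (∈-deduplicate⁻ ℤₚ._≟_ _ z∈)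
  ... | _ , y , d∈ , y∈ , refl with ∈-cartesianProductWith⁻ (λ b b′ → + b ℤ.- + b′) B B d∈
  ... | b , b′ , b∈ , b′∈ , refl = b , b′ , y , b∈ , b′∈ , y∈ , refl

  E-zero⁺ : ∀ {B} → 0ℤ ∈ E B 0
  E-zero⁺ = here refl

  E-zero⁻ : ∀ {B z} → z ∈ E B 0 → z ≡ 0ℤ
  E-zero⁻ (here e) = e

module _ {B : List ℕ} where

  E-+ : ∀ m {n x y} → x ∈ E B m → y ∈ E B n → x ℤ.+ y ∈ E B (m + n)
  E-+ zero    {n} {x} {y} x∈ y∈ =
    subst (_∈ E B n) (sym (trans (cong (ℤ._+ y) (E-zero⁻ x∈)) (ℤₚ.+-identityˡ y))) y∈
  E-+ (suc m) {n} {x} {y} x∈ y∈ with E-suc⁻ x∈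
  ... | b , b′ , x′ , b∈ , b′∈ , x′∈ , refl =
    subst (_∈ E B (suc m + n)) (sym (ℤₚ.+-assoc (+ b ℤ.- + b′) x′ y)) (E-suc⁺ b∈ b′∈ (E-+ m x′∈ y∈))

  E-neg : ∀ n {x} → x ∈ E B n → ℤ.- x ∈ E B n
  E-neg zero    x∈ with refl ← E-zero⁻ x∈ = x∈
  E-neg (suc n) x∈ with E-suc⁻ x∈
  ... | b , b′ , x′ , b∈ , b′∈ , x′∈ , refl =
    subst (_∈ E B (suc n)) (e (+ b) (+ b′) x′) (E-suc⁺ b′∈ b∈ (E-neg n x′∈))
    where
    e : ∀ u v w → v ℤ.- u ℤ.+ (ℤ.- w) ≡ ℤ.- (u ℤ.- v ℤ.+ w)
    e = ℤ-ring

  E-sub : ∀ m {n x y} → x ∈ E B m → y ∈ E B n → x ℤ.- y ∈ E B (m + n)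
  E-sub m x∈ y∈ = E-+ m x∈ (E-neg _ y∈)

  E-split : ∀ m {n x} → x ∈ E B (m + n) → ∃[ y ] ∃[ z ] y ∈ E B m × z ∈ E B n × x ≡ y ℤ.+ z
  E-split zero    {x = x} x∈ = 0ℤ , x , E-zero⁺ , x∈ , sym (ℤₚ.+-identityˡ x)
  E-split (suc m) x∈ with E-suc⁻ x∈
  ... | b , b′ , x′ , b∈ , b′∈ , x′∈ , refl with E-split m x′∈
  ... | y , z , y∈ , z∈ , refl = + b ℤ.- + b′ ℤ.+ y , z , E-suc⁺ b∈ b′∈ y∈ , z∈ ,
    sym (ℤₚ.+-assoc (+ b ℤ.- + b′) y z)

  E-zero∈ : ∀ {b} → b ∈ B → ∀ n → 0ℤ ∈ E B n
  E-zero∈ b∈ zero    = E-zero⁺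
  E-zero∈ {b} b∈ (suc n) = subst (_∈ E B (suc n)) (e (+ b)) (E-suc⁺ b∈ b∈ (E-zero∈ b∈ n))
    where
    e : ∀ u → u ℤ.- u ℤ.+ 0ℤ ≡ 0ℤ
    e = ℤ-ring

  -- Shorter sums are padded with zero differences b - b, which is why an element of B accompanies
  -- so many statements.
  E-mono : ∀ {b m n x} → b ∈ B → m ≤ n → x ∈ E B m → x ∈ E B n
  E-mono {m = m} {n} {x} b∈ m≤n x∈ = subst₂ (λ z k → z ∈ E B k) (ℤₚ.+-identityʳ x) (m+[n∸m]≡n m≤n)
    (E-+ m x∈ (E-zero∈ b∈ (n ∸ m)))

  E-scale-ℕ : ∀ m {n x} → x ∈ E B n → + m ℤ.* x ∈ E B (m * n)
  E-scale-ℕ zero {n} {x} x∈ = subst (_∈ E B 0) (sym (ℤₚ.*-zeroˡ x)) E-zero⁺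
  E-scale-ℕ (suc m) {n} {x} x∈ = subst (_∈ E B (n + m * n)) (sym (e (+ m) x)) (E-+ n x∈ (E-scale-ℕ m x∈))
    where
    e : ∀ m x → (ℤ.1ℤ ℤ.+ m) ℤ.* x ≡ x ℤ.+ m ℤ.* x
    e = ℤ-ring

  E-scale : ∀ m {n x} → x ∈ E B n → m ℤ.* x ∈ E B (∣ m ∣ * n)
  E-scale (+ m)    x∈ = E-scale-ℕ m x∈
  E-scale -[1+ m ] {n} {x} x∈ = subst (_∈ E B (suc m * n)) (ℤₚ.neg-distribˡ-* (+ suc m) x)
    (E-neg (suc m * n) (E-scale-ℕ (suc m) x∈))

  E-difference : ∀ {b b′} → b ∈ B → b′ ∈ B → + b ℤ.- + b′ ∈ E B 1
  E-difference {b} {b′} b∈ b′∈ = subst (_∈ E B 1) (ℤₚ.+-identityʳ _) (E-suc⁺ b∈ b′∈ E-zero⁺)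

  E-bounded : ∀ {N} → (∀ {b} → b ∈ B → b ≤ N) → ∀ n {x} → x ∈ E B n → ∣ x ∣ ≤ n * N
  E-bounded h zero x∈ with refl ← E-zero⁻ x∈ = z≤n
  E-bounded {N} h (suc n) x∈ with E-suc⁻ x∈
  ... | b , b′ , x′ , b∈ , b′∈ , x′∈ , refl = ≤-trans (ℤₚ.∣i+j∣≤∣i∣+∣j∣ (+ b ℤ.- + b′) x′)
    (+-mono-≤ (≤-trans (≤-reflexive (cong ∣_∣ (ℤₚ.m-n≡m⊖n b b′)))
               (≤-trans (ℤₚ.∣m⊝n∣≤m⊔n b b′) (⊔-lub (h b∈) (h b′∈)))) (E-bounded h n x′∈))

E-⊆ : ∀ {B B′} → (∀ {b} → b ∈ B → b ∈ B′) → ∀ n {x} → x ∈ E B n → x ∈ E B′ n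
E-⊆ {B} {B′} sub zero x∈ = subst (_∈ E B′ 0) (sym (E-zero⁻ x∈)) E-zero⁺
E-⊆ {B} sub (suc n) x∈ with E-suc⁻ {B} x∈
... | b , b′ , x′ , b∈ , b′∈ , x′∈ , refl = E-suc⁺ (sub b∈) (sub b′∈) (E-⊆ sub n x′∈)

E-nonempty : ∀ {B b} → b ∈ B → ∀ n → 1 ≤ length (E B n)
E-nonempty b∈ n = ∈-length (E-zero∈ b∈ n)

E-card-bound : ∀ {B N} → (∀ {b} → b ∈ B → b ≤ N) → ∀ n → length (E B n) ≤ suc (n * N + n * N)
E-card-bound {B} h n = length-interval (n * _) (E-unique {B} n) (E-bounded h n)

-- Subset sums of pairs and absorption

flat : List (ℕ × ℕ) → List ℕ
flat []             = []
flat ((x , x′) ∷ P) = x ∷ x′ ∷ flat P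

flat-++ : ∀ P Q → flat (P ++ Q) ≡ flat P ++ flat Q
flat-++ []             Q = refl
flat-++ ((x , x′) ∷ P) Q = cong (λ zs → x ∷ x′ ∷ zs) (flat-++ P Q)

length-flat : ∀ P → length (flat P) ≡ 2 * length P
length-flat [] = refl
length-flat (_ ∷ P) = trans (cong (λ n → 2 + n) (length-flat P)) (e (length P))
  where
  e : ∀ n → 2 + 2 * n ≡ 2 * (1 + n)
  e = ℕ-ring

abstract
  -- The sums of choices of one entry from each pair. All choices have the same number of elements,
  -- so exchanging one for another changes the sum of a set but not its size.
  V : List (ℕ × ℕ) → List ℤ
  V []             = [ 0ℤ ]
  V ((x , x′) ∷ P) = deduplicate ℤₚ._≟_ (map (λ v → + x ℤ.+ v) (V P) ++ map (λ v → + x′ ℤ.+ v) (V P))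

  V-unique : ∀ P → Unique (V P)
  V-unique []      = [] ∷ []
  V-unique (_ ∷ P) = deduplicate-! ℤₚ._≟_ _

  V-∷ˡ : ∀ {x x′ v} P → v ∈ V P → + x ℤ.+ v ∈ V ((x , x′) ∷ P)
  V-∷ˡ {x} P v∈ = ∈-deduplicate⁺ ℤₚ._≟_ (∈-++⁺ˡ (∈-map⁺ (λ v → + x ℤ.+ v) v∈))

  V-∷ʳ : ∀ {x x′ v} P → v ∈ V P → + x′ ℤ.+ v ∈ V ((x , x′) ∷ P)
  V-∷ʳ {x} {x′} P v∈ =
    ∈-deduplicate⁺ ℤₚ._≟_ (∈-++⁺ʳ (map (λ v → + x ℤ.+ v) (V P)) (∈-map⁺ (λ v → + x′ ℤ.+ v) v∈))

  V-∷⁻ : ∀ {x x′ z} P → z ∈ V ((x , x′) ∷ P) →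
    ∃[ y ] ∃[ v ] (y ≡ x ⊎ y ≡ x′) × v ∈ V P × z ≡ + y ℤ.+ v
  V-∷⁻ {x} {x′} P z∈ with ∈-++⁻ (map (λ v → + x ℤ.+ v) (V P)) (∈-deduplicate⁻ ℤₚ._≟_ _ z∈)
  ... | inj₁ h with ∈-map⁻ (λ v → + x ℤ.+ v) h
  ...   | v , v∈ , e = x , v , inj₁ refl , v∈ , e
  V-∷⁻ {x} {x′} P z∈ | inj₂ h with ∈-map⁻ (λ v → + x′ ℤ.+ v) h
  ...   | v , v∈ , e = x′ , v , inj₂ refl , v∈ , e

  V-[]⁺ : 0ℤ ∈ V []
  V-[]⁺ = here refl

  V-[]⁻ : ∀ {z} → z ∈ V [] → z ≡ 0ℤ
  V-[]⁻ (here e) = e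

V-++⁺ : ∀ P {Q u v} → u ∈ V P → v ∈ V Q → u ℤ.+ v ∈ V (P ++ Q)
V-++⁺ [] {Q} {v = v} u∈ v∈ with refl ← V-[]⁻ u∈ = subst (_∈ V Q) (sym (ℤₚ.+-identityˡ v)) v∈
V-++⁺ ((x , x′) ∷ P) {Q} {v = v} u∈ v∈ with V-∷⁻ P u∈
... | y , w , inj₁ refl , w∈ , refl = subst (_∈ V ((x , x′) ∷ P ++ Q)) (sym (ℤₚ.+-assoc (+ y) w v))
                                        (V-∷ˡ (P ++ Q) (V-++⁺ P w∈ v∈))
... | y , w , inj₂ refl , w∈ , refl = subst (_∈ V ((x , x′) ∷ P ++ Q)) (sym (ℤₚ.+-assoc (+ y) w v))
                                        (V-∷ʳ (P ++ Q) (V-++⁺ P w∈ v∈))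

V-choice : ∀ P {t} → Unique (flat P) → t ∈ V P →
  ∃[ T ] Unique T × (∀ {x} → x ∈ T → x ∈ flat P) × length T ≡ length P × + sum T ≡ t
V-choice [] u t∈ = [] , [] , (λ ()) , refl , sym (V-[]⁻ t∈)
V-choice ((x , x′) ∷ P) (x∉ ∷ x′∉ ∷ u) t∈ with V-∷⁻ P t∈
... | y , v , inj₁ refl , v∈ , refl with V-choice P u v∈
...   | T , uT , T⊆ , len , e =
  y ∷ T , All.tabulate (λ z∈ → All.lookup x∉ (there (T⊆ z∈))) ∷ uT
  , (λ { (here refl) → here refl ; (there z∈) → there (there (T⊆ z∈)) })
  , cong suc len , trans (ℤₚ.pos-+ y (sum T)) (cong (λ z → + y ℤ.+ z) e)
V-choice ((x , x′) ∷ P) (x∉ ∷ x′∉ ∷ u) t∈ | y , v , inj₂ refl , v∈ , refl with V-choice P u v∈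
...   | T , uT , T⊆ , len , e =
  y ∷ T , All.tabulate (λ z∈ → All.lookup x′∉ (T⊆ z∈)) ∷ uT
  , (λ { (here refl) → there (here refl) ; (there z∈) → there (there (T⊆ z∈)) })
  , cong suc len , trans (ℤₚ.pos-+ y (sum T)) (cong (λ z → + y ℤ.+ z) e)

V-bounded : ∀ P {N} → (∀ {x} → x ∈ flat P → x ≤ N) → ∀ {v} → v ∈ V P → ∣ v ∣ ≤ length P * N
V-bounded [] h v∈ with refl ← V-[]⁻ v∈ = z≤n
V-bounded ((x , x′) ∷ P) h z∈ with V-∷⁻ P z∈
... | y , v , inj₁ refl , v∈ , refl = ≤-trans (ℤₚ.∣i+j∣≤∣i∣+∣j∣ (+ y) v)
  (+-mono-≤ (h (here refl)) (V-bounded P (h ∘ there ∘ there) v∈))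
... | y , v , inj₂ refl , v∈ , refl = ≤-trans (ℤₚ.∣i+j∣≤∣i∣+∣j∣ (+ y) v)
  (+-mono-≤ (h (there (here refl))) (V-bounded P (h ∘ there ∘ there) v∈))

V-nonempty : ∀ P → 1 ≤ length (V P)
V-nonempty [] = ∈-length V-[]⁺
V-nonempty ((x , x′) ∷ P) = ≤-trans (V-nonempty P)
  (length-injection (λ v → + x ℤ.+ v) (V-unique P) (V-∷ˡ P) (λ _ _ → ℤ-cancelˡ (+ x)))

-- Sets almost invariant under translation

missing : List ℤ → ℤ → ℕ
missing S y = count (λ v → ¬? ((v ℤ.+ y) ∈? S)) S

missing-0 : ∀ S → missing S 0ℤ ≡ 0
missing-0 S = count-none _ S (λ {v} v∈ ∉ → ∉ (subst (_∈ S) (sym (ℤₚ.+-identityʳ v)) v∈))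

-- If v leaves S under the shift by y + z, then either v + y is already outside S, or v + y lies in
-- S and leaves it under z; the map v ↦ v + y is injective. Thus `missing S` behaves like a norm,
-- and near invariance under single differences passes to sums of them.
missing-+ : ∀ {S} → Unique S → ∀ y z → missing S (y ℤ.+ z) ≤ missing S y + missing S z
missing-+ {S} u y z = begin
  length F                          ≡⟨ count-partition (out? y) F ⟩
  length F₁ + length F₂             ≤⟨ +-mono-≤ into₁ into₂ ⟩
  missing S y + missing S z         ∎
  where
  open ≤-Reasoning
  out? : ∀ y v → Dec (¬ (v ℤ.+ y ∈ S))
  out? y v = ¬? ((v ℤ.+ y) ∈? S)
  F F₁ F₂ : List ℤ
  F  = filter (out? (y ℤ.+ z)) S
  F₁ = filter (out? y) F
  F₂ = filter (¬? ∘ out? y) F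
  uF : Unique F
  uF = Unique.filter⁺ (out? (y ℤ.+ z)) u
  into₁ : length F₁ ≤ missing S y
  into₁ = length-⊆ (Unique.filter⁺ (out? y) uF) λ v∈ →
    case ∈-filter⁻ (out? y) {xs = F} v∈ of λ (v∈F , p) →
    ∈-filter⁺ (out? y) (proj₁ (∈-filter⁻ (out? (y ℤ.+ z)) {xs = S} v∈F)) p
  into₂ : length F₂ ≤ missing S z
  into₂ = length-injection (λ v → v ℤ.+ y) (Unique.filter⁺ (¬? ∘ out? y) uF)
    (λ {v} v∈ → case ∈-filter⁻ (¬? ∘ out? y) {xs = F} v∈ of λ (v∈F , p) →
      ∈-filter⁺ (out? z) (decidable-stable ((v ℤ.+ y) ∈? S) p)
        (subst (λ w → ¬ (w ∈ S)) (sym (ℤₚ.+-assoc v y z)) (proj₂ (∈-filter⁻ (out? (y ℤ.+ z)) {xs = S} v∈F))))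
    (λ _ _ → ℤ-cancelʳ y)

Stable : ℕ → List ℤ → List ℕ → Set
Stable g S R = ∀ {x x′} → x ∈ R → x′ ∈ R → g * missing S (+ x ℤ.- + x′) ≤ length S

stable-E : ∀ {g S R} → Unique S → Stable g S R → ∀ q {y} → y ∈ E R q →
  g * missing S y ≤ q * length S
stable-E {g} {S} u st zero y∈ with refl ← E-zero⁻ y∈ = ≤-reflexive (trans (cong (g *_) (missing-0 S)) (*-zeroʳ g))
stable-E {g} {S} {R} u st (suc q) y∈ with E-suc⁻ {R} y∈
... | b , b′ , y′ , b∈ , b′∈ , y′∈ , refl = begin
  g * missing S (d ℤ.+ y′)              ≤⟨ *-monoʳ-≤ g (missing-+ u d y′) ⟩
  g * (missing S d + missing S y′)      ≡⟨ *-distribˡ-+ g (missing S d) (missing S y′) ⟩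
  g * missing S d + g * missing S y′    ≤⟨ +-mono-≤ (st b∈ b′∈) (stable-E {g} u st q y′∈) ⟩
  length S + q * length S               ∎
  where
  open ≤-Reasoning
  d = + b ℤ.- + b′

-- A sum x + v lies outside x′ + V P exactly when v + (x - x′) is missing from V P. So a pair under
-- which V P is not stable is a pair that enlarges V P.
V-grow : ∀ x x′ P → length (V P) + missing (V P) (+ x ℤ.- + x′) ≤ length (V ((x′ , x) ∷ P))
V-grow x x′ P = subst (_≤ length (V ((x′ , x) ∷ P)))
  (trans (length-++ L₁) (cong₂ _+_ (length-map _ S) (length-map _ F)))
  (length-⊆ (Unique.++⁺ (Unique.map⁺ (ℤ-cancelˡ (+ x′)) (V-unique P))
                        (Unique.map⁺ (ℤ-cancelˡ (+ x)) (Unique.filter⁺ out? (V-unique P))) disj) sub)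
  where
  S = V P
  out? : ∀ v → Dec (¬ (v ℤ.+ (+ x ℤ.- + x′) ∈ S))
  out? v = ¬? ((v ℤ.+ (+ x ℤ.- + x′)) ∈? S)
  F = filter out? S
  L₁ L₂ : List ℤ
  L₁ = map (λ v → + x′ ℤ.+ v) S
  L₂ = map (λ v → + x ℤ.+ v) F
  disj : ∀ {z} → z ∈ L₁ × z ∈ L₂ → ⊥
  disj (z∈₁ , z∈₂) with ∈-map⁻ (λ v → + x′ ℤ.+ v) z∈₁ | ∈-map⁻ (λ v → + x ℤ.+ v) z∈₂
  ... | v , v∈ , refl | w , w∈ , e =
    proj₂ (∈-filter⁻ out? {xs = S} w∈) (subst (_∈ S) (move (+ x) (+ x′) v w e) v∈)
    where
    l₁ : ∀ x x′ w → w ℤ.+ (x ℤ.- x′) ≡ x ℤ.+ w ℤ.- x′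
    l₁ = ℤ-ring
    l₂ : ∀ x′ v → x′ ℤ.+ v ℤ.- x′ ≡ v
    l₂ = ℤ-ring
    move : ∀ x x′ v w → x′ ℤ.+ v ≡ x ℤ.+ w → v ≡ w ℤ.+ (x ℤ.- x′)
    move x x′ v w e = sym (trans (l₁ x x′ w) (trans (cong (ℤ._- x′) (sym e)) (l₂ x′ v)))
  sub : ∀ {z} → z ∈ L₁ ++ L₂ → z ∈ V ((x′ , x) ∷ P)
  sub z∈ with ∈-++⁻ L₁ z∈
  ... | inj₁ h with ∈-map⁻ (λ v → + x′ ℤ.+ v) h
  ...   | v , v∈ , refl = V-∷ˡ P v∈
  sub z∈ | inj₂ h with ∈-map⁻ (λ v → + x ℤ.+ v) h
  ...   | v , v∈ , refl = V-∷ʳ P (proj₁ (∈-filter⁻ out? {xs = S} v∈))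

-- Double counting: the pairs in S × T fall on at most 2 |T| sums, and a sum w together with s
-- determines t, so some w has at least |S| / 2 representations.
popular : ∀ {S T W} → (∀ {s t} → s ∈ S → t ∈ T → s ℤ.+ t ∈ W) →
  Unique T → 1 ≤ length S → 1 ≤ length T → length W ≤ 2 * length T →
  ∃[ w ] w ∈ W × length S ≤ 2 * count (λ s → (w ℤ.- s) ∈? T) S
popular {S} {T} {W} sub uT 1≤S 1≤T W≤ with any? (λ w → length S ≤? 2 * count (λ s → (w ℤ.- s) ∈? T) S) W
... | yes p = find p
... | no ¬p = ⊥-elim (<-irrefl refl (begin-strict
  2 * (length S * length T)                     ≤⟨ *-monoʳ-≤ 2 (∑-≥ (λ s → count (R? s) W) (length T) S row) ⟩
  2 * ∑ (λ s → count (R? s) W) S                ≡⟨ cong (2 *_) (double-count R? S W) ⟩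
  2 * ∑ (λ w → count (λ s → R? s w) S) W        ≤⟨ *-monoʳ-≤ 2 (∑-≤ _ c W col) ⟩
  2 * (length W * c)                            ≤⟨ *-monoʳ-≤ 2 (*-monoˡ-≤ c W≤) ⟩
  2 * (2 * length T * c)                        ≡⟨ e₁ (length T) c ⟩
  2 * length T * (2 * c)                        <⟨ *-monoʳ-< (2 * length T) {{m*n≢0 2 (length T) {{_}} {{>-nonZero 1≤T}}}} 2c<S ⟩
  2 * length T * length S                       ≡⟨ e₂ (length T) (length S) ⟩
  2 * (length S * length T)                     ∎))
  where
  open ≤-Reasoning
  R? : ∀ s w → Dec (w ℤ.- s ∈ T)
  R? s w = (w ℤ.- s) ∈? T
  -- The largest integer with 2 c < |S|, hence a bound for every count that fails the claim.
  c = pred (length S) / 2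
  e₁ : ∀ t c → 2 * (2 * t * c) ≡ 2 * t * (2 * c)
  e₁ = ℕ-ring
  e₂ : ∀ t s → 2 * t * s ≡ 2 * (s * t)
  e₂ = ℕ-ring
  sp : suc (pred (length S)) ≡ length S
  sp = suc-pred (length S) {{>-nonZero 1≤S}}
  2c<S : 2 * c < length S
  2c<S = ≤-trans (s≤s (≤-trans (≤-reflexive (*-comm 2 c)) (m/n*n≤m (pred (length S)) 2))) (≤-reflexive sp)
  col : ∀ {w} → w ∈ W → count (λ s → R? s w) S ≤ c
  col {w} w∈ = subst (_≤ c) (trans (cong (_/ 2) (*-comm 2 n)) (m*n/n≡m n 2))
    (/-mono-≤ (≤-pred (≤-trans (≰⇒> (λ h → ¬p (lose w∈ h))) (≤-reflexive (sym sp)))) (≤-refl {2}))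
    where
    n = count (λ s → R? s w) S
  row : ∀ {s} → s ∈ S → length T ≤ count (R? s) W
  row {s} s∈ = length-injection (λ t → s ℤ.+ t) uT
    (λ {t} t∈ → ∈-filter⁺ (R? s) (sub s∈ t∈) (subst (_∈ T) (sym (l s t)) t∈))
    (λ _ _ → ℤ-cancelˡ s)
    where
    l : ∀ a u → a ℤ.+ u ℤ.- a ≡ u
    l = ℤ-ring

-- Exponential growth of choice sums, and absorption

bernoulli : ∀ g m → (g + m) * g ^ m ≤ g * suc g ^ m
bernoulli g zero = ≤-reflexive (cong (_* 1) (+-identityʳ g))
bernoulli g (suc m) = begin
  (g + suc m) * (g * g ^ m)              ≤⟨ m≤m+n _ (m * g ^ m) ⟩
  (g + suc m) * (g * g ^ m) + m * g ^ m  ≡⟨ e g m (g ^ m) ⟩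
  suc g * ((g + m) * g ^ m)              ≤⟨ *-monoʳ-≤ (suc g) (bernoulli g m) ⟩
  suc g * (g * suc g ^ m)                ≡⟨ e₂ g (suc g ^ m) ⟩
  g * (suc g * suc g ^ m)                ∎
  where
  open ≤-Reasoning
  e : ∀ g m p → (g + (1 + m)) * (g * p) + m * p ≡ (1 + g) * ((g + m) * p)
  e = ℕ-ring
  e₂ : ∀ g q → (1 + g) * (g * q) ≡ g * ((1 + g) * q)
  e₂ = ℕ-ring

doubling : ∀ g .{{_ : NonZero g}} → 2 * g ^ g ≤ suc g ^ g
doubling g = *-cancelˡ-≤ g (≤-trans (≤-reflexive (e g (g ^ g))) (bernoulli g g))
  where
  e : ∀ g p → g * (2 * p) ≡ (g + g) * p
  e = ℕ-ring

^-distribʳ-* : ∀ a b n → (a * b) ^ n ≡ a ^ n * b ^ n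
^-distribʳ-* a b zero = refl
^-distribʳ-* a b (suc n) = trans (cong (a * b *_) (^-distribʳ-* a b n)) (e a b (a ^ n) (b ^ n))
  where
  e : ∀ a b p q → a * b * (p * q) ≡ a * p * (b * q)
  e = ℕ-ring

-- The hypothesis is v ≥ (1 + 1 / g) ^ (g h) with denominators cleared, and (1 + 1 / g) ^ g ≥ 2 by
-- Bernoulli.
many-steps : ∀ g h .{{_ : NonZero g}} v → suc g ^ (g * h) ≤ g ^ (g * h) * v → 2 ^ h ≤ v
many-steps g h v le = *-cancelˡ-≤ (g ^ (g * h)) {{m^n≢0 g (g * h)}} (begin
  g ^ (g * h) * 2 ^ h       ≡⟨ cong (_* 2 ^ h) (^-*-assoc g g h) ⟨
  (g ^ g) ^ h * 2 ^ h       ≡⟨ *-comm ((g ^ g) ^ h) (2 ^ h) ⟩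
  2 ^ h * (g ^ g) ^ h       ≡⟨ ^-distribʳ-* 2 (g ^ g) h ⟨
  (2 * g ^ g) ^ h           ≤⟨ ^-monoˡ-≤ h (doubling g) ⟩
  (suc g ^ g) ^ h           ≡⟨ ^-*-assoc (suc g) g h ⟩
  suc g ^ (g * h)           ≤⟨ le ⟩
  g ^ (g * h) * v           ∎)
  where open ≤-Reasoning

↭-extract : ∀ {B} P {R x x′} → x ∈ R → x′ ∈ R → x ≢ x′ → B ↭ flat P ++ R →
  ∃[ R′ ] B ↭ flat ((x , x′) ∷ P) ++ R′
↭-extract P {R} {x} {x′} x∈ x′∈ x≢x′ p with ∈⇒↭ x∈
... | R₁ , q with ∈-resp-↭ q x′∈
... | here x′≡x   = contradiction (sym x′≡x) x≢x′
... | there x′∈R₁ with ∈⇒↭ x′∈R₁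
... | R₂ , r = R₂ , ↭-trans p (↭-trans (++⁺ˡ (flat P) (↭-trans q (prep x r))) (shifts (flat P) (x ∷ x′ ∷ [])))

module Absorb (g h : ℕ) .{{_ : NonZero g}} (B : List ℕ)
  (small : ∀ Q R → B ↭ flat Q ++ R → length (V Q) < 2 ^ h) where

  -- Each unstable pair multiplies |V Q| by more than 1 + 1 / g, so g h of them would give 2 ^ h
  -- choice sums. As the goal is ⊥, stability is claimed to `k` at once; a pair that violates it
  -- resumes the run with that pair added to Q.
  run : ∀ fuel Q R → B ↭ flat Q ++ R → length Q + fuel ≡ g * h →
    suc g ^ length Q ≤ g ^ length Q * length (V Q) →
    (∀ Q R → B ↭ flat Q ++ R → length Q ≤ g * h → Stable g (V Q) R → ⊥) → ⊥
  run zero Q R p len pot k = <-irrefl refl (<-≤-trans (small Q R p) (many-steps g h (length (V Q)) pot′))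
    where
    len′ : length Q ≡ g * h
    len′ = trans (sym (+-identityʳ _)) len
    pot′ : suc g ^ (g * h) ≤ g ^ (g * h) * length (V Q)
    pot′ = subst (λ m → suc g ^ m ≤ g ^ m * length (V Q)) len′ pot
  run (suc fuel) Q R p len pot k = k Q R p (≤-trans (m≤m+n _ _) (≤-reflexive len)) stable
    where
    stable : Stable g (V Q) R
    stable {x} {x′} x∈ x′∈ with g * missing (V Q) (+ x ℤ.- + x′) ≤? length (V Q)
    ... | yes le = le
    ... | no ¬le with x′ ≟ x
    ... | yes refl = ⊥-elim (¬le (≤-trans (≤-reflexive
            (trans (cong (g *_) (trans (cong (missing (V Q)) (ℤₚ.+-inverseʳ (+ x))) (missing-0 (V Q)))) (*-zeroʳ g))) z≤n))
    ... | no x≢x′ with ↭-extract Q x′∈ x∈ x≢x′ p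
    ... | R′ , p′ = ⊥-elim (run fuel ((x′ , x) ∷ Q) R′ p′ (trans (sym (+-suc (length Q) fuel)) len) grown k)
      where
      open ≤-Reasoning
      v m : ℕ
      v = length (V Q)
      m = missing (V Q) (+ x ℤ.- + x′)
      e₁ : ∀ g p v → (1 + g) * (p * v) ≡ p * (g * v + v)
      e₁ = ℕ-ring
      e₂ : ∀ g p v m → p * (g * v + g * m) ≡ g * p * (v + m)
      e₂ = ℕ-ring
      grown : suc g * suc g ^ length Q ≤ g * g ^ length Q * length (V ((x′ , x) ∷ Q))
      grown = begin
        suc g * suc g ^ length Q                ≤⟨ *-monoʳ-≤ (suc g) pot ⟩
        suc g * (g ^ length Q * v)              ≡⟨ e₁ g (g ^ length Q) v ⟩
        g ^ length Q * (g * v + v)              ≤⟨ *-monoʳ-≤ (g ^ length Q) (+-monoʳ-≤ (g * v) (<⇒≤ (≰⇒> ¬le))) ⟩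
        g ^ length Q * (g * v + g * m)          ≡⟨ e₂ g (g ^ length Q) v m ⟩
        g * g ^ length Q * (v + m)              ≤⟨ *-monoʳ-≤ (g * g ^ length Q) (V-grow x x′ Q) ⟩
        g * g ^ length Q * length (V ((x′ , x) ∷ Q)) ∎

Absorber : ℕ → List (ℕ × ℕ) → List ℕ → ℤ → Set
Absorber q P R t = t ∈ V P × (∀ {y} → y ∈ E R q → t ℤ.+ y ∈ V P)

-- A set V Q with |V Q + V P| ≤ 2 |V P| has a sum t with at least |V Q| / 2 representations, while
-- stability says that V Q is moved out of itself by y in at most |V Q| / 4 places.
popular-absorber : ∀ q .{{_ : NonZero q}} Q P R → Stable (4 * q) (V Q) R →
  length (V (Q ++ P)) ≤ 2 * length (V P) → ∃[ t ] Absorber q (Q ++ P) R t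
popular-absorber q Q P R st le
  with popular {V Q} {V P} {V (Q ++ P)} (λ u∈ v∈ → V-++⁺ Q u∈ v∈) (V-unique P) (V-nonempty Q) (V-nonempty P) le
... | t , t∈ , pop = t , t∈ , absorb
  where
  open ≤-Reasoning
  S? : ∀ v → Dec (t ℤ.- v ∈ V P)
  S? v = (t ℤ.- v) ∈? V P
  l : ∀ t v y → v ℤ.+ y ℤ.+ (t ℤ.- v) ≡ t ℤ.+ y
  l = ℤ-ring
  absorb : ∀ {y} → y ∈ E R q → t ℤ.+ y ∈ V (Q ++ P)
  absorb {y} y∈ with any? (λ v → S? v ×-dec ((v ℤ.+ y) ∈? V Q)) (V Q)
  ... | yes a with find a
  ...   | v , v∈ , s , vy = subst (_∈ V (Q ++ P)) (l t v y) (V-++⁺ Q vy s)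
  absorb {y} y∈ | no ¬a = ⊥-elim (<-irrefl refl (begin-strict
    length (V Q)                   <⟨ m<m+n (length (V Q)) (V-nonempty Q) ⟩
    length (V Q) + length (V Q)    ≡⟨ e₂ (length (V Q)) ⟩
    2 * length (V Q)               ≤⟨ *-monoʳ-≤ 2 pop ⟩
    2 * (2 * count S? (V Q))       ≤⟨ *-monoʳ-≤ 2 (*-monoʳ-≤ 2 inside) ⟩
    2 * (2 * missing (V Q) y)      ≡⟨ *-assoc 2 2 (missing (V Q) y) ⟨
    4 * missing (V Q) y            ≤⟨ quarter ⟩
    length (V Q)                   ∎))
    where
    e₂ : ∀ v → v + v ≡ 2 * v
    e₂ = ℕ-ring
    inside : count S? (V Q) ≤ missing (V Q) y
    inside = length-⊆ (Unique.filter⁺ S? (V-unique Q)) (λ v∈ →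
      case ∈-filter⁻ S? {xs = V Q} v∈ of λ (v∈Q , s) →
      ∈-filter⁺ (λ v → ¬? ((v ℤ.+ y) ∈? V Q)) v∈Q (λ vy → ¬a (lose v∈Q (s , vy))))
    e : ∀ q m → 4 * q * m ≡ q * (4 * m)
    e = ℕ-ring
    quarter : 4 * missing (V Q) y ≤ length (V Q)
    quarter = *-cancelˡ-≤ q (≤-trans (≤-reflexive (sym (e q (missing (V Q) y)))) (stable-E {4 * q} (V-unique Q) st q y∈))

module _ (q h : ℕ) .{{_ : NonZero q}} (B : List ℕ)
  (small : ∀ Q R → B ↭ flat Q ++ R → length (V Q) < 2 ^ h) where

  private
    g = 4 * q
    instance
      g≢0 : NonZero (4 * q)
      g≢0 = m*n≢0 4 q

  -- A stable Q is taken from what is left of B. If joining Q to P more than doubles the set of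
  -- choice sums, Q is kept and the counter i increases, which `small` allows at most h times.
  -- Otherwise the hypothesis of `popular-absorber` holds. Every round uses at most g h pairs.
  absorb : ∀ fuel i P R → i + fuel ≡ h → B ↭ flat P ++ R → 2 ^ i ≤ length (V P) →
    1 ≤ length P → length P ≤ suc (i * (g * h)) →
    (∀ P R t → B ↭ flat P ++ R → 1 ≤ length P → length P ≤ suc (h * (g * h)) → Absorber q P R t → ⊥) → ⊥
  absorb zero i P R i≡h p big 1≤P P≤ k = <-irrefl refl (<-≤-trans (small P R p)
    (subst (λ j → 2 ^ j ≤ length (V P)) (trans (sym (+-identityʳ i)) i≡h) big))
  absorb (suc fuel) i P R i+f≡h p big 1≤P P≤ k =
    Absorb.run g h R smallR (g * h) [] R ↭-refl refl (≤-trans (V-nonempty []) (≤-reflexive (sym (+-identityʳ _)))) step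
    where
    smallR : ∀ Q R′ → R ↭ flat Q ++ R′ → length (V Q) < 2 ^ h
    smallR Q R′ r = small Q (flat P ++ R′)
      (↭-trans p (↭-trans (++⁺ˡ (flat P) r) (shifts (flat P) (flat Q))))
    si+f≡h : suc i + fuel ≡ h
    si+f≡h = trans (sym (+-suc i fuel)) i+f≡h
    module _ (Q : List (ℕ × ℕ)) (R′ : List ℕ) (r : R ↭ flat Q ++ R′) (Q≤ : length Q ≤ g * h) where
      p′ : B ↭ flat (Q ++ P) ++ R′
      p′ = ↭-trans p (↭-trans (++⁺ˡ (flat P) r) (↭-trans (shifts (flat P) (flat Q))
             (↭-reflexive (trans (sym (++-assoc (flat Q) (flat P) R′)) (cong (_++ R′) (sym (flat-++ Q P)))))))
      1≤QP : 1 ≤ length (Q ++ P)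
      1≤QP = ≤-trans 1≤P (≤-trans (m≤n+m (length P) (length Q)) (≤-reflexive (sym (length-++ Q))))
      len : length (Q ++ P) ≤ suc (suc i * (g * h))
      len = ≤-trans (≤-reflexive (length-++ Q)) (≤-trans (+-mono-≤ Q≤ P≤) (≤-reflexive (+-suc (g * h) _)))
    step : ∀ Q R′ → R ↭ flat Q ++ R′ → length Q ≤ g * h → Stable g (V Q) R′ → ⊥
    step Q R′ r Q≤ st with length (V (Q ++ P)) ≤? 2 * length (V P)
    ... | no ¬le = absorb fuel (suc i) (Q ++ P) R′ si+f≡h (p′ Q R′ r Q≤)
                     (≤-trans (*-monoʳ-≤ 2 big) (<⇒≤ (≰⇒> ¬le))) (1≤QP Q R′ r Q≤) (len Q R′ r Q≤) k
    ... | yes le with popular-absorber q Q P R′ st le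
    ...   | t , ab = k (Q ++ P) R′ t (p′ Q R′ r Q≤) (1≤QP Q R′ r Q≤)
              (≤-trans (len Q R′ r Q≤)
                (s≤s (*-monoˡ-≤ (g * h) (≤-trans (m≤m+n (suc i) fuel) (≤-reflexive si+f≡h))))) ab

-- Integer vectors

0≤+ : ∀ {a b} → 0ℤ ℤ.≤ a → 0ℤ ℤ.≤ b → 0ℤ ℤ.≤ a ℤ.+ b
0≤+ p q = ℤₚ.+-mono-≤ p q

0≤* : ∀ {a b} → 0ℤ ℤ.≤ a → 0ℤ ℤ.≤ b → 0ℤ ℤ.≤ a ℤ.* b
0≤* {+ m} {+ n} (+≤+ _) (+≤+ _) = subst (0ℤ ℤ.≤_) (ℤₚ.pos-* m n) (+≤+ z≤n)

0≤square : ∀ a → 0ℤ ℤ.≤ a ℤ.* a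
0≤square (+ n)    = 0≤* (+≤+ (z≤n {n})) (+≤+ z≤n)
0≤square -[1+ n ] = +≤+ z≤n

≤-by : ∀ {x y t} → y ℤ.- x ≡ t → 0ℤ ℤ.≤ t → x ℤ.≤ y
≤-by e p = ℤₚ.0≤i-j⇒j≤i (subst (0ℤ ℤ.≤_) (sym e) p)

0≤gap : ∀ {x y} → x ℤ.≤ y → 0ℤ ℤ.≤ y ℤ.- x
0≤gap = ℤₚ.i≤j⇒0≤j-i

i≤∣i∣ : ∀ i → i ℤ.≤ + ∣ i ∣
i≤∣i∣ (+ n)    = ℤₚ.≤-refl
i≤∣i∣ -[1+ n ] = ℤ.-≤+

∣i∣≤ : ∀ i {n} → i ℤ.≤ + n → ℤ.- i ℤ.≤ + n → ∣ i ∣ ≤ n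
∣i∣≤ (+ m)    p q = drop‿+≤+ p
∣i∣≤ -[1+ m ] p q = drop‿+≤+ q

i*i≡∣i∣*∣i∣ : ∀ i → i ℤ.* i ≡ + (∣ i ∣ * ∣ i ∣)
i*i≡∣i∣*∣i∣ (+ n)    = sym (ℤₚ.pos-* n n)
i*i≡∣i∣*∣i∣ -[1+ n ] = refl

square-cancel : ∀ m n → m * m ≤ n * n → m ≤ n
square-cancel m n le with m ≤? n
... | yes p = p
... | no ¬p = contradiction le (<⇒≱ (*-mono-< (≰⇒> ¬p) (≰⇒> ¬p)))

-- Truncation towards zero: unlike the floor, it guarantees |m| |q| ≤ |c|, so quotients are never
-- larger than the exact ratio. The price is a remainder of either sign.
div-trunc : ∀ c q → q ≢ 0ℤ → ∃[ m ] ∃[ ρ ] c ≡ m ℤ.* q ℤ.+ ρ × ∣ m ∣ * ∣ q ∣ ≤ ∣ c ∣ × ∣ ρ ∣ < ∣ q ∣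
div-trunc = by-sign
  where
  Result : ℤ → ℤ → Set
  Result c q = ∃[ m ] ∃[ ρ ] c ≡ m ℤ.* q ℤ.+ ρ × ∣ m ∣ * ∣ q ∣ ≤ ∣ c ∣ × ∣ ρ ∣ < ∣ q ∣
  negˡ : ∀ {c q} → Result c q → Result (ℤ.- c) q
  negˡ {c} {q} (m , ρ , e , p , r) = ℤ.- m , ℤ.- ρ , trans (cong ℤ.-_ e) (l m q ρ) ,
    subst₂ _≤_ (cong (_* ∣ q ∣) (sym (ℤₚ.∣-i∣≡∣i∣ m))) (sym (ℤₚ.∣-i∣≡∣i∣ c)) p ,
    subst (_< ∣ q ∣) (sym (ℤₚ.∣-i∣≡∣i∣ ρ)) r
    where
    l : ∀ m q ρ → ℤ.- (m ℤ.* q ℤ.+ ρ) ≡ ℤ.- m ℤ.* q ℤ.+ ℤ.- ρ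
    l = ℤ-ring
  negʳ : ∀ {c q} → Result c q → Result c (ℤ.- q)
  negʳ {c} {q} (m , ρ , e , p , r) = ℤ.- m , ρ , trans e (l m q ρ) ,
    subst (_≤ ∣ c ∣) (cong₂ _*_ (sym (ℤₚ.∣-i∣≡∣i∣ m)) (sym (ℤₚ.∣-i∣≡∣i∣ q))) p ,
    subst (∣ ρ ∣ <_) (sym (ℤₚ.∣-i∣≡∣i∣ q)) r
    where
    l : ∀ m q ρ → m ℤ.* q ℤ.+ ρ ≡ ℤ.- m ℤ.* ℤ.- q ℤ.+ ρ
    l = ℤ-ring
  base : ∀ a b → Result (+ a) (+ suc b)
  base a b = + (a / suc b) , + (a % suc b) ,
    trans (cong +_ (trans (m≡m%n+[m/n]*n a (suc b)) (+-comm (a % suc b) _)))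
      (trans (ℤₚ.pos-+ _ (a % suc b)) (cong (ℤ._+ + (a % suc b)) (ℤₚ.pos-* (a / suc b) (suc b)))) ,
    m/n*n≤m a (suc b) , m%n<n a (suc b)
  pos : ∀ c b → Result c (+ suc b)
  pos (+ a)    b = base a b
  pos -[1+ a ] b = negˡ (base (suc a) b)
  by-sign : ∀ c q → q ≢ 0ℤ → Result c q
  by-sign c (+ zero)  q≢0 = contradiction refl q≢0
  by-sign c (+ suc b) _   = pos c b
  by-sign c -[1+ b ]  _   = negʳ {q = + suc b} (pos c b)

Vector : ℕ → Set
Vector d = Fin d → ℤ

dot : ∀ {d} → Vector d → Vector d → ℤ
dot {zero}  f g = 0ℤ
dot {suc d} f g = f fz ℤ.* g fz ℤ.+ dot (f ∘ fs) (g ∘ fs)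

dot-cong : ∀ {d} {f f′ g g′ : Vector d} → (∀ i → f i ≡ f′ i) → (∀ i → g i ≡ g′ i) → dot f g ≡ dot f′ g′
dot-cong {zero}  p q = refl
dot-cong {suc d} p q = cong₂ ℤ._+_ (cong₂ ℤ._*_ (p fz) (q fz)) (dot-cong (p ∘ fs) (q ∘ fs))

dot-comm : ∀ {d} (f g : Vector d) → dot f g ≡ dot g f
dot-comm {zero}  f g = refl
dot-comm {suc d} f g = cong₂ ℤ._+_ (ℤₚ.*-comm (f fz) (g fz)) (dot-comm (f ∘ fs) (g ∘ fs))

dot-+ : ∀ {d} (f g u : Vector d) → dot (λ i → f i ℤ.+ g i) u ≡ dot f u ℤ.+ dot g u
dot-+ {zero}  f g u = refl
dot-+ {suc d} f g u = trans (cong (λ z → (f fz ℤ.+ g fz) ℤ.* u fz ℤ.+ z) (dot-+ (f ∘ fs) (g ∘ fs) (u ∘ fs)))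
    (e (f fz) (g fz) (u fz) (dot (f ∘ fs) (u ∘ fs)) (dot (g ∘ fs) (u ∘ fs)))
  where
  e : ∀ a b u x y → (a ℤ.+ b) ℤ.* u ℤ.+ (x ℤ.+ y) ≡ (a ℤ.* u ℤ.+ x) ℤ.+ (b ℤ.* u ℤ.+ y)
  e = ℤ-ring

dot-* : ∀ {d} m (f u : Vector d) → dot (λ i → m ℤ.* f i) u ≡ m ℤ.* dot f u
dot-* {zero}  m f u = sym (ℤₚ.*-zeroʳ m)
dot-* {suc d} m f u = trans (cong (λ z → (m ℤ.* f fz) ℤ.* u fz ℤ.+ z) (dot-* m (f ∘ fs) (u ∘ fs)))
    (e m (f fz) (u fz) (dot (f ∘ fs) (u ∘ fs)))
  where
  e : ∀ m a u x → m ℤ.* a ℤ.* u ℤ.+ m ℤ.* x ≡ m ℤ.* (a ℤ.* u ℤ.+ x)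
  e = ℤ-ring

dot-- : ∀ {d} (f g u : Vector d) → dot (λ i → f i ℤ.- g i) u ≡ dot f u ℤ.- dot g u
dot-- {zero}  f g u = refl
dot-- {suc d} f g u = trans (cong (λ z → (f fz ℤ.- g fz) ℤ.* u fz ℤ.+ z) (dot-- (f ∘ fs) (g ∘ fs) (u ∘ fs)))
    (e (f fz) (g fz) (u fz) (dot (f ∘ fs) (u ∘ fs)) (dot (g ∘ fs) (u ∘ fs)))
  where
  e : ∀ a b u x y → (a ℤ.- b) ℤ.* u ℤ.+ (x ℤ.- y) ≡ (a ℤ.* u ℤ.+ x) ℤ.- (b ℤ.* u ℤ.+ y)
  e = ℤ-ring

dot-square : ∀ {d} (f g : Vector d) → dot (λ i → f i ℤ.+ g i) (λ i → f i ℤ.+ g i) ≡ dot f f ℤ.+ + 2 ℤ.* dot f g ℤ.+ dot g g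
dot-square {d} f g = begin
  dot f+g f+g                                      ≡⟨ dot-+ f g f+g ⟩
  dot f f+g ℤ.+ dot g f+g                          ≡⟨ cong₂ ℤ._+_ (trans (dot-comm f f+g) (dot-+ f g f)) (trans (dot-comm g f+g) (dot-+ f g g)) ⟩
  (dot f f ℤ.+ dot g f) ℤ.+ (dot f g ℤ.+ dot g g)  ≡⟨ cong (λ z → (dot f f ℤ.+ z) ℤ.+ (dot f g ℤ.+ dot g g)) (dot-comm g f) ⟩
  (dot f f ℤ.+ dot f g) ℤ.+ (dot f g ℤ.+ dot g g)  ≡⟨ e (dot f f) (dot f g) (dot g g) ⟩
  dot f f ℤ.+ + 2 ℤ.* dot f g ℤ.+ dot g g          ∎
  where
  open ≡-Reasoning
  f+g : Vector d
  f+g i = f i ℤ.+ g i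
  e : ∀ x y z → (x ℤ.+ y) ℤ.+ (y ℤ.+ z) ≡ x ℤ.+ + 2 ℤ.* y ℤ.+ z
  e = ℤ-ring

dot-punchIn : ∀ {d} i (f u : Vector (suc d)) →
  dot f u ≡ f i ℤ.* u i ℤ.+ dot (f ∘ punchIn i) (u ∘ punchIn i)
dot-punchIn fz f u = refl
dot-punchIn {suc d} (fs i) f u = trans
    (cong (λ z → f fz ℤ.* u fz ℤ.+ z) (dot-punchIn i (f ∘ fs) (u ∘ fs)))
    (e (f fz ℤ.* u fz) (f (fs i) ℤ.* u (fs i)) _)
  where
  e : ∀ a b c → a ℤ.+ (b ℤ.+ c) ≡ b ℤ.+ (a ℤ.+ c)
  e = ℤ-ring

dot-∣∣≤ : ∀ {d} {f g : Vector d} F G → (∀ i → ∣ f i ∣ ≤ F) → (∀ i → ∣ g i ∣ ≤ G) → ∣ dot f g ∣ ≤ d * (F * G)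
dot-∣∣≤ {zero}  F G p q = z≤n
dot-∣∣≤ {suc d} {f} {g} F G p q = ≤-trans (ℤₚ.∣i+j∣≤∣i∣+∣j∣ (f fz ℤ.* g fz) _)
  (+-mono-≤ (≤-trans (≤-reflexive (ℤₚ.abs-* (f fz) (g fz))) (*-mono-≤ (p fz) (q fz)))
            (dot-∣∣≤ F G (p ∘ fs) (q ∘ fs)))

0≤dot : ∀ {d} (f : Vector d) → 0ℤ ℤ.≤ dot f f
0≤dot {zero}  f = ℤₚ.≤-refl
0≤dot {suc d} f = 0≤+ (0≤square (f fz)) (0≤dot (f ∘ fs))

square≤dot : ∀ {d} (f : Vector d) i → f i ℤ.* f i ℤ.≤ dot f f
square≤dot f fz = subst (ℤ._≤ dot f f) (ℤₚ.+-identityʳ _) (ℤₚ.+-monoʳ-≤ (f fz ℤ.* f fz) (0≤dot (f ∘ fs)))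
square≤dot f (fs i) = subst (ℤ._≤ dot f f) (ℤₚ.+-identityˡ _)
  (ℤₚ.+-mono-≤ (0≤square (f fz)) (square≤dot (f ∘ fs) i))

dot-E : ∀ {B d m n} (c u : Vector d) → (∀ i → ∣ c i ∣ ≤ m) → (∀ i → u i ∈ E B n) →
  ∀ {b} → b ∈ B → dot c u ∈ E B (d * (m * n))
dot-E {d = zero}  c u p q b∈ = E-zero⁺
dot-E {d = suc d} {m} {n} c u p q b∈ = E-+ (m * n)
  (E-mono b∈ (*-monoˡ-≤ n (p fz)) (E-scale (c fz) (q fz))) (dot-E (c ∘ fs) (u ∘ fs) (p ∘ fs) (q ∘ fs) b∈)

argmax : ∀ {d} (f : Fin (suc d) → ℕ) → ∃[ i ] (∀ j → f j ≤ f i)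
argmax {zero}  f = fz , λ { fz → ≤-refl }
argmax {suc d} f with argmax (f ∘ fs)
... | i , max with f fz ≤? f (fs i)
... | yes p = fs i , λ { fz → p ; (fs j) → max j }
... | no ¬p = fz , λ { fz → ≤-refl ; (fs j) → ≤-trans (max j) (<⇒≤ (≰⇒> ¬p)) }

∣i-j∣≤ : ∀ i j {m n} → ∣ i ∣ ≤ m → ∣ j ∣ ≤ n → ∣ i ℤ.- j ∣ ≤ m + n
∣i-j∣≤ i j p q = ≤-trans (ℤₚ.∣i-j∣≤∣i∣+∣j∣ i j) (+-mono-≤ p q)

∣i+j∣≤ : ∀ i j {m n} → ∣ i ∣ ≤ m → ∣ j ∣ ≤ n → ∣ i ℤ.+ j ∣ ≤ m + n
∣i+j∣≤ i j p q = ≤-trans (ℤₚ.∣i+j∣≤∣i∣+∣j∣ i j) (+-mono-≤ p q)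

-- Generators of the iterated difference sets

dot-0 : ∀ {d} (u : Vector d) → dot (λ _ → 0ℤ) u ≡ 0ℤ
dot-0 {zero}  u = refl
dot-0 {suc d} u = trans (cong (λ z → 0ℤ ℤ.* u fz ℤ.+ z) (dot-0 (u ∘ fs)))
  (cong (ℤ._+ 0ℤ) (ℤₚ.*-zeroˡ (u fz)))

unit : ∀ {d} → Fin d → Vector d
unit fz     fz     = ℤ.1ℤ
unit fz     (fs i) = 0ℤ
unit (fs j) fz     = 0ℤ
unit (fs j) (fs i) = unit j i

∣unit∣≤1 : ∀ {d} (j i : Fin d) → ∣ unit j i ∣ ≤ 1
∣unit∣≤1 fz     fz     = ≤-refl
∣unit∣≤1 fz     (fs i) = z≤n
∣unit∣≤1 (fs j) fz     = z≤n
∣unit∣≤1 (fs j) (fs i) = ∣unit∣≤1 j i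

dot-unit : ∀ {d} (j : Fin d) (u : Vector d) → dot (unit j) u ≡ u j
dot-unit {suc d} fz u = trans (cong (λ z → ℤ.1ℤ ℤ.* u fz ℤ.+ z) (dot-0 (u ∘ fs)))
  (trans (ℤₚ.+-identityʳ _) (ℤₚ.*-identityˡ (u fz)))
dot-unit {suc d} (fs j) u = trans (cong₂ ℤ._+_ (ℤₚ.*-zeroˡ (u fz)) (dot-unit j (u ∘ fs)))
  (ℤₚ.+-identityˡ _)

-- The inequality is |c i| ≤ C N / a without division; the generators have size about a, and the
-- error κ does not grow with N.
Span : List ℕ → ℕ → ∀ {d} → Vector d → ℕ → ℕ → Set
Span B a {d} u C κ = ∀ N {y} → y ∈ E B N →
  ∃[ c ] (∀ i → a * ∣ c i ∣ ≤ C * N) × y ℤ.- dot c u ∈ E B κ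

module _ (B : List ℕ) (r : ℕ) where

  Separated : List ℤ → Set
  Separated = AllPairs (λ x x′ → ¬ (x ℤ.- x′ ∈ E B (r + r)))

  separated-net : ∀ ys → ∃[ X ] Separated X × (∀ {x} → x ∈ X → x ∈ ys) ×
    (∀ {y} → y ∈ ys → y ∈ X ⊎ (∃[ x ] x ∈ X × x ℤ.- y ∈ E B (r + r)))
  separated-net [] = [] , [] , (λ ()) , λ ()
  separated-net (y ∷ ys) with separated-net ys
  ... | X , sep , X⊆ , net with any? (λ x → (x ℤ.- y) ∈? E B (r + r)) X
  ... | yes near = X , sep , there ∘ X⊆ , λ { (here refl) → inj₂ (find near) ; (there y∈) → net y∈ }
  ... | no ¬near = y ∷ X ,
      All.tabulate (λ {x} x∈ h → ¬near (lose x∈ (subst (_∈ E B (r + r)) (e y x) (E-neg (r + r) h)))) ∷ sep ,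
      (λ { (here refl) → here refl ; (there x∈) → there (X⊆ x∈) }) ,
      λ { (here refl) → inj₁ (here refl)
        ; (there z∈) → case net z∈ of λ
            { (inj₁ z∈X) → inj₁ (there z∈X) ; (inj₂ (x , x∈ , p)) → inj₂ (x , there x∈ , p) } }
    where
    e : ∀ x y → ℤ.- (x ℤ.- y) ≡ y ℤ.- x
    e = ℤ-ring

  separated-pair : ∀ {X x x′} → Separated X → x ∈ X → x′ ∈ X → x ℤ.- x′ ∈ E B (r + r) → x ≡ x′
  separated-pair sep (here refl) (here refl) h = refl
  separated-pair (p ∷ sep) (here refl) (there x′∈) h = ⊥-elim (All.lookup p x′∈ h)
  separated-pair {x = x} {x′} (p ∷ sep) (there x∈) (here refl) h =
    ⊥-elim (All.lookup p x∈ (subst (_∈ E B (r + r)) (e x x′) (E-neg (r + r) h)))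
    where
    e : ∀ x y → ℤ.- (x ℤ.- y) ≡ y ℤ.- x
    e = ℤ-ring
  separated-pair (p ∷ sep) (there x∈) (there x′∈) h = separated-pair sep x∈ x′∈ h

  separated-unique : ∀ {X b} → b ∈ B → Separated X → Unique X
  separated-unique b∈ [] = []
  separated-unique b∈ (p ∷ sep) = All.map (λ {x} h e → h (subst (_∈ E B (r + r))
    (sym (trans (cong (λ z → z ℤ.- x) e) (ℤₚ.+-inverseʳ x))) (E-zero∈ b∈ (r + r)))) p ∷ separated-unique b∈ sep

  -- The translates x + E B r of a set with no differences in E B (2 r) are disjoint, and they all
  -- lie in E B (m + r).
  separated-card : ∀ {X b} m → b ∈ B → Separated X → (∀ {x} → x ∈ X → x ∈ E B m) →
    length X * length (E B r) ≤ length (E B (m + r))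
  separated-card {X} m b∈ sep X⊆ = length-packing ℤ._+_ (separated-unique b∈ sep) (E-unique r)
    (λ x∈ e∈ → E-+ m (X⊆ x∈) e∈)
    (λ {x} {x′} {y} {y′} x∈ x′∈ y∈ y′∈ eq →
      let x≡x′ = separated-pair sep x∈ x′∈ (subst (_∈ E B (r + r)) (move x x′ y y′ eq) (E-sub r y′∈ y∈)) in
      x≡x′ , ℤ-cancelˡ x (trans eq (cong (ℤ._+ y′) (sym x≡x′))))
    where
    l₁ : ∀ x y x′ → (x ℤ.+ y) ℤ.- x′ ℤ.- y ≡ x ℤ.- x′
    l₁ = ℤ-ring
    l₂ : ∀ x′ y′ y → (x′ ℤ.+ y′) ℤ.- x′ ℤ.- y ≡ y′ ℤ.- y
    l₂ = ℤ-ring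
    move : ∀ x x′ y y′ → x ℤ.+ y ≡ x′ ℤ.+ y′ → y′ ℤ.- y ≡ x ℤ.- x′
    move x x′ y y′ eq = trans (sym (l₂ x′ y′ y)) (trans (cong (λ z → z ℤ.- x′ ℤ.- y) (sym eq)) (l₁ x y x′))

  module _ .{{_ : NonZero r}} where

    private instance
      2r≢0 : NonZero (r + r)
      2r≢0 = >-nonZero (<-≤-trans (>-nonZero⁻¹ r) (m≤m+n r r))

    -- The generators are a maximal separated subset of E B (4 r). Their translates of E B r fit
    -- into E B (5 r), so slow growth between r and 8 r bounds their number, while maximality makes
    -- them a net.
    initial-span : ∀ {b} → b ∈ B → ∃[ d ] Σ (Vector d) λ u →
      d * length (E B r) ≤ length (E B (8 * r)) ×
      (∀ i → u i ∈ E B (2 * (r + r))) × Span B (r + r) u 1 (r + r)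
    initial-span b∈ with separated-net (E B ((r + r) + (r + r)))
    ... | X , sep , X⊆ , net = length X , u ,
        ≤-trans (separated-card ((r + r) + (r + r)) b∈ sep X⊆) (length-⊆ (E-unique _) (E-mono b∈ 5r≤8r)) ,
        (λ i → subst (λ k → u i ∈ E B k) (e (r + r)) (X⊆ (∈-lookup i))) , span
      where
      u : Vector (length X)
      u = Data.List.lookup X
      e : ∀ a → a + a ≡ 2 * a
      e = ℕ-ring
      e₅ : ∀ r → (r + r) + (r + r) + r + 3 * r ≡ 8 * r
      e₅ = ℕ-ring
      5r≤8r : (r + r) + (r + r) + r ≤ 8 * r
      5r≤8r = ≤-trans (m≤m+n _ (3 * r)) (≤-reflexive (e₅ r))
      nearest : ∀ {y} → y ∈ E B ((r + r) + (r + r)) → ∃[ j ] y ℤ.- u j ∈ E B (r + r)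
      nearest {y} y∈ with net y∈
      ... | inj₁ y∈X = index y∈X , subst (_∈ E B (r + r))
              (trans (sym (ℤₚ.+-inverseʳ y)) (cong (λ z → y ℤ.- z) (lookup-index y∈X))) (E-zero∈ b∈ (r + r))
      ... | inj₂ (x , x∈ , h) = index x∈ , subst (_∈ E B (r + r))
              (trans (e₂ x y) (cong (λ z → y ℤ.- z) (lookup-index x∈))) (E-neg (r + r) h)
        where
        e₂ : ∀ x y → ℤ.- (x ℤ.- y) ≡ y ℤ.- x
        e₂ = ℤ-ring
      -- One block of 2 r differences plus the remainder of the other blocks lies in E B (4 r),
      -- hence near some generator; each block costs one unit of one coefficient and the remainder
      -- stays in E B (2 r).
      peel : ∀ m {y} → y ∈ E B (suc m * (r + r)) → ∃[ c ] (∀ i → ∣ c i ∣ ≤ m) × y ℤ.- dot c u ∈ E B (r + r)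
      peel zero {y} y∈ = (λ _ → 0ℤ) , (λ _ → z≤n) , subst₂ (λ z k → z ∈ E B k)
        (sym (trans (cong (λ z → y ℤ.- z) (dot-0 u)) (ℤₚ.+-identityʳ y))) (+-identityʳ (r + r)) y∈
      peel (suc m) y∈ with E-split (r + r) y∈
      ... | y₁ , y₂ , y₁∈ , y₂∈ , refl with peel m y₂∈
      ... | c , c≤ , h with nearest (E-+ (r + r) y₁∈ h)
      ... | j , h′ = (λ i → unit j i ℤ.+ c i) ,
          (λ i → ∣i+j∣≤ (unit j i) (c i) (∣unit∣≤1 j i) (c≤ i)) ,
          subst (_∈ E B (r + r)) (trans (e₃ y₁ y₂ (dot c u) (u j)) (cong (λ z → y₁ ℤ.+ y₂ ℤ.- z)
            (sym (trans (dot-+ (unit j) c u) (cong (ℤ._+ dot c u) (dot-unit j u)))))) h′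
        where
        e₃ : ∀ y₁ y₂ c w → y₁ ℤ.+ (y₂ ℤ.- c) ℤ.- w ≡ y₁ ℤ.+ y₂ ℤ.- (w ℤ.+ c)
        e₃ = ℤ-ring
      span : Span B (r + r) u 1 (r + r)
      span N y∈ with peel (N / (r + r)) (E-mono b∈ (<⇒≤ (m<n*o⇒m/o<n′ N)) y∈)
        where
        m<n*o⇒m/o<n′ : ∀ N → N < suc (N / (r + r)) * (r + r)
        m<n*o⇒m/o<n′ N = subst (_< suc (N / (r + r)) * (r + r)) (sym (m≡m%n+[m/n]*n N (r + r)))
          (+-monoˡ-< (N / (r + r) * (r + r)) (m%n<n N (r + r)))
      ... | c , c≤ , h = c , (λ i → ≤-trans (*-monoʳ-≤ (r + r) (c≤ i))
              (≤-trans (≤-reflexive (*-comm (r + r) _)) (≤-trans (m/n*n≤m N (r + r)) (≤-reflexive (sym (+-identityʳ N)))))) , h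

-- A gap in the sizes of relations: coefficients bounded by J are forced down to ω. Between ω and J
-- the generators behave as if they were independent. The error 8 κ leaves room for the combined
-- errors of the coordinate vectors that will be compared.
IndependentUpTo : List ℕ → ∀ {d} → Vector d → ℕ → ℕ → ℕ → Set
IndependentUpTo B u κ J ω = ∀ q → (∀ i → ∣ q i ∣ ≤ J) → dot q u ∈ E B (8 * κ) → ∀ i → ∣ q i ∣ ≤ ω

module _ {B : List ℕ} {b₀ : ℕ} (b₀∈ : b₀ ∈ B) {a : ℕ} where

  -- A relation q · u ∈ E B (8 κ) expresses a multiple of u i by the other generators. Dividing the
  -- i-th coefficient by q i leaves an element of some E B N′ with N′ ≤ N / 2, and one iterates.
  eliminate : ∀ {d} {u : Vector (suc d)} {C κ} J .{{_ : NonZero C}} → Span B a u C κ → (∀ i → u i ∈ E B (2 * a)) →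
    ∀ q i → q i ≢ 0ℤ → (∀ j → ∣ q j ∣ ≤ ∣ q i ∣) → ∣ q i ∣ ≤ J → 32 * C * κ ≤ ∣ q i ∣ * a →
    dot q u ∈ E B (8 * κ) → Span B a (u ∘ punchIn i) (4 * C) (4 * (2 * J * a + κ))
  eliminate {d} {u} {C} {κ} J span u∈ q i q≢0 max Q≤J 32Cκ≤Qa rel = <-rec _ step
    where
    Q κ′ : ℕ
    Q  = ∣ q i ∣
    κ′ = 4 * (2 * J * a + κ)
    u′ : Vector d
    u′ = u ∘ punchIn i
    Goal : ℕ → Set
    Goal N = ∀ {y} → y ∈ E B N → ∃[ c ] (∀ j → a * ∣ c j ∣ ≤ 4 * C * N) × y ℤ.- dot c u′ ∈ E B κ′
    step : ∀ N → (∀ {N′} → N′ < N → Goal N′) → Goal N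
    step N rec {y} y∈ with N ≤? κ′
    ... | yes N≤κ′ = (λ _ → 0ℤ) , (λ _ → ≤-trans (≤-reflexive (*-zeroʳ a)) z≤n) ,
      subst (_∈ E B κ′) (sym (trans (cong (λ z → y ℤ.- z) (dot-0 u′)) (ℤₚ.+-identityʳ y))) (E-mono b₀∈ N≤κ′ y∈)
    ... | no N≰κ′ with span N y∈
    ...   | c , c≤ , h with div-trunc (c i) (q i) q≢0
    ...   | m , ρ , c≡ , mQ≤ , ρ<Q = conclude
      where
      N′ : ℕ
      N′ = κ + (∣ ρ ∣ * (2 * a) + ∣ m ∣ * (8 * κ))
      amQ≤ : a * (∣ m ∣ * Q) ≤ C * N
      amQ≤ = ≤-trans (*-monoʳ-≤ a mQ≤) (c≤ i)
      κ′≤N : κ′ ≤ N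
      κ′≤N = <⇒≤ (≰⇒> N≰κ′)
      -- Using the relation m times costs m copies of its error 8 κ. This is at most N / 4 because
      -- its largest coefficient satisfies Q a ≥ 32 C κ.
      32mκ≤N : ∣ m ∣ * (32 * κ) ≤ N
      32mκ≤N = *-cancelˡ-≤ C (begin
        C * (∣ m ∣ * (32 * κ))   ≡⟨ e₁ C ∣ m ∣ κ ⟩
        ∣ m ∣ * (32 * C * κ)     ≤⟨ *-monoʳ-≤ ∣ m ∣ 32Cκ≤Qa ⟩
        ∣ m ∣ * (Q * a)          ≡⟨ e₂ ∣ m ∣ Q a ⟩
        a * (∣ m ∣ * Q)          ≤⟨ amQ≤ ⟩
        C * N                    ∎)
        where
        open ≤-Reasoning
        e₁ : ∀ C m κ → C * (m * (32 * κ)) ≡ m * (32 * C * κ)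
        e₁ = ℕ-ring
        e₂ : ∀ m Q a → m * (Q * a) ≡ a * (m * Q)
        e₂ = ℕ-ring
      2N′≤N : 2 * N′ ≤ N
      2N′≤N = *-cancelˡ-≤ 2 (begin
        2 * (2 * N′)                                        ≡⟨ e₁ κ (∣ ρ ∣) a (∣ m ∣) ⟩
        4 * (2 * ∣ ρ ∣ * a + κ) + ∣ m ∣ * (32 * κ)          ≤⟨ +-mono-≤ (*-monoʳ-≤ 4 (+-monoˡ-≤ κ
          (*-monoˡ-≤ a (*-monoʳ-≤ 2 (≤-trans (<⇒≤ ρ<Q) Q≤J))))) 32mκ≤N ⟩
        κ′ + N                                              ≤⟨ +-monoˡ-≤ N κ′≤N ⟩
        N + N                                               ≡⟨ e₂ N ⟩
        2 * N                                               ∎)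
        where
        open ≤-Reasoning
        e₁ : ∀ κ ρ a m → 2 * (2 * (κ + (ρ * (2 * a) + m * (8 * κ)))) ≡ 4 * (2 * ρ * a + κ) + m * (32 * κ)
        e₁ = ℕ-ring
        e₂ : ∀ N → N + N ≡ 2 * N
        e₂ = ℕ-ring
      N′<N : N′ < N
      N′<N with N′ ≟ 0
      ... | yes N′≡0 = ≤-<-trans (≤-reflexive N′≡0) (≤-<-trans z≤n (≰⇒> N≰κ′))
      ... | no N′≢0 = <-≤-trans (m<m+n N′ (≤-trans (n≢0⇒n>0 N′≢0) (≤-reflexive (sym (+-identityʳ N′))))) 2N′≤N
      c″ : Vector d
      c″ j = c (punchIn i j) ℤ.- m ℤ.* q (punchIn i j)
      z : ℤ
      z = (y ℤ.- dot c u) ℤ.+ (ρ ℤ.* u i ℤ.+ m ℤ.* dot q u)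
      z∈ : z ∈ E B N′
      z∈ = E-+ κ h (E-+ (∣ ρ ∣ * (2 * a)) (E-scale ρ (u∈ i)) (E-scale m rel))
      z≡ : z ≡ y ℤ.- dot c″ u′
      z≡ = begin
        (y ℤ.- dot c u) ℤ.+ (ρ ℤ.* u i ℤ.+ m ℤ.* dot q u)
          ≡⟨ cong₂ (λ s t → (y ℤ.- s) ℤ.+ (ρ ℤ.* u i ℤ.+ m ℤ.* t)) (dot-punchIn i c u) (dot-punchIn i q u) ⟩
        (y ℤ.- (c i ℤ.* u i ℤ.+ cu)) ℤ.+ (ρ ℤ.* u i ℤ.+ m ℤ.* (q i ℤ.* u i ℤ.+ qu))
          ≡⟨ cong (λ s → (y ℤ.- (s ℤ.* u i ℤ.+ cu)) ℤ.+ (ρ ℤ.* u i ℤ.+ m ℤ.* (q i ℤ.* u i ℤ.+ qu))) c≡ ⟩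
        (y ℤ.- ((m ℤ.* q i ℤ.+ ρ) ℤ.* u i ℤ.+ cu)) ℤ.+ (ρ ℤ.* u i ℤ.+ m ℤ.* (q i ℤ.* u i ℤ.+ qu))
          ≡⟨ e₁ y m (q i) ρ (u i) cu qu ⟩
        y ℤ.- (cu ℤ.- m ℤ.* qu)
          ≡⟨ cong (λ s → y ℤ.- (cu ℤ.- s)) (dot-* m (q ∘ punchIn i) u′) ⟨
        y ℤ.- (cu ℤ.- dot (λ j → m ℤ.* q (punchIn i j)) u′)
          ≡⟨ cong (λ s → y ℤ.- s) (dot-- (c ∘ punchIn i) (λ j → m ℤ.* q (punchIn i j)) u′) ⟨
        y ℤ.- dot c″ u′ ∎
        where
        open ≡-Reasoning
        cu qu : ℤ
        cu = dot (c ∘ punchIn i) u′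
        qu = dot (q ∘ punchIn i) u′
        e₁ : ∀ y m q ρ u cu qu →
          (y ℤ.- ((m ℤ.* q ℤ.+ ρ) ℤ.* u ℤ.+ cu)) ℤ.+ (ρ ℤ.* u ℤ.+ m ℤ.* (q ℤ.* u ℤ.+ qu)) ≡ y ℤ.- (cu ℤ.- m ℤ.* qu)
        e₁ = ℤ-ring
      conclude : ∃[ c ] (∀ j → a * ∣ c j ∣ ≤ 4 * C * N) × y ℤ.- dot c u′ ∈ E B κ′
      conclude with rec N′<N z∈
      ... | c₃ , c₃≤ , h₃ = (λ j → c″ j ℤ.+ c₃ j) , bound , subst (_∈ E B κ′) (begin
          z ℤ.- dot c₃ u′                          ≡⟨ cong (ℤ._- dot c₃ u′) z≡ ⟩
          y ℤ.- dot c″ u′ ℤ.- dot c₃ u′            ≡⟨ e₁ y (dot c″ u′) (dot c₃ u′) ⟩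
          y ℤ.- (dot c″ u′ ℤ.+ dot c₃ u′)          ≡⟨ cong (λ s → y ℤ.- s) (dot-+ c″ c₃ u′) ⟨
          y ℤ.- dot (λ j → c″ j ℤ.+ c₃ j) u′       ∎) h₃
        where
        open ≡-Reasoning
        e₁ : ∀ y s t → y ℤ.- s ℤ.- t ≡ y ℤ.- (s ℤ.+ t)
        e₁ = ℤ-ring
        -- The factor 4 closes the induction: c″ accounts for 2 C N, and the recursive call for 4 C
        -- N′ ≤ 2 C N.
        bound : ∀ j → a * ∣ c″ j ℤ.+ c₃ j ∣ ≤ 4 * C * N
        bound j = ≤-trans (*-monoʳ-≤ a (∣i+j∣≤ (c″ j) (c₃ j)
            (∣i-j∣≤ (c (punchIn i j)) (m ℤ.* q (punchIn i j)) ≤-refl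
              (≤-trans (≤-reflexive (ℤₚ.abs-* m _)) (*-monoʳ-≤ ∣ m ∣ (max (punchIn i j))))) ≤-refl))
          (≤-trans (≤-reflexive (e₂ a (∣ c (punchIn i j) ∣) (∣ m ∣ * Q) (∣ c₃ j ∣)))
          (≤-trans (+-mono-≤ (+-mono-≤ (c≤ (punchIn i j)) amQ≤) (c₃≤ j))
          (≤-trans (≤-reflexive (e₃ C N N′)) (≤-trans (+-monoʳ-≤ (2 * (C * N)) (*-monoʳ-≤ (2 * C) 2N′≤N))
            (≤-reflexive (e₄ C N))))))
          where
          e₂ : ∀ a x y z → a * (x + y + z) ≡ a * x + a * y + a * z
          e₂ = ℕ-ring
          e₃ : ∀ C N N′ → C * N + C * N + 4 * C * N′ ≡ 2 * (C * N) + 2 * C * (2 * N′)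
          e₃ = ℕ-ring
          e₄ : ∀ C N → 2 * (C * N) + 2 * C * N ≡ 4 * C * N
          e₄ = ℕ-ring

  -- A relation that violates independence has its largest coefficient above ω, and the generator
  -- carrying that coefficient is the one to eliminate.
  independent-or-eliminate : ∀ {d} {u : Vector (suc d)} {C κ} J ω .{{_ : NonZero C}} →
    Span B a u C κ → (∀ i → u i ∈ E B (2 * a)) → 32 * C * κ ≤ ω * a →
    (∀ i → Span B a (u ∘ punchIn i) (4 * C) (4 * (2 * J * a + κ)) → ⊥) → IndependentUpTo B u κ J ω
  independent-or-eliminate {u = u} {C} {κ} J ω span u∈ le k q q≤J rel j with ∣ q j ∣ ≤? ω
  ... | yes p = p
  ... | no ¬p with argmax (λ i → ∣ q i ∣)
  ...   | i , max = ⊥-elim (k i (eliminate J span u∈ q i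
            (λ e → ¬p (≤-trans (max j) (≤-trans (≤-reflexive (cong ∣_∣ e)) z≤n))) max (q≤J i)
            (≤-trans le (*-monoˡ-≤ a (≤-trans (<⇒≤ (≰⇒> ¬p)) (max j)))) rel))

-- Approximate additivity of coordinates

total : List (ℕ × ℕ) → ℤ
total []              = 0ℤ
total ((b , b′) ∷ xs) = (+ b ℤ.- + b′) ℤ.+ total xs

total-++ : ∀ xs ys → total (xs ++ ys) ≡ total xs ℤ.+ total ys
total-++ []              ys = sym (ℤₚ.+-identityˡ (total ys))
total-++ ((b , b′) ∷ xs) ys =
  trans (cong (λ z → (+ b ℤ.- + b′) ℤ.+ z) (total-++ xs ys)) (sym (ℤₚ.+-assoc (+ b ℤ.- + b′) (total xs) (total ys)))

PairsIn : List ℕ → List (ℕ × ℕ) → Set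
PairsIn B = All (λ (b , b′) → b ∈ B × b′ ∈ B)

total∈E : ∀ {B} xs → PairsIn B xs → total xs ∈ E B (length xs)
total∈E []       []               = E-zero⁺
total∈E (_ ∷ xs) ((p , q) ∷ ps) = E-suc⁺ p q (total∈E xs ps)

E⇒total : ∀ {B} n {y} → y ∈ E B n → ∃[ xs ] PairsIn B xs × length xs ≡ n × total xs ≡ y
E⇒total zero    y∈ = [] , [] , refl , sym (E-zero⁻ y∈)
E⇒total (suc n) y∈ with E-suc⁻ y∈
... | b , b′ , y′ , b∈ , b′∈ , y′∈ , refl with E⇒total n y′∈
... | xs , ps , len , e = (b , b′) ∷ xs , (b∈ , b′∈) ∷ ps , cong suc len , cong (λ z → (+ b ℤ.- + b′) ℤ.+ z) e

module _ {d : ℕ} (ξ : ℕ → Vector d) where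

  gap : ℕ × ℕ → Vector d
  gap (b , b′) i = ξ b i ℤ.- ξ b′ i

  ξsum : List (ℕ × ℕ) → Vector d
  ξsum []       i = 0ℤ
  ξsum (x ∷ xs) i = gap x i ℤ.+ ξsum xs i

  ξsum-++ : ∀ xs ys i → ξsum (xs ++ ys) i ≡ ξsum xs i ℤ.+ ξsum ys i
  ξsum-++ []       ys i = sym (ℤₚ.+-identityˡ (ξsum ys i))
  ξsum-++ (x ∷ xs) ys i =
    trans (cong (λ z → gap x i ℤ.+ z) (ξsum-++ xs ys i)) (sym (ℤₚ.+-assoc (gap x i) (ξsum xs i) (ξsum ys i)))

  ∣ξsum∣≤ : ∀ i D xs → (∀ {x} → x ∈ xs → ∣ gap x i ∣ ≤ D) → ∣ ξsum xs i ∣ ≤ length xs * D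
  ∣ξsum∣≤ i D []       h = z≤n
  ∣ξsum∣≤ i D (x ∷ xs) h = ∣i+j∣≤ (gap x i) (ξsum xs i) (h (here refl)) (∣ξsum∣≤ i D xs (h ∘ there))

  dot-ξsum-∷ : ∀ f x xs → dot f (ξsum (x ∷ xs)) ≡ dot f (gap x) ℤ.+ dot f (ξsum xs)
  dot-ξsum-∷ f x xs = trans (dot-comm f (ξsum (x ∷ xs)))
    (trans (dot-+ (gap x) (ξsum xs) f) (cong₂ ℤ._+_ (dot-comm (gap x) f) (dot-comm (ξsum xs) f)))

  dot-ξsum-[] : ∀ f → dot f (ξsum []) ≡ 0ℤ
  dot-ξsum-[] f = trans (dot-comm f (ξsum [])) (dot-0 f)

  ∣dot-ξsum∣≤ : ∀ f D xs → (∀ {x} → x ∈ xs → ∣ dot f (gap x) ∣ ≤ D) → ∣ dot f (ξsum xs) ∣ ≤ length xs * D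
  ∣dot-ξsum∣≤ f D []       h = ≤-reflexive (cong ∣_∣ (dot-ξsum-[] f))
  ∣dot-ξsum∣≤ f D (x ∷ xs) h = subst (λ z → ∣ z ∣ ≤ D + length xs * D) (sym (dot-ξsum-∷ f x xs))
    (∣i+j∣≤ (dot f (gap x)) (dot f (ξsum xs)) (h (here refl)) (∣dot-ξsum∣≤ f D xs (h ∘ there)))

  dot-ξsum≥ : ∀ f D xs → (∀ {x} → x ∈ xs → + D ℤ.≤ dot f (gap x)) → + (length xs * D) ℤ.≤ dot f (ξsum xs)
  dot-ξsum≥ f D []       h = ℤₚ.≤-reflexive (sym (dot-ξsum-[] f))
  dot-ξsum≥ f D (x ∷ xs) h = subst₂ ℤ._≤_ (sym (ℤₚ.pos-+ D (length xs * D))) (sym (dot-ξsum-∷ f x xs))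
    (ℤₚ.+-mono-≤ (h (here refl)) (dot-ξsum≥ f D xs (h ∘ there)))

-- ξ b holds coordinates of b - b₀ with common denominator L = 2 ^ T. Without the dilation by L the
-- single difference b - b₀ could be part of the error. The base point b₀ cancels in differences of
-- coordinates.
Coordinates : List ℕ → ℕ → ℕ → ∀ {d} → Vector d → ℕ → ℕ → ℕ → (ℕ → Vector d) → Set
Coordinates B b₀ a u C κ T ξ = ∀ {b} → b ∈ B →
  (∀ i → a * ∣ ξ b i ∣ ≤ C * 2 ^ T) × (+ (2 ^ T) ℤ.* (+ b ℤ.- + b₀) ℤ.- dot (ξ b) u ∈ E B κ)

coordinates : ∀ {B b₀ a d C κ} {u : Vector d} → b₀ ∈ B → Span B a u C κ → ∀ T → ∃[ ξ ] Coordinates B b₀ a u C κ T ξ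
coordinates {B} {b₀} {a} {d} {C} {κ} {u} b₀∈ span T = ξ , λ b∈ → ξ-spec b∈ (any? (_ ≟_) B)
  where
  L : ℕ
  L = 2 ^ T
  scaled : ∀ {b} → b ∈ B → + L ℤ.* (+ b ℤ.- + b₀) ∈ E B L
  scaled {b} b∈ = subst (λ n → + L ℤ.* (+ b ℤ.- + b₀) ∈ E B n) (*-identityʳ L) (E-scale (+ L) (E-difference b∈ b₀∈))
  choose : ∀ b → Dec (b ∈ B) → Vector d
  choose b (yes b∈) = proj₁ (span L (scaled b∈))
  choose b (no _)   = λ _ → 0ℤ
  ξ : ℕ → Vector d
  ξ b = choose b (any? (b ≟_) B)
  ξ-spec : ∀ {b} → b ∈ B → (b∈? : Dec (b ∈ B)) →
    (∀ i → a * ∣ choose b b∈? i ∣ ≤ C * L) × (+ L ℤ.* (+ b ℤ.- + b₀) ℤ.- dot (choose b b∈?) u ∈ E B κ)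
  ξ-spec b∈ (yes b∈′) = proj₂ (span L (scaled b∈′))
  ξ-spec b∈ (no b∉)   = contradiction b∈ b∉

record Frame (d : ℕ) : Set where
  field
    B             : List ℕ
    {b₀}          : ℕ
    b₀∈           : b₀ ∈ B
    a C κ J ω T   : ℕ
    {{a≢0}}       : NonZero a
    u             : Vector d
    u∈            : ∀ i → u i ∈ E B (2 * a)
    span          : Span B a u C κ
    independent   : IndependentUpTo B u κ J ω
    -- Combinations of up to four coordinate vectors of elements of E B L stay in the range where
    -- `independent` applies.
    4CL≤aJ        : 4 * (C * 2 ^ T) ≤ a * J
    ξ             : ℕ → Vector d
    ξ-spec        : Coordinates B b₀ a u C κ T ξ

  L : ℕ
  L = 2 ^ T

module _ {d : ℕ} (𝓕 : Frame d) where

  open Frame 𝓕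

  small⇒≤J : ∀ {x} → a * x ≤ 4 * (C * L) → x ≤ J
  small⇒≤J h = *-cancelˡ-≤ a (≤-trans h 4CL≤aJ)

  -- A balanced binary tree of differences. A partial sum at height t has at most 2 ^ t terms, so
  -- its multiple by 2 ^ (T - t) still lies in E B L and its coordinates stay within the range of
  -- independence.
  data Formal : ℕ → ℤ → Vector d → Set where
    leaf : ∀ {b b′ y S} → b ∈ B → b′ ∈ B → y ≡ + b ℤ.- + b′ → (∀ i → S i ≡ ξ b i ℤ.- ξ b′ i) → Formal 0 y S
    node : ∀ {t y y₁ y₂ S S₁ S₂} → Formal t y₁ S₁ → Formal t y₂ S₂ →
      y ≡ y₁ ℤ.+ y₂ → (∀ i → S i ≡ S₁ i ℤ.+ S₂ i) → Formal (suc t) y S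

  formal∈E : ∀ {t y S} → Formal t y S → y ∈ E B (2 ^ t)
  formal∈E (leaf b∈ b′∈ refl _) = E-difference b∈ b′∈
  formal∈E {suc t} {y} (node {y₁ = y₁} {y₂} F₁ F₂ y≡ _) = subst (_∈ E B (2 ^ suc t)) (sym y≡)
    (subst (λ n → y₁ ℤ.+ y₂ ∈ E B (2 ^ t + n)) (sym (+-identityʳ (2 ^ t))) (E-+ (2 ^ t) (formal∈E F₁) (formal∈E F₂)))

  formal-list : ∀ t xs → PairsIn B xs → length xs ≤ 2 ^ t → Formal t (total xs) (ξsum ξ xs)
  -- Short lists are padded with the trivial difference b₀ - b₀.
  formal-list zero [] ps len = leaf b₀∈ b₀∈ (sym (ℤₚ.+-inverseʳ (+ b₀))) (λ i → sym (ℤₚ.+-inverseʳ (ξ b₀ i)))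
  formal-list zero ((b , b′) ∷ []) ((p , q) ∷ []) len = leaf p q (ℤₚ.+-identityʳ _) (λ i → ℤₚ.+-identityʳ _)
  formal-list zero (_ ∷ _ ∷ _) ps (s≤s ())
  formal-list (suc t) xs ps len = node
      (formal-list t (take n xs) (All.take⁺ n ps) (≤-trans (≤-reflexive (length-take n xs)) (m⊓n≤m n _)))
      (formal-list t (drop n xs) (All.drop⁺ n ps) (≤-trans (≤-reflexive (length-drop n xs))
        (≤-trans (∸-monoˡ-≤ n len) (≤-reflexive (trans (m+n∸m≡n n (n + 0)) (+-identityʳ n))))))
      (trans (cong total (sym (take++drop≡id n xs))) (total-++ (take n xs) (drop n xs)))
      (λ i → trans (cong (λ zs → ξsum ξ zs i) (sym (take++drop≡id n xs))) (ξsum-++ ξ (take n xs) (drop n xs) i))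
    where n = 2 ^ t

  -- At a node 2 c - (c₁ + c₂) is a relation, hence at most ω in every coordinate. Each level of the
  -- tree contributes at most 2 ^ t ω, so after division by 2 ^ t the error grows with the number of
  -- levels, that is, with the logarithm of the number of summands.
  formal-coordinates : ∀ t t′ → t + t′ ≡ T → ∀ {y S} → Formal t y S →
    ∀ c → (∀ i → a * ∣ c i ∣ ≤ C * L) → + (2 ^ t′) ℤ.* y ℤ.- dot c u ∈ E B κ →
    ∀ i → ∣ + (2 ^ t) ℤ.* c i ℤ.- S i ∣ ≤ 2 ^ t * (suc t * ω)
  formal-coordinates zero t′ refl (leaf {b} {b′} {y} {S} b∈ b′∈ refl S≡) c c≤ h i =
    subst₂ _≤_ (cong ∣_∣ (trans (e₁ (c i) (ξ b i) (ξ b′ i)) (cong (λ s → + 1 ℤ.* c i ℤ.- s) (sym (S≡ i)))))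
      (e₂ ω) (independent q (λ j → small⇒≤J (bound j)) q·u∈ i)
    where
    q : Vector d
    q j = (c j ℤ.- ξ b j) ℤ.+ ξ b′ j
    e₁ : ∀ c x x′ → (c ℤ.- x) ℤ.+ x′ ≡ + 1 ℤ.* c ℤ.- (x ℤ.- x′)
    e₁ = ℤ-ring
    e₂ : ∀ ω → ω ≡ 1 * (1 * ω)
    e₂ = ℕ-ring
    bound : ∀ j → a * ∣ q j ∣ ≤ 4 * (C * L)
    bound j = ≤-trans (*-monoʳ-≤ a (∣i+j∣≤ (c j ℤ.- ξ b j) (ξ b′ j) (∣i-j∣≤ (c j) (ξ b j) ≤-refl ≤-refl) ≤-refl))
      (≤-trans (≤-reflexive (e₃ a (∣ c j ∣) (∣ ξ b j ∣) (∣ ξ b′ j ∣)))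
      (≤-trans (+-mono-≤ (+-mono-≤ (c≤ j) (proj₁ (ξ-spec b∈) j)) (proj₁ (ξ-spec b′∈) j))
      (≤-trans (m≤m+n _ (C * L)) (≤-reflexive (e₄ (C * L))))))
      where
      e₃ : ∀ a x y z → a * (x + y + z) ≡ a * x + a * y + a * z
      e₃ = ℕ-ring
      e₄ : ∀ x → x + x + x + x ≡ 4 * x
      e₄ = ℕ-ring
    q·u∈ : dot q u ∈ E B (8 * κ)
    q·u∈ = E-mono b₀∈ (≤-trans (m≤m+n _ (5 * κ)) (≤-reflexive (e₄ κ))) (subst (_∈ E B (κ + (κ + κ)))
      (trans (e₃ (+ L) (+ b) (+ b′) (+ b₀) (dot c u) (dot (ξ b) u) (dot (ξ b′) u))
        (sym (trans (dot-+ (λ j → c j ℤ.- ξ b j) (ξ b′) u) (cong (ℤ._+ dot (ξ b′) u) (dot-- c (ξ b) u)))))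
      (E-sub κ (proj₂ (ξ-spec b∈)) (E-+ κ h (proj₂ (ξ-spec b′∈)))))
      where
      e₃ : ∀ L b b′ b₀ cu xu xu′ → (L ℤ.* (b ℤ.- b₀) ℤ.- xu) ℤ.- ((L ℤ.* (b ℤ.- b′) ℤ.- cu) ℤ.+ (L ℤ.* (b′ ℤ.- b₀) ℤ.- xu′))
        ≡ (cu ℤ.- xu) ℤ.+ xu′
      e₃ = ℤ-ring
      e₄ : ∀ x → x + (x + x) + 5 * x ≡ 8 * x
      e₄ = ℕ-ring
  formal-coordinates (suc t) t′ t+t′≡T (node {y₁ = y₁} {y₂} {S} {S₁} {S₂} F₁ F₂ refl S≡) c c≤ h i =
    ≤-trans (≤-reflexive (cong ∣_∣ (trans (cong₂ (λ p s → p ℤ.* c i ℤ.- s) (trans (cong +_ (cong (λ z → 2 ^ t + z) (+-identityʳ (2 ^ t)))) (ℤₚ.pos-+ (2 ^ t) (2 ^ t))) (S≡ i))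
        (e₁ (+ (2 ^ t)) (c i) (c₁ i) (c₂ i) (S₁ i) (S₂ i)))))
      (≤-trans (∣i+j∣≤ (+ (2 ^ t) ℤ.* q i) _
        (≤-trans (≤-reflexive (ℤₚ.abs-* (+ (2 ^ t)) (q i))) (*-monoʳ-≤ (2 ^ t) (independent q (λ j → small⇒≤J (bound j)) q·u∈ i)))
        (∣i+j∣≤ (+ (2 ^ t) ℤ.* c₁ i ℤ.- S₁ i) (+ (2 ^ t) ℤ.* c₂ i ℤ.- S₂ i) (formal-coordinates t (suc t′) t+st′≡T F₁ c₁ (proj₁ (proj₂ C₁)) (proj₂ (proj₂ C₁)) i)
                    (formal-coordinates t (suc t′) t+st′≡T F₂ c₂ (proj₁ (proj₂ C₂)) (proj₂ (proj₂ C₂)) i)))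
      (≤-trans (m≤m+n _ (2 ^ t * ω)) (≤-reflexive (e₂ (2 ^ t) t ω))))
    where
    t+st′≡T : t + suc t′ ≡ T
    t+st′≡T = trans (+-suc t t′) t+t′≡T
    scaled∈ : ∀ {y S} → Formal t y S → + (2 ^ suc t′) ℤ.* y ∈ E B L
    scaled∈ {y} F = subst (λ n → + (2 ^ suc t′) ℤ.* y ∈ E B n)
      (trans (sym (^-distribˡ-+-* 2 (suc t′) t)) (cong (2 ^_) (trans (+-comm (suc t′) t) t+st′≡T)))
      (E-scale (+ (2 ^ suc t′)) (formal∈E F))
    C₁ = span L (scaled∈ F₁)
    C₂ = span L (scaled∈ F₂)
    c₁ c₂ q : Vector d
    c₁ = proj₁ C₁
    c₂ = proj₁ C₂
    q j = + 2 ℤ.* c j ℤ.- (c₁ j ℤ.+ c₂ j)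
    e₁ : ∀ p c c₁ c₂ S₁ S₂ → (p ℤ.+ p) ℤ.* c ℤ.- (S₁ ℤ.+ S₂) ≡
      p ℤ.* (+ 2 ℤ.* c ℤ.- (c₁ ℤ.+ c₂)) ℤ.+ ((p ℤ.* c₁ ℤ.- S₁) ℤ.+ (p ℤ.* c₂ ℤ.- S₂))
    e₁ = ℤ-ring
    e₂ : ∀ p t ω → p * ω + (p * ((1 + t) * ω) + p * ((1 + t) * ω)) + p * ω ≡ 2 * p * ((2 + t) * ω)
    e₂ = ℕ-ring
    bound : ∀ j → a * ∣ q j ∣ ≤ 4 * (C * L)
    bound j = ≤-trans (*-monoʳ-≤ a (∣i-j∣≤ (+ 2 ℤ.* c j) (c₁ j ℤ.+ c₂ j) (≤-reflexive (ℤₚ.abs-* (+ 2) (c j)))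
                (∣i+j∣≤ (c₁ j) (c₂ j) ≤-refl ≤-refl)))
      (≤-trans (≤-reflexive (e₃ a (∣ c j ∣) (∣ c₁ j ∣) (∣ c₂ j ∣)))
      (≤-trans (+-mono-≤ (*-monoʳ-≤ 2 (c≤ j)) (+-mono-≤ (proj₁ (proj₂ C₁) j) (proj₁ (proj₂ C₂) j))) (≤-reflexive (e₄ (C * L)))))
      where
      e₃ : ∀ a x y z → a * (2 * x + (y + z)) ≡ 2 * (a * x) + (a * y + a * z)
      e₃ = ℕ-ring
      e₄ : ∀ x → 2 * x + (x + x) ≡ 4 * x
      e₄ = ℕ-ring
    q·u∈ : dot q u ∈ E B (8 * κ)
    q·u∈ = E-mono b₀∈ (≤-trans (m≤m+n _ (4 * κ)) (≤-reflexive (e₄ κ))) (subst (_∈ E B (κ + κ + 2 * κ))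
      (trans (cong (λ p → ((p ℤ.* y₁ ℤ.- dot c₁ u) ℤ.+ (p ℤ.* y₂ ℤ.- dot c₂ u)) ℤ.- + 2 ℤ.* (+ (2 ^ t′) ℤ.* (y₁ ℤ.+ y₂) ℤ.- dot c u))
               (ℤₚ.pos-* 2 (2 ^ t′)))
      (trans (e₃ (+ (2 ^ t′)) y₁ y₂ (dot c u) (dot c₁ u) (dot c₂ u))
        (sym (trans (dot-- (λ j → + 2 ℤ.* c j) (λ j → c₁ j ℤ.+ c₂ j) u) (cong₂ ℤ._-_ (dot-* (+ 2) c u) (dot-+ c₁ c₂ u))))))
      (E-sub (κ + κ) (E-+ κ (proj₂ (proj₂ C₁)) (proj₂ (proj₂ C₂))) (E-scale (+ 2) h)))
      where
      e₃ : ∀ p y₁ y₂ cu c₁u c₂u →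
        ((+ 2 ℤ.* p ℤ.* y₁ ℤ.- c₁u) ℤ.+ (+ 2 ℤ.* p ℤ.* y₂ ℤ.- c₂u)) ℤ.- + 2 ℤ.* (p ℤ.* (y₁ ℤ.+ y₂) ℤ.- cu)
          ≡ + 2 ℤ.* cu ℤ.- (c₁u ℤ.+ c₂u)
      e₃ = ℤ-ring
      e₄ : ∀ x → x + x + 2 * x + 4 * x ≡ 8 * x
      e₄ = ℕ-ring

  additive : ∀ xs → PairsIn B xs → length xs ≤ L →
    ∀ c → (∀ i → a * ∣ c i ∣ ≤ C * L) → total xs ℤ.- dot c u ∈ E B κ →
    ∀ i → ∣ + L ℤ.* c i ℤ.- ξsum ξ xs i ∣ ≤ L * (suc T * ω)
  additive xs ps len c c≤ h = formal-coordinates T 0 (+-identityʳ T) (formal-list T xs ps len) c c≤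
    (subst (_∈ E B κ) (cong (ℤ._- dot c u) (sym (ℤₚ.*-identityˡ (total xs)))) h)

-- Steering a sum of differences to a point with small coordinates

filter-split : ∀ {A : Set} {P : A → Set} (P? : ∀ x → Dec (P x)) xs → xs ↭ filter P? xs ++ filter (¬? ∘ P?) xs
filter-split P? [] = ↭-refl
filter-split P? (x ∷ xs) with P? x
... | yes _ = prep x (filter-split P? xs)
... | no _  = ↭-trans (prep x (filter-split P? xs)) (↭-sym (shift x (filter P? xs) (filter (¬? ∘ P?) xs)))

count-↭ : ∀ {A : Set} {P : A → Set} (P? : ∀ x → Dec (P x)) {xs ys} → xs ↭ ys → count P? xs ≡ count P? ys
count-↭ P? p = ↭-length (filter-↭ P? p)

+≤⇒∣∣ : ∀ {i n} → ∣ i ∣ ≤ n → i ℤ.≤ + n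
+≤⇒∣∣ {i} p = ℤₚ.≤-trans (i≤∣i∣ i) (+≤+ p)

-- A half-space depth in the sense of Tukey, with margin H. Directions are integer vectors of
-- maximum norm exactly J₀, as `direction` produces them.
Deep : ∀ {d} → (ℕ → Vector d) → List ℕ → ℕ → ℕ → ℕ → ℕ → Set
Deep ξ R J₀ H Θ o = ∀ f → (∀ i → ∣ f i ∣ ≤ J₀) → (∃[ i ] ∣ f i ∣ ≡ J₀) →
  Θ ≤ count (λ b → + H ℤₚ.≤? dot f (gap ξ (b , o))) R

gap-self-small : ∀ {d} (ξ : ℕ → Vector d) f o {H} → 0 < H → ¬ (+ H ℤ.≤ dot f (gap ξ (o , o)))
gap-self-small ξ f o 0<H le = ℤₚ.<⇒≱ (ℤ.+<+ 0<H) (ℤₚ.≤-trans le (ℤₚ.≤-reflexive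
  (trans (dot-comm f (gap ξ (o , o))) (trans (dot-- (ξ o) (ξ o) f) (ℤₚ.+-inverseʳ (dot (ξ o) f))))))

-- A block of L₂ steps changes each coordinate by about L₂ J₀ / L = p₀ at most. `drift` keeps the
-- rounding errors in the linear term of the energy change, and `square` the quadratic term, below
-- the gain p₀ μ per unit of g.
record WalkBounds {d : ℕ} (𝓕 : Frame d) : Set where
  open Frame 𝓕
  field
    J₀ G₀ p₀ μ L₂ Θ : ℕ
    1≤J₀     : 1 ≤ J₀
    1≤μ      : 1 ≤ μ
    L₂≤L     : L₂ ≤ L
    2Cκ≤aω   : C * (2 * κ) ≤ a * ω
    L₂J₀≡Lp₀ : L₂ * J₀ ≡ L * p₀
    Ω≤p₀     : (2 + T) * ω ≤ p₀
    drift    : 4 * (d * p₀ + J₀ * (d * ((2 + T) * ω))) ≤ p₀ * μ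
    square   : 8 * (J₀ * (d * (p₀ * p₀))) ≤ G₀ * (p₀ * μ)

record Target {d : ℕ} (𝓕 : Frame d) (W : WalkBounds 𝓕) : Set where
  open Frame 𝓕
  open WalkBounds W
  field
    R    : List ℕ
    R⊆B  : ∀ {b} → b ∈ R → b ∈ B
    o    : ℕ
    o∈B  : o ∈ B
    gap≤ : ∀ {b} → b ∈ B → ∀ i → ∣ gap ξ (b , o) i ∣ ≤ J₀
    deep : Deep ξ R J₀ (J₀ * μ) Θ o
    w    : ℤ

module Walk {d : ℕ} (𝓕 : Frame d) (W : WalkBounds 𝓕) where

  open Frame 𝓕
  open WalkBounds W

  private
    K Ω H : ℕ
    K = p₀ * μ
    Ω = (2 + T) * ω
    H = J₀ * μ
    instance
      J₀≢0 : NonZero J₀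
      J₀≢0 = >-nonZero 1≤J₀
      L≢0 : NonZero (2 ^ T)
      L≢0 = m^n≢0 2 T
      L-pos : ℤ.Positive (+ (2 ^ T))
      L-pos = ℤ.positive (ℤ.+<+ (>-nonZero⁻¹ (2 ^ T)))

  -- f is - J₀ g / |g| rounded to integers, with |g| the maximum norm: it points from g back to the
  -- origin. At the index i of the maximum the division is exact, so the norm J₀ is attained there.
  direction : (g : Vector d) (i : Fin d) → (∀ j → ∣ g j ∣ ≤ ∣ g i ∣) → g i ≢ 0ℤ →
    Σ (Vector d) λ f → Σ (Vector d) λ ρ → (∀ j → ∣ f j ∣ ≤ J₀) × ∣ f i ∣ ≡ J₀ × (∀ j → ∣ ρ j ∣ ≤ ∣ g i ∣) ×
      (∀ j → + J₀ ℤ.* g j ≡ ρ j ℤ.- + ∣ g i ∣ ℤ.* f j)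
  direction g i max gi≢0 = f , ρ , f≤ , ≤-antisym (f≤ i) J₀≤fi , (λ j → <⇒≤ (ρ< j)) , eq
    where
    G : ℕ
    G = ∣ g i ∣
    G≢0 : + G ≢ 0ℤ
    G≢0 e = gi≢0 (ℤₚ.∣i∣≡0⇒i≡0 (ℤₚ.+-injective e))
    instance
      G-nz : NonZero G
      G-nz = ≢-nonZero (λ e → G≢0 (cong +_ e))
    quot : ∀ j → ∃[ m ] ∃[ r ] + J₀ ℤ.* g j ≡ m ℤ.* + G ℤ.+ r × ∣ m ∣ * G ≤ ∣ + J₀ ℤ.* g j ∣ × ∣ r ∣ < G
    quot j = div-trunc (+ J₀ ℤ.* g j) (+ G) G≢0
    f ρ : Vector d
    f j = ℤ.- proj₁ (quot j)
    ρ j = proj₁ (proj₂ (quot j))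
    ∣f∣≡ : ∀ j → ∣ f j ∣ ≡ ∣ proj₁ (quot j) ∣
    ∣f∣≡ j = ℤₚ.∣-i∣≡∣i∣ (proj₁ (quot j))
    f≤ : ∀ j → ∣ f j ∣ ≤ J₀
    f≤ j = *-cancelʳ-≤ (∣ f j ∣) J₀ G (≤-trans (≤-reflexive (cong (_* G) (∣f∣≡ j)))
      (≤-trans (proj₁ (proj₂ (proj₂ (proj₂ (quot j))))) (≤-trans (≤-reflexive (ℤₚ.abs-* (+ J₀) (g j))) (*-monoʳ-≤ J₀ (max j)))))
    ρ< : ∀ j → ∣ ρ j ∣ < G
    ρ< j = proj₂ (proj₂ (proj₂ (proj₂ (quot j))))
    J₀≤fi : J₀ ≤ ∣ f i ∣
    J₀≤fi = ≤-pred (*-cancelʳ-< G J₀ (suc ∣ f i ∣) (begin-strict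
      J₀ * G                          ≡⟨ ℤₚ.abs-* (+ J₀) (g i) ⟨
      ∣ + J₀ ℤ.* g i ∣                ≡⟨ cong ∣_∣ (proj₁ (proj₂ (proj₂ (quot i)))) ⟩
      ∣ m ℤ.* + G ℤ.+ ρ i ∣           ≤⟨ ∣i+j∣≤ (m ℤ.* + G) (ρ i) (≤-reflexive (ℤₚ.abs-* m (+ G))) ≤-refl ⟩
      ∣ m ∣ * G + ∣ ρ i ∣             <⟨ +-monoʳ-< (∣ m ∣ * G) (ρ< i) ⟩
      ∣ m ∣ * G + G                   ≡⟨ +-comm (∣ m ∣ * G) G ⟩
      suc ∣ m ∣ * G                   ≡⟨ cong (λ z → suc z * G) (∣f∣≡ i) ⟨
      suc ∣ f i ∣ * G                 ∎))
      where
      open ≤-Reasoning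
      m = proj₁ (quot i)
    eq : ∀ j → + J₀ ℤ.* g j ≡ ρ j ℤ.- + G ℤ.* f j
    eq j = trans (proj₁ (proj₂ (proj₂ (quot j)))) (e (proj₁ (quot j)) (+ G) (ρ j))
      where
      e : ∀ m G r → m ℤ.* G ℤ.+ r ≡ r ℤ.- G ℤ.* (ℤ.- m)
      e = ℤ-ring

  -- One block of L₂ steps with inner product at least H with f moves g by δ with J₀ ⟨g, δ⟩ ≤ − (3/4) |g| K,
  -- which outweighs J₀ ⟨δ, δ⟩ ≤ (1/2) G₀ K.
  energy-decrease : ∀ (g δ S f ρ : Vector d) G → G₀ ≤ G → (∀ j → ∣ g j ∣ ≤ G) → (∀ j → ∣ ρ j ∣ ≤ G) →
    (∀ j → + J₀ ℤ.* g j ≡ ρ j ℤ.- + G ℤ.* f j) → (∀ j → ∣ S j ∣ ≤ L₂ * J₀) → + (L₂ * H) ℤ.≤ dot f S →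
    (∀ j → ∣ + L ℤ.* δ j ℤ.- S j ∣ ≤ L * Ω) →
    + J₀ ℤ.* dot (λ j → g j ℤ.+ δ j) (λ j → g j ℤ.+ δ j) ℤ.≤ + J₀ ℤ.* dot g g ℤ.- + (G₀ * K)
  energy-decrease g δ S f ρ G G₀≤G g≤ ρ≤ J₀g≡ S≤ fS≥ δ≈ = ≤-half final
    where
    err : Vector d
    err j = + L ℤ.* δ j ℤ.- S j
    S≤′ : ∀ j → ∣ S j ∣ ≤ L * p₀
    S≤′ j = ≤-trans (S≤ j) (≤-reflexive L₂J₀≡Lp₀)
    X Z E₁ F : ℤ
    X  = + J₀ ℤ.* dot g δ
    Z  = + J₀ ℤ.* dot δ δ
    E₁ = dot ρ S ℤ.+ + J₀ ℤ.* dot g err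
    F  = dot f S
    δ≤ : ∀ j → ∣ δ j ∣ ≤ 2 * p₀
    δ≤ j = *-cancelˡ-≤ L (begin
      L * ∣ δ j ∣                 ≡⟨ ℤₚ.abs-* (+ L) (δ j) ⟨
      ∣ + L ℤ.* δ j ∣             ≡⟨ cong ∣_∣ (e (+ L ℤ.* δ j) (S j)) ⟩
      ∣ err j ℤ.+ S j ∣           ≤⟨ ∣i+j∣≤ (err j) (S j) (δ≈ j) (S≤′ j) ⟩
      L * Ω + L * p₀              ≤⟨ +-monoˡ-≤ (L * p₀) (*-monoʳ-≤ L Ω≤p₀) ⟩
      L * p₀ + L * p₀             ≡⟨ e₂ L p₀ ⟩
      L * (2 * p₀)                ∎)
      where
      open ≤-Reasoning
      e : ∀ x s → x ≡ (x ℤ.- s) ℤ.+ s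
      e = ℤ-ring
      e₂ : ∀ l p → l * p + l * p ≡ l * (2 * p)
      e₂ = ℕ-ring
    4E₁≤ : 4 * ∣ E₁ ∣ ≤ G * (L * K)
    4E₁≤ = begin
      4 * ∣ E₁ ∣
        ≤⟨ *-monoʳ-≤ 4 (∣i+j∣≤ (dot ρ S) (+ J₀ ℤ.* dot g err) (dot-∣∣≤ G (L * p₀) ρ≤ S≤′)
             (≤-trans (≤-reflexive (ℤₚ.abs-* (+ J₀) (dot g err))) (*-monoʳ-≤ J₀ (dot-∣∣≤ G (L * Ω) g≤ δ≈)))) ⟩
      4 * (d * (G * (L * p₀)) + J₀ * (d * (G * (L * Ω))))
        ≡⟨ e d G L p₀ J₀ Ω ⟩
      G * (L * (4 * (d * p₀ + J₀ * (d * Ω))))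
        ≤⟨ *-monoʳ-≤ G (*-monoʳ-≤ L drift) ⟩
      G * (L * K) ∎
      where
      open ≤-Reasoning
      e : ∀ d G L p J Ω → 4 * (d * (G * (L * p)) + J * (d * (G * (L * Ω)))) ≡ G * (L * (4 * (d * p + J * (d * Ω))))
      e = ℕ-ring
    LX≡ : + L ℤ.* X ≡ E₁ ℤ.- + G ℤ.* F
    LX≡ = begin
      + L ℤ.* (+ J₀ ℤ.* dot g δ)                          ≡⟨ e₁ (+ L) (+ J₀) (dot g δ) ⟩
      + J₀ ℤ.* (+ L ℤ.* dot g δ)                          ≡⟨ cong (λ z → + J₀ ℤ.* z) Lgδ ⟩
      + J₀ ℤ.* (dot g S ℤ.+ dot g err)                    ≡⟨ ℤₚ.*-distribˡ-+ (+ J₀) (dot g S) (dot g err) ⟩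
      + J₀ ℤ.* dot g S ℤ.+ + J₀ ℤ.* dot g err             ≡⟨ cong (ℤ._+ + J₀ ℤ.* dot g err) J₀gS ⟩
      (dot ρ S ℤ.- + G ℤ.* F) ℤ.+ + J₀ ℤ.* dot g err      ≡⟨ e₂ (dot ρ S) (+ G ℤ.* F) (+ J₀ ℤ.* dot g err) ⟩
      E₁ ℤ.- + G ℤ.* F                                    ∎
      where
      open ≡-Reasoning
      e₁ : ∀ l j x → l ℤ.* (j ℤ.* x) ≡ j ℤ.* (l ℤ.* x)
      e₁ = ℤ-ring
      e₂ : ∀ x y z → (x ℤ.- y) ℤ.+ z ≡ (x ℤ.+ z) ℤ.- y
      e₂ = ℤ-ring
      e₃ : ∀ x s → x ≡ s ℤ.+ (x ℤ.- s)
      e₃ = ℤ-ring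
      Lgδ : + L ℤ.* dot g δ ≡ dot g S ℤ.+ dot g err
      Lgδ = begin
        + L ℤ.* dot g δ                   ≡⟨ cong (λ z → + L ℤ.* z) (dot-comm g δ) ⟩
        + L ℤ.* dot δ g                   ≡⟨ dot-* (+ L) δ g ⟨
        dot (λ j → + L ℤ.* δ j) g         ≡⟨ dot-cong {g = g} (λ j → e₃ (+ L ℤ.* δ j) (S j)) (λ _ → refl) ⟩
        dot (λ j → S j ℤ.+ err j) g       ≡⟨ dot-+ S err g ⟩
        dot S g ℤ.+ dot err g             ≡⟨ cong₂ ℤ._+_ (dot-comm S g) (dot-comm err g) ⟩
        dot g S ℤ.+ dot g err             ∎
      J₀gS : + J₀ ℤ.* dot g S ≡ dot ρ S ℤ.- + G ℤ.* F
      J₀gS = begin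
        + J₀ ℤ.* dot g S                              ≡⟨ dot-* (+ J₀) g S ⟨
        dot (λ j → + J₀ ℤ.* g j) S                    ≡⟨ dot-cong {g = S} J₀g≡ (λ _ → refl) ⟩
        dot (λ j → ρ j ℤ.- + G ℤ.* f j) S             ≡⟨ dot-- ρ (λ j → + G ℤ.* f j) S ⟩
        dot ρ S ℤ.- dot (λ j → + G ℤ.* f j) S         ≡⟨ cong (λ z → dot ρ S ℤ.- z) (dot-* (+ G) f S) ⟩
        dot ρ S ℤ.- + G ℤ.* F                         ∎
    LK≤F : + L ℤ.* + K ℤ.≤ F
    LK≤F = subst (ℤ._≤ F) (trans (cong +_ (trans (sym (*-assoc L₂ J₀ μ)) (trans (cong (_* μ) L₂J₀≡Lp₀) (*-assoc L p₀ μ))))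
      (ℤₚ.pos-* L K)) fS≥
    4E₁≤GLK : + 4 ℤ.* E₁ ℤ.≤ + G ℤ.* (+ L ℤ.* + K)
    4E₁≤GLK = subst (+ 4 ℤ.* E₁ ℤ.≤_) (trans (ℤₚ.pos-* G (L * K)) (cong (λ z → + G ℤ.* z) (ℤₚ.pos-* L K)))
      (+≤⇒∣∣ (≤-trans (≤-reflexive (ℤₚ.abs-* (+ 4) E₁)) 4E₁≤))
    4X≤ : + 4 ℤ.* X ℤ.≤ ℤ.- (+ 3 ℤ.* (+ G ℤ.* + K))
    4X≤ = ℤₚ.*-cancelˡ-≤-pos _ _ (+ L) (≤-by
      (trans (cong (λ z → + L ℤ.* ℤ.- (+ 3 ℤ.* (+ G ℤ.* + K)) ℤ.- z) (trans (e₁ (+ L) X) (cong (λ z → + 4 ℤ.* z) LX≡)))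
        (e₂ (+ L) (+ G) (+ K) E₁ F))
      (0≤+ (0≤gap 4E₁≤GLK) (0≤* {+ 4} (+≤+ z≤n) (0≤* {+ G} (+≤+ z≤n) (0≤gap LK≤F)))))
      where
      e₁ : ∀ l x → l ℤ.* (+ 4 ℤ.* x) ≡ + 4 ℤ.* (l ℤ.* x)
      e₁ = ℤ-ring
      e₂ : ∀ l g k e f → l ℤ.* ℤ.- (+ 3 ℤ.* (g ℤ.* k)) ℤ.- + 4 ℤ.* (e ℤ.- g ℤ.* f) ≡
        (g ℤ.* (l ℤ.* k) ℤ.- + 4 ℤ.* e) ℤ.+ + 4 ℤ.* (g ℤ.* (f ℤ.- l ℤ.* k))
      e₂ = ℤ-ring
    2Z≤ : + 2 ℤ.* Z ℤ.≤ + G ℤ.* + K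
    2Z≤ = subst (+ 2 ℤ.* Z ℤ.≤_) (ℤₚ.pos-* G K) (+≤⇒∣∣ (begin
      ∣ + 2 ℤ.* Z ∣                            ≡⟨ ℤₚ.abs-* (+ 2) Z ⟩
      2 * ∣ + J₀ ℤ.* dot δ δ ∣                 ≡⟨ cong (2 *_) (ℤₚ.abs-* (+ J₀) (dot δ δ)) ⟩
      2 * (J₀ * ∣ dot δ δ ∣)                   ≤⟨ *-monoʳ-≤ 2 (*-monoʳ-≤ J₀ (dot-∣∣≤ (2 * p₀) (2 * p₀) δ≤ δ≤)) ⟩
      2 * (J₀ * (d * (2 * p₀ * (2 * p₀))))     ≡⟨ e J₀ d p₀ ⟩
      8 * (J₀ * (d * (p₀ * p₀)))               ≤⟨ square ⟩
      G₀ * K                                   ≤⟨ *-monoˡ-≤ K G₀≤G ⟩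
      G * K                                    ∎))
      where
      open ≤-Reasoning
      e : ∀ j d p → 2 * (j * (d * (2 * p * (2 * p)))) ≡ 8 * (j * (d * (p * p)))
      e = ℕ-ring
    expand : dot (λ j → g j ℤ.+ δ j) (λ j → g j ℤ.+ δ j) ≡ dot g g ℤ.+ + 2 ℤ.* dot g δ ℤ.+ dot δ δ
    expand = dot-square g δ
    Φ′ : ℤ
    Φ′ = + J₀ ℤ.* dot (λ j → g j ℤ.+ δ j) (λ j → g j ℤ.+ δ j)
    ≤-half : + 2 ℤ.* Φ′ ℤ.≤ + 2 ℤ.* (+ J₀ ℤ.* dot g g ℤ.- + (G₀ * K)) → Φ′ ℤ.≤ + J₀ ℤ.* dot g g ℤ.- + (G₀ * K)
    ≤-half = ℤₚ.*-cancelˡ-≤-pos _ _ (+ 2)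
    G₀K≤GK : + (G₀ * K) ℤ.≤ + G ℤ.* + K
    G₀K≤GK = subst (+ (G₀ * K) ℤ.≤_) (ℤₚ.pos-* G K) (+≤+ (*-monoˡ-≤ K G₀≤G))
    final : + 2 ℤ.* Φ′ ℤ.≤ + 2 ℤ.* (+ J₀ ℤ.* dot g g ℤ.- + (G₀ * K))
    final = ≤-by (trans (cong (λ z → + 2 ℤ.* (+ J₀ ℤ.* dot g g ℤ.- + (G₀ * K)) ℤ.- + 2 ℤ.* (+ J₀ ℤ.* z)) expand)
        (e (+ J₀) (dot g g) (dot g δ) (dot δ δ) (+ (G₀ * K)) (+ G ℤ.* + K)))
      (0≤+ (0≤gap 4X≤) (0≤+ (0≤gap 2Z≤) (0≤* (+≤+ (z≤n {2})) (0≤gap G₀K≤GK))))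
      where
      e : ∀ j gg gδ δδ q k → + 2 ℤ.* (j ℤ.* gg ℤ.- q) ℤ.- + 2 ℤ.* (j ℤ.* (gg ℤ.+ + 2 ℤ.* gδ ℤ.+ δδ)) ≡
        (ℤ.- (+ 3 ℤ.* k) ℤ.- + 4 ℤ.* (j ℤ.* gδ)) ℤ.+ ((k ℤ.- + 2 ℤ.* (j ℤ.* δδ)) ℤ.+ + 2 ℤ.* (k ℤ.- q))
      e = ℤ-ring

  module Steering (Tg : Target 𝓕 W) where

    open Target Tg

    steps : List ℕ → List (ℕ × ℕ)
    steps = map (_, o)

    At : List ℕ → Vector d → Set
    At Y g = (w ℤ.+ total (steps Y)) ℤ.- dot g u ∈ E B κ

    -- Depth counts elements of all of R, and at most |Y| of them have been spent; `room` leaves L₂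
    -- fresh ones.
    block : ∀ {Y Rest} f → R ↭ Y ++ Rest → length Y + L₂ ≤ Θ → (∀ i → ∣ f i ∣ ≤ J₀) → (∃[ i ] ∣ f i ∣ ≡ J₀) →
      ∃[ D ] ∃[ Rest′ ] Rest ↭ D ++ Rest′ × length D ≡ L₂ × (∀ {b} → b ∈ D → b ∈ Rest × + H ℤ.≤ dot f (gap ξ (b , o)))
    block {Y} {Rest} f p room f≤ f= = take L₂ F , drop L₂ F ++ filter (¬? ∘ far?) Rest ,
        ↭-trans (filter-split far? Rest) (↭-reflexive (trans (cong (_++ filter (¬? ∘ far?) Rest) (sym (take++drop≡id L₂ F)))
          (++-assoc (take L₂ F) (drop L₂ F) _))) ,
        trans (length-take L₂ F) (m≤n⇒m⊓n≡m L₂≤F) ,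
        λ b∈ → ∈-filter⁻ far? {xs = Rest} (subst (_ ∈_) (take++drop≡id L₂ F) (∈-++⁺ˡ b∈))
      where
      open ≤-Reasoning
      far? : ∀ b → Dec (+ H ℤ.≤ dot f (gap ξ (b , o)))
      far? b = + H ℤₚ.≤? dot f (gap ξ (b , o))
      F : List ℕ
      F = filter far? Rest
      L₂≤F : L₂ ≤ length F
      L₂≤F = +-cancelˡ-≤ (length Y) L₂ (length F) (begin
        length Y + L₂                      ≤⟨ room ⟩
        Θ                                  ≤⟨ deep f f≤ f= ⟩
        count far? R                       ≡⟨ trans (count-↭ far? p) (count-++ far? Y Rest) ⟩
        count far? Y + count far? Rest     ≤⟨ +-monoˡ-≤ _ (length-filter far? Y) ⟩
        length Y + length F                ∎)

    move : ∀ {Y g D f ρ} G → At Y g → length D ≡ L₂ → (∀ {b} → b ∈ D → b ∈ B × + H ℤ.≤ dot f (gap ξ (b , o))) →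
      G₀ ≤ G → (∀ j → ∣ g j ∣ ≤ G) → (∀ j → ∣ ρ j ∣ ≤ G) → (∀ j → + J₀ ℤ.* g j ≡ ρ j ℤ.- + G ℤ.* f j) →
      ∃[ g′ ] At (Y ++ D) g′ × + J₀ ℤ.* dot g′ g′ ℤ.≤ + J₀ ℤ.* dot g g ℤ.- + (G₀ * K)
    move {Y} {g} {D} {f} {ρ} G at len D⊆ G₀≤G g≤ ρ≤ J₀g≡ =
        (λ j → g j ℤ.+ δ j) , at′ , energy-decrease g δ S f ρ G G₀≤G g≤ ρ≤ J₀g≡ S≤ fS≥ δ≈
      where
      xs : List (ℕ × ℕ)
      xs = steps D
      len-xs : length xs ≡ L₂
      len-xs = trans (length-map (_, o) D) len
      len-xs≤ : length xs ≤ L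
      len-xs≤ = ≤-trans (≤-reflexive len-xs) L₂≤L
      in-D : ∀ {x} → x ∈ xs → ∃[ b ] b ∈ D × x ≡ (b , o)
      in-D x∈ = ∈-map⁻ (_, o) x∈
      ps : PairsIn B xs
      ps = All.map⁺ (All.tabulate (λ b∈ → proj₁ (D⊆ b∈) , o∈B))
      y : ℤ
      y = total xs
      S : Vector d
      S = ξsum ξ xs
      Cy = span L (E-mono b₀∈ len-xs≤ (total∈E xs ps))
      c : Vector d
      c = proj₁ Cy
      rest∈ : ((w ℤ.+ total (steps Y)) ℤ.- dot g u) ℤ.+ (y ℤ.- dot c u) ∈ E B (2 * κ)
      rest∈ = subst (λ n → ((w ℤ.+ total (steps Y)) ℤ.- dot g u) ℤ.+ (y ℤ.- dot c u) ∈ E B n) (cong (λ z → κ + z) (sym (+-identityʳ κ))) (E-+ κ at (proj₂ (proj₂ Cy)))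
      -- The doubled error is expanded again and its coefficients, at most ω, are moved into δ. So
      -- the remainder returns to E B κ however many blocks are used.
      Ce = span (2 * κ) rest∈
      c″ δ : Vector d
      c″ = proj₁ Ce
      δ j = c j ℤ.+ c″ j
      c″≤ : ∀ j → ∣ c″ j ∣ ≤ ω
      c″≤ j = *-cancelˡ-≤ a (≤-trans (proj₁ (proj₂ Ce) j) 2Cκ≤aω)
      at′ : At (Y ++ D) (λ j → g j ℤ.+ δ j)
      at′ = subst (_∈ E B κ) (trans (e₁ w (total (steps Y)) y (dot g u) (dot c u) (dot c″ u)) (cong₂ (λ s t → (w ℤ.+ s) ℤ.- t)
          (sym (trans (cong total (map-++ (_, o) Y D)) (total-++ (steps Y) xs)))
          (sym (trans (dot-+ g δ u) (cong (λ z → dot g u ℤ.+ z) (dot-+ c c″ u)))))) (proj₂ (proj₂ Ce))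
        where
        e₁ : ∀ w s y gu cu eu → ((w ℤ.+ s ℤ.- gu) ℤ.+ (y ℤ.- cu)) ℤ.- eu ≡ (w ℤ.+ (s ℤ.+ y)) ℤ.- (gu ℤ.+ (cu ℤ.+ eu))
        e₁ = ℤ-ring
      S≤ : ∀ j → ∣ S j ∣ ≤ L₂ * J₀
      S≤ j = subst (λ n → ∣ S j ∣ ≤ n * J₀) len-xs (∣ξsum∣≤ ξ j J₀ xs
        (λ x∈ → case in-D x∈ of λ { (b , b∈ , refl) → gap≤ (proj₁ (D⊆ b∈)) j }))
      fS≥ : + (L₂ * H) ℤ.≤ dot f S
      fS≥ = subst (λ n → + (n * H) ℤ.≤ dot f S) len-xs (dot-ξsum≥ ξ f H xs
        (λ x∈ → case in-D x∈ of λ { (b , b∈ , refl) → proj₂ (D⊆ b∈) }))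
      δ≈ : ∀ j → ∣ + L ℤ.* δ j ℤ.- S j ∣ ≤ L * Ω
      δ≈ j = ≤-trans (≤-reflexive (cong ∣_∣ (e₁ (+ L) (c j) (c″ j) (S j))))
        (≤-trans (∣i+j∣≤ (+ L ℤ.* c j ℤ.- S j) (+ L ℤ.* c″ j)
          (additive 𝓕 xs ps len-xs≤ c (proj₁ (proj₂ Cy)) (proj₂ (proj₂ Cy)) j)
          (≤-trans (≤-reflexive (ℤₚ.abs-* (+ L) (c″ j))) (*-monoʳ-≤ L (c″≤ j))))
        (≤-reflexive (e₂ L T ω)))
        where
        e₁ : ∀ l c e s → l ℤ.* (c ℤ.+ e) ℤ.- s ≡ (l ℤ.* c ℤ.- s) ℤ.+ l ℤ.* e
        e₁ = ℤ-ring
        e₂ : ∀ l t ω → l * ((1 + t) * ω) + l * ω ≡ l * ((2 + t) * ω)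
        e₂ = ℕ-ring

    record State (Y : List ℕ) : Set where
      constructor state
      field
        {Rest} : List ℕ
        g      : Vector d
        R↭     : R ↭ Y ++ Rest
        o∉     : o ∉ Y
        at     : At Y g

    energy : ∀ {Y} → State Y → ℤ
    energy s = + J₀ ℤ.* dot (State.g s) (State.g s)

    Close : ∀ {Y} → State Y → Set
    Close s = ∀ i → ∣ State.g s i ∣ ≤ G₀

    largest : ∀ {d} (g : Vector d) → (∀ i → ∣ g i ∣ ≤ G₀) ⊎ (∃[ i ] G₀ < ∣ g i ∣ × (∀ j → ∣ g j ∣ ≤ ∣ g i ∣))
    largest {zero}  g = inj₁ λ ()
    largest {suc d} g with argmax (λ i → ∣ g i ∣)
    ... | i , max with ∣ g i ∣ ≤? G₀
    ... | yes le = inj₁ λ j → ≤-trans (max j) le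
    ... | no ¬le = inj₂ (i , ≰⇒> ¬le , max)

    nonzero : ∀ {i} (g : Vector d) → G₀ < ∣ g i ∣ → g i ≢ 0ℤ
    nonzero g G₀<G e = n≮0 (subst (G₀ <_) (cong ∣_∣ e) G₀<G)

    advance : ∀ {Y} (s : State Y) D Rest′ f g′ → State.Rest s ↭ D ++ Rest′ →
      (∀ {b} → b ∈ D → b ∈ State.Rest s × + H ℤ.≤ dot f (gap ξ (b , o))) → At (Y ++ D) g′ → State (Y ++ D)
    advance {Y} (state g R↭ o∉ at) D Rest′ f g′ q D⊆ at′ = state {Rest = Rest′} g′
      (↭-trans R↭ (↭-trans (++⁺ˡ Y q) (↭-reflexive (sym (++-assoc Y D Rest′))))) o∉′ at′
      where
      o∉′ : o ∉ Y ++ D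
      o∉′ o∈ with ∈-++⁻ Y o∈
      ... | inj₁ o∈Y = o∉ o∈Y
      -- The step from o to itself has inner product 0 < H, so o never enters a block; an average
      -- must not contain o.
      ... | inj₂ o∈D = gap-self-small ξ f o (*-mono-≤ 1≤J₀ 1≤μ) (proj₂ (D⊆ o∈D))

    Step : ∀ {Y} → State Y → Set
    Step {Y} s = ∃[ D ] length D ≡ L₂ × Σ (State (Y ++ D)) λ s′ → energy s′ ℤ.≤ energy s ℤ.- + (G₀ * K)

    step-moved : ∀ {Y} (s : State Y) D Rest′ f → State.Rest s ↭ D ++ Rest′ → length D ≡ L₂ →
      (∀ {b} → b ∈ D → b ∈ State.Rest s × + H ℤ.≤ dot f (gap ξ (b , o))) →
      ∃[ g′ ] At (Y ++ D) g′ × + J₀ ℤ.* dot g′ g′ ℤ.≤ energy s ℤ.- + (G₀ * K) → Step s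
    step-moved (state g R↭ o∉ at) D Rest′ f q len D⊆ (g′ , at′ , e≤) =
      D , len , advance (state g R↭ o∉ at) D Rest′ f g′ q D⊆ at′ , e≤

    step-direction : ∀ {Y} (s : State Y) i f ρ → G₀ < ∣ State.g s i ∣ → (∀ j → ∣ State.g s j ∣ ≤ ∣ State.g s i ∣) →
      (∀ j → ∣ ρ j ∣ ≤ ∣ State.g s i ∣) → (∀ j → + J₀ ℤ.* State.g s j ≡ ρ j ℤ.- + ∣ State.g s i ∣ ℤ.* f j) →
      (∃[ D ] ∃[ Rest′ ] State.Rest s ↭ D ++ Rest′ × length D ≡ L₂ ×
        (∀ {b} → b ∈ D → b ∈ State.Rest s × + H ℤ.≤ dot f (gap ξ (b , o)))) → Step s
    step-direction {Y} s i f ρ G₀<G max ρ≤ eq (D , Rest′ , q , len , D⊆) = step-moved s D Rest′ f q len D⊆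
      (move {Y} {State.g s} {D} {f} {ρ} (∣ State.g s i ∣) (State.at s) len
        (λ b∈ → R⊆B (∈-resp-↭ (↭-sym (State.R↭ s)) (∈-++⁺ʳ Y (proj₁ (D⊆ b∈)))) , proj₂ (D⊆ b∈)) (<⇒≤ G₀<G) max ρ≤ eq)

    step : ∀ {Y} (s : State Y) i → G₀ < ∣ State.g s i ∣ → (∀ j → ∣ State.g s j ∣ ≤ ∣ State.g s i ∣) → length Y + L₂ ≤ Θ → Step s
    step {Y} s i G₀<G max room with direction (State.g s) i max (nonzero (State.g s) G₀<G)
    ... | f , ρ , f≤ , fi= , ρ≤ , eq =
      step-direction s i f ρ G₀<G max ρ≤ eq (block {Y} {State.Rest s} f (State.R↭ s) room f≤ (i , fi=))

    energy-positive : ∀ {Y} (s : State Y) i → G₀ < ∣ State.g s i ∣ → ¬ energy s ℤ.≤ 0ℤ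
    energy-positive s i G₀<G e≤0 = contradiction (ℤₚ.≤-trans square≤ e≤0) (ℤₚ.<⇒≱ (ℤ.+<+ positive))
      where
      g = State.g s
      positive : 0 < J₀ * (∣ g i ∣ * ∣ g i ∣)
      positive = *-mono-≤ 1≤J₀ (*-mono-≤ (≤-<-trans z≤n G₀<G) (≤-<-trans z≤n G₀<G))
      square≤ : + (J₀ * (∣ g i ∣ * ∣ g i ∣)) ℤ.≤ energy s
      square≤ = subst (ℤ._≤ energy s) (trans (cong (λ z → + J₀ ℤ.* z) (i*i≡∣i∣*∣i∣ (g i))) (sym (ℤₚ.pos-* J₀ _)))
        (ℤₚ.*-monoˡ-≤-nonNeg (+ J₀) (square≤dot g i))

    Result : Set
    Result = ∃[ Y ] Σ (State Y) Close

    Ready : ℕ → ∀ {Y} → State Y → Set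
    Ready fuel {Y} s = length Y + fuel * L₂ ≤ Θ × energy s ℤ.≤ + (fuel * (G₀ * K))

    stop : ∀ {Y} (s : State Y) → Ready 0 s → Close s
    stop s (_ , e≤) with largest (State.g s)
    ... | inj₁ close = close
    ... | inj₂ (i , G₀<G , _) = ⊥-elim (energy-positive s i G₀<G e≤)

    ready-step : ∀ fuel {Y} (s : State Y) → Ready (suc fuel) s → Step s → ∃[ Y′ ] Σ (State Y′) (Ready fuel)
    ready-step fuel {Y} s (room , e≤) (D , len , s′ , e≤′) = Y ++ D , s′ , room′ ,
      ℤₚ.≤-trans e≤′ (≤-by (trans (e (+ (fuel * (G₀ * K))) (energy s) (+ (G₀ * K)))
        (cong (λ z → z ℤ.- energy s) (sym (ℤₚ.pos-+ (G₀ * K) (fuel * (G₀ * K)))))) (0≤gap e≤))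
      where
      e : ∀ x y z → x ℤ.- (y ℤ.- z) ≡ (z ℤ.+ x) ℤ.- y
      e = ℤ-ring
      room′ : length (Y ++ D) + fuel * L₂ ≤ Θ
      room′ = ≤-trans (≤-reflexive (trans (cong (_+ fuel * L₂) (trans (length-++ Y) (cong (λ z → length Y + z) len)))
        (+-assoc (length Y) L₂ (fuel * L₂)))) room

    next : ∀ fuel {Y} (s : State Y) → Ready (suc fuel) s → Result ⊎ (∃[ Y′ ] Σ (State Y′) (Ready fuel))
    next fuel {Y} s r with largest (State.g s)
    ... | inj₁ close = inj₁ (Y , s , close)
    ... | inj₂ (i , G₀<G , max) = inj₂ (ready-step fuel s r
            (step s i G₀<G max (≤-trans (+-monoʳ-≤ (length Y) (m≤m+n L₂ (fuel * L₂))) (proj₁ r))))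

    walk : ∀ fuel {Y} (s : State Y) → Ready fuel s → Result
    walk zero {Y} s r = Y , s , stop s r
    walk (suc fuel) s r with next fuel s r
    ... | inj₁ result         = result
    ... | inj₂ (_ , s′ , r′) = walk fuel s′ r′

-- Points that are not deep

pigeonhole : ∀ {A : Set} (key : A → ℕ) m .{{_ : NonZero m}} xs → (∀ {x} → x ∈ xs → key x < m) →
  ∃[ v ] length xs ≤ m * count (λ x → key x ≟ v) xs
pigeonhole {A} key m xs key< with any? (λ v → length xs ≤? m * count (λ x → key x ≟ v) xs) (upTo m)
... | yes p = case find p of λ (v , _ , le) → v , le
... | no ¬p with length xs in len
... | zero  = 0 , z≤n
... | suc n = ⊥-elim (<-irrefl refl (begin-strict
  length xs                                       ≡⟨ *-identityʳ _ ⟨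
  length xs * 1                                   ≤⟨ ∑-≥ (λ x → count (key x ≟_) (upTo m)) 1 xs hit ⟩
  ∑ (λ x → count (key x ≟_) (upTo m)) xs          ≡⟨ double-count (λ x v → key x ≟ v) xs (upTo m) ⟩
  ∑ (λ v → count (λ x → key x ≟ v) xs) (upTo m)   ≤⟨ ∑-≤ _ (n / m) (upTo m) few ⟩
  length (upTo m) * (n / m)                       ≡⟨ trans (cong (_* (n / m)) (length-upTo m)) (*-comm m (n / m)) ⟩
  n / m * m                                       ≤⟨ m/n*n≤m n m ⟩
  n                                               <⟨ ≤-reflexive (sym len) ⟩
  length xs                                       ∎))
  where
  open ≤-Reasoning
  hit : ∀ {x} → x ∈ xs → 1 ≤ count (key x ≟_) (upTo m)
  hit {x} x∈ = ∈-length (∈-filter⁺ (key x ≟_) (∈-upTo⁺ (key< x∈)) refl)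
  few : ∀ {v} → v ∈ upTo m → count (λ x → key x ≟ v) xs ≤ n / m
  few {v} v∈ = subst (_≤ n / m) (trans (cong (_/ m) (*-comm m c)) (m*n/n≡m c m))
    (/-mono-≤ (≤-pred (≰⇒> (λ h → ¬p (lose v∈ h)))) (≤-refl {m}))
    where
    c = count (λ x → key x ≟ v) xs

pigeonholes : ∀ {A : Set} n (key : Fin n → A → ℕ) m .{{_ : NonZero m}} xs → (∀ l {x} → x ∈ xs → key l x < m) → Unique xs →
  ∃[ ys ] Unique ys × (∀ {x} → x ∈ ys → x ∈ xs) × length xs ≤ m ^ n * length ys ×
    (∀ l {x y} → x ∈ ys → y ∈ ys → key l x ≡ key l y)
pigeonholes zero    key m xs key< u = xs , u , id , ≤-reflexive (sym (+-identityʳ _)) , λ ()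
pigeonholes (suc n) key m xs key< u with pigeonhole (key fz) m xs (key< fz)
... | v , le with pigeonholes n (key ∘ fs) m (filter (λ x → key fz x ≟ v) xs)
                    (λ l x∈ → key< (fs l) (proj₁ (∈-filter⁻ (λ x → key fz x ≟ v) {xs = xs} x∈)))
                    (Unique.filter⁺ (λ x → key fz x ≟ v) u)
... | ys , uys , ys⊆ , le′ , same = ys , uys , (λ x∈ → proj₁ (∈-filter⁻ (λ x → key fz x ≟ v) {xs = xs} (ys⊆ x∈))) ,
  ≤-trans le (≤-trans (*-monoʳ-≤ m le′) (≤-reflexive (sym (*-assoc m (m ^ n) (length ys))))) ,
  λ { fz x∈ y∈ → trans (key≡v x∈) (sym (key≡v y∈)) ; (fs l) → same l }
  where
  key≡v : ∀ {x} → x ∈ ys → key fz x ≡ v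
  key≡v x∈ = proj₂ (∈-filter⁻ (λ x → key fz x ≟ v) {xs = xs} (ys⊆ x∈))

same-cell : ∀ {m n} k .{{_ : NonZero k}} → m / k ≡ n / k → ∣ + m ℤ.- + n ∣ ≤ k
same-cell {m} {n} k e = subst (λ z → ∣ z ∣ ≤ k) (sym eq)
  (≤-trans (≤-trans (≤-reflexive (cong ∣_∣ (ℤₚ.m-n≡m⊖n (m % k) (n % k)))) (ℤₚ.∣m⊝n∣≤m⊔n (m % k) (n % k)))
    (⊔-lub (<⇒≤ (m%n<n m k)) (<⇒≤ (m%n<n n k))))
  where
  l : ∀ a b q → (a ℤ.+ q) ℤ.- (b ℤ.+ q) ≡ a ℤ.- b
  l = ℤ-ring
  decompose : ∀ m → + m ≡ + (m % k) ℤ.+ + (m / k * k)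
  decompose m = trans (cong +_ (m≡m%n+[m/n]*n m k)) (ℤₚ.pos-+ (m % k) _)
  eq : + m ℤ.- + n ≡ + (m % k) ℤ.- + (n % k)
  eq = trans (cong₂ ℤ._-_ (decompose m) (trans (decompose n) (cong (λ q → + (n % k) ℤ.+ + (q * k)) (sym e)))) (l (+ (m % k)) (+ (n % k)) (+ (m / k * k)))

sign-key : ℤ → ℕ
sign-key (+ _)    = 0
sign-key -[1+ _ ] = 1

same-sign : ∀ i j → sign-key i ≡ sign-key j → ∣ i ∣ ≡ ∣ j ∣ → i ≡ j
same-sign (+ m)    (+ n)    _  e = cong +_ e
same-sign -[1+ m ] -[1+ n ] _  e = cong -[1+_] (suc-injective e)
same-sign (+ m)    -[1+ n ] () e
same-sign -[1+ m ] (+ n)    () e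

sign-key<2 : ∀ i → sign-key i < 2
sign-key<2 (+ _)    = s≤s z≤n
sign-key<2 -[1+ _ ] = s≤s (s≤s z≤n)

inhabitant : ∀ {A : Set} (xs : List A) → 1 ≤ length xs → ∃[ x ] x ∈ xs
inhabitant (x ∷ _) _ = x , here refl

-- In-degrees and out-degrees of a relation have the same average.
few-in-neighbours : ∀ {A : Set} {R : A → A → Set} (R? : ∀ x y → Dec (R x y)) Θ xs → 1 ≤ length xs →
  (∀ {x} → x ∈ xs → count (R? x) xs < Θ) → ∃[ y ] y ∈ xs × count (λ x → R? x y) xs < Θ
few-in-neighbours R? Θ xs 1≤xs out with any? (λ y → count (λ x → R? x y) xs <? Θ) xs
... | yes p = find p
... | no ¬p with Θ
... | zero  = case inhabitant xs 1≤xs of λ (x , x∈) → ⊥-elim (n≮0 (out x∈))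
... | suc θ = ⊥-elim (<-irrefl refl (begin-strict
  length xs * θ                            <⟨ *-monoʳ-< (length xs) {{>-nonZero 1≤xs}} (n<1+n θ) ⟩
  length xs * suc θ                        ≤⟨ ∑-≥ _ (suc θ) xs (λ y∈ → ≮⇒≥ (λ h → ¬p (lose y∈ h))) ⟩
  ∑ (λ y → count (λ x → R? x y) xs) xs     ≡⟨ double-count R? xs xs ⟨
  ∑ (λ x → count (R? x) xs) xs             ≤⟨ ∑-≤ _ θ xs (λ x∈ → ≤-pred (out x∈)) ⟩
  length xs * θ                            ∎))
  where open ≤-Reasoning

map-unique-injective : ∀ {A B : Set} (f : A → B) {xs} → Unique (map f xs) →
  ∀ {x y} → x ∈ xs → y ∈ xs → f x ≡ f y → x ≡ y
map-unique-injective f (p ∷ u) (here refl) (here refl) e = refl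
map-unique-injective f (p ∷ u) (here refl) (there y∈)  e = ⊥-elim (All.lookup p (∈-map⁺ f y∈) e)
map-unique-injective f (p ∷ u) (there x∈)  (here refl) e = ⊥-elim (All.lookup p (∈-map⁺ f x∈) (sym e))
map-unique-injective f (p ∷ u) (there x∈)  (there y∈)  e = map-unique-injective f u x∈ y∈ e

record Shallow {d} (ξ : ℕ → Vector d) (R : List ℕ) (J₀ H Θ : ℕ) : Set where
  field
    o   : ℕ
    f   : Vector d
    i   : Fin d
    f≤  : ∀ l → ∣ f l ∣ ≤ J₀
    fi≡ : ∣ f i ∣ ≡ J₀
    few : count (λ b → + H ℤₚ.≤? dot f (gap ξ (b , o))) R < Θ

module _ {d} (ξ : ℕ → Vector d) (R : List ℕ) (J₀ H Θ : ℕ) where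

  -- The failure of a statement about all f yields a witness only under double negation, whence the
  -- continuation into ⊥.
  shallow-point : ∀ o → ¬ Deep ξ R J₀ H Θ o → ((x : Shallow ξ R J₀ H Θ) → Shallow.o x ≡ o → ⊥) → ⊥
  shallow-point o ¬deep k = ¬deep deep
    where
    deep : Deep ξ R J₀ H Θ o
    deep f f≤ (i , fi≡) with Θ ≤? count (λ b → + H ℤₚ.≤? dot f (gap ξ (b , o))) R
    ... | yes le = le
    ... | no ¬le = ⊥-elim (k (record { o = o ; f = f ; i = i ; f≤ = f≤ ; fi≡ = fi≡ ; few = ≰⇒> ¬le }) refl)

  shallow-points : ∀ os → (∀ {o} → o ∈ os → ¬ Deep ξ R J₀ H Θ o) →
    ((xs : List (Shallow ξ R J₀ H Θ)) → map Shallow.o xs ≡ os → ⊥) → ⊥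
  shallow-points []       ¬deep k = k [] refl
  shallow-points (o ∷ os) ¬deep k = shallow-point o (¬deep (here refl)) λ x e →
    shallow-points os (¬deep ∘ there) λ xs es → k (x ∷ xs) (cong₂ _∷_ e es)

-- If neither of two points with displacement Δ lies in the cap of the other, then fy − fx is monotone
-- along Δ up to 2 ς ². As in Minty's parametrisation of monotone relations, closeness of the sums
-- ξ + f then forces closeness of ξ and of f separately.
module _ {d : ℕ} (i : Fin (suc d)) (ς h : ℕ) (d+5≤h : d + 5 ≤ h) (Δ fx fy : Vector (suc d)) (same-i : fx i ≡ fy i)
  (close : ∀ l → ∣ Δ (punchIn i l) ℤ.+ (fy (punchIn i l) ℤ.- fx (punchIn i l)) ∣ ≤ ς)
  (y∉cap : ¬ (+ (ς * ς) ℤ.≤ dot fx Δ)) (x∉cap : ¬ (+ (ς * ς) ℤ.≤ ℤ.- dot fy Δ)) where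

  private
    P F : Vector d
    P l = Δ (punchIn i l)
    F l = fy (punchIn i l) ℤ.- fx (punchIn i l)
    s D A Q M a b : ℤ
    s = + (ς * ς)
    D = + d
    A = dot P P
    Q = dot F F
    M = dot P F
    a = dot fx Δ
    b = dot fy Δ

    a≤s : a ℤ.≤ s
    a≤s = ℤₚ.<⇒≤ (ℤₚ.≰⇒> y∉cap)

    -b≤s : ℤ.- b ℤ.≤ s
    -b≤s = ℤₚ.<⇒≤ (ℤₚ.≰⇒> x∉cap)

    -- fx and fy agree at i, so this component drops out of the difference, whatever Δ i is.
    b≡a+M : b ≡ a ℤ.+ M
    b≡a+M = trans (l b a) (cong (λ z → a ℤ.+ z) (begin
      b ℤ.- a                                             ≡⟨ dot-- fy fx Δ ⟨
      dot (λ l → fy l ℤ.- fx l) Δ                         ≡⟨ dot-punchIn i (λ l → fy l ℤ.- fx l) Δ ⟩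
      (fy i ℤ.- fx i) ℤ.* Δ i ℤ.+ dot F P                 ≡⟨ cong₂ (λ z w → z ℤ.* Δ i ℤ.+ w)
        (trans (cong (λ z → fy i ℤ.- z) same-i) (ℤₚ.+-inverseʳ (fy i))) (dot-comm F P) ⟩
      0ℤ ℤ.* Δ i ℤ.+ M                                    ≡⟨ cong (ℤ._+ M) (ℤₚ.*-zeroˡ (Δ i)) ⟩
      0ℤ ℤ.+ M                                            ≡⟨ ℤₚ.+-identityˡ M ⟩
      M                                                   ∎))
      where
      open ≡-Reasoning
      l : ∀ b a → b ≡ a ℤ.+ (b ℤ.- a)
      l = ℤ-ring

    sum≤ : A ℤ.+ + 2 ℤ.* M ℤ.+ Q ℤ.≤ D ℤ.* s
    sum≤ = subst₂ ℤ._≤_ (dot-square P F) (ℤₚ.pos-* d (ς * ς)) (+≤⇒∣∣ (dot-∣∣≤ ς ς close close))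

    -- |P + F|² is at most d ς², and the two cap conditions give M = b - a ≥ - 2 ς². Together they
    -- bound |P|² + |F|².
    A+Q≤ : A ℤ.+ Q ℤ.≤ (D ℤ.+ + 4) ℤ.* s
    A+Q≤ = ≤-by (e D s A Q M a b b≡a+M)
      (0≤+ (0≤gap sum≤) (0≤+ (0≤* {+ 2} (+≤+ z≤n) (0≤gap a≤s)) (0≤* {+ 2} (+≤+ z≤n) (0≤gap -b≤s))))
      where
      e : ∀ D s A Q M a b → b ≡ a ℤ.+ M → (D ℤ.+ + 4) ℤ.* s ℤ.- (A ℤ.+ Q) ≡
        (D ℤ.* s ℤ.- (A ℤ.+ + 2 ℤ.* M ℤ.+ Q)) ℤ.+ (+ 2 ℤ.* (s ℤ.- a) ℤ.+ + 2 ℤ.* (s ℤ.- ℤ.- b))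
      e D s A Q M a b refl = l D s A Q M a
        where
        l : ∀ D s A Q M a → (D ℤ.+ + 4) ℤ.* s ℤ.- (A ℤ.+ Q) ≡
          (D ℤ.* s ℤ.- (A ℤ.+ + 2 ℤ.* M ℤ.+ Q)) ℤ.+ (+ 2 ℤ.* (s ℤ.- a) ℤ.+ + 2 ℤ.* (s ℤ.- ℤ.- (a ℤ.+ M)))
        l = ℤ-ring

    2M≤A+Q : + 2 ℤ.* M ℤ.≤ A ℤ.+ Q
    2M≤A+Q = ≤-by (trans (e A Q M) (sym (trans (dot-square P (λ l → ℤ.- + 1 ℤ.* F l)) (cong₂ (λ z w → A ℤ.+ + 2 ℤ.* z ℤ.+ w)
        (trans (dot-comm P _) (trans (dot-* (ℤ.- + 1) F P) (cong (λ z → ℤ.- + 1 ℤ.* z) (dot-comm F P))))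
        (trans (dot-* (ℤ.- + 1) F _) (cong (λ z → ℤ.- + 1 ℤ.* z) (trans (dot-comm F _) (dot-* (ℤ.- + 1) F F))))))))
      (0≤dot (λ l → P l ℤ.+ ℤ.- + 1 ℤ.* F l))
      where
      e : ∀ A Q M → (A ℤ.+ Q) ℤ.- + 2 ℤ.* M ≡ A ℤ.+ + 2 ℤ.* (ℤ.- + 1 ℤ.* M) ℤ.+ ℤ.- + 1 ℤ.* (ℤ.- + 1 ℤ.* Q)
      e = ℤ-ring

    D+4≡ : + ((d + 4) * (ς * ς)) ≡ (D ℤ.+ + 4) ℤ.* s
    D+4≡ = trans (ℤₚ.pos-* (d + 4) (ς * ς)) (cong (ℤ._* s) (ℤₚ.pos-+ d 4))

    1≤h : 1 ≤ h
    1≤h = ≤-trans (≤-trans (s≤s z≤n) (m≤n+m 5 d)) d+5≤h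

  close-coordinates : ∀ l → ∣ Δ (punchIn i l) ∣ ≤ h * ς
  close-coordinates l = square-cancel _ _ (begin
    ∣ P l ∣ * ∣ P l ∣          ≤⟨ drop‿+≤+ (ℤₚ.≤-trans (ℤₚ.≤-reflexive (sym (i*i≡∣i∣*∣i∣ (P l)))) (ℤₚ.≤-trans (square≤dot P l)
                                  (ℤₚ.≤-trans A≤ (ℤₚ.≤-reflexive (sym D+4≡))))) ⟩
    (d + 4) * (ς * ς)          ≤⟨ *-monoˡ-≤ (ς * ς) (≤-trans (+-monoʳ-≤ d (n≤1+n 4)) d+5≤h) ⟩
    h * (ς * ς)                ≤⟨ m≤m*n (h * (ς * ς)) h {{>-nonZero 1≤h}} ⟩
    h * (ς * ς) * h            ≡⟨ e h ς ⟩
    h * ς * (h * ς)            ∎)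
    where
    open ≤-Reasoning
    e : ∀ h ς → h * (ς * ς) * h ≡ h * ς * (h * ς)
    e = ℕ-ring
    A≤ : A ℤ.≤ (D ℤ.+ + 4) ℤ.* s
    A≤ = ℤₚ.≤-trans (subst (ℤ._≤ A ℤ.+ Q) (ℤₚ.+-identityʳ A) (ℤₚ.+-monoʳ-≤ A (0≤dot F))) A+Q≤

  close-height : ∣ dot fx Δ ∣ ≤ h * (ς * ς)
  close-height = ∣i∣≤ a (ℤₚ.≤-trans a≤s (+≤+ (m≤n*m (ς * ς) h {{>-nonZero 1≤h}})))
    (ℤₚ.*-cancelˡ-≤-pos _ _ (+ 2) (ℤₚ.≤-trans -2a≤ (ℤₚ.≤-trans (ℤₚ.≤-reflexive (sym (trans (ℤₚ.pos-* (d + 6) (ς * ς)) (cong (ℤ._* s) (ℤₚ.pos-+ d 6)))))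
      (ℤₚ.≤-trans (+≤+ (*-monoˡ-≤ (ς * ς) d+6≤2h)) (ℤₚ.≤-reflexive (trans (cong +_ (*-assoc 2 h (ς * ς))) (ℤₚ.pos-* 2 (h * (ς * ς)))))))))
    where
    d+6≤2h : d + 6 ≤ 2 * h
    d+6≤2h = ≤-trans (≤-reflexive (+-suc d 5)) (≤-trans (+-mono-≤ 1≤h d+5≤h) (≤-reflexive (e h)))
      where
      e : ∀ h → h + h ≡ 2 * h
      e = ℕ-ring
    -- The missing lower bound for a: a = b - M, where b ≥ - ς² and 2 M ≤ A + Q.
    -2a≤ : + 2 ℤ.* ℤ.- a ℤ.≤ (D ℤ.+ + 6) ℤ.* s
    -2a≤ = ≤-by (e D s A Q M a b b≡a+M) (0≤+ (0≤gap A+Q≤) (0≤+ (0≤gap 2M≤A+Q) (0≤* {+ 2} (+≤+ z≤n) (0≤gap -b≤s))))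
      where
      l : ∀ D s A Q M a → (D ℤ.+ + 6) ℤ.* s ℤ.- + 2 ℤ.* ℤ.- a ≡
        ((D ℤ.+ + 4) ℤ.* s ℤ.- (A ℤ.+ Q)) ℤ.+ (((A ℤ.+ Q) ℤ.- + 2 ℤ.* M) ℤ.+ + 2 ℤ.* (s ℤ.- ℤ.- (a ℤ.+ M)))
      l = ℤ-ring
      e : ∀ D s A Q M a b → b ≡ a ℤ.+ M → (D ℤ.+ + 6) ℤ.* s ℤ.- + 2 ℤ.* ℤ.- a ≡
        ((D ℤ.+ + 4) ℤ.* s ℤ.- (A ℤ.+ Q)) ℤ.+ (((A ℤ.+ Q) ℤ.- + 2 ℤ.* M) ℤ.+ + 2 ℤ.* (s ℤ.- ℤ.- b))
      e D s A Q M a b refl = l D s A Q M a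

-- In the application J₀ = Y ς. As f has norm J₀, `height` bounds the extent in the direction f / J₀
-- by h ς / Y, thinner by the factor Y than the widths h ς allowed by `near`.
record Slab {d} (ξ : ℕ → Vector (suc d)) (R : List ℕ) (J₀ ς h m : ℕ) : Set where
  field
    o        : ℕ
    f        : Vector (suc d)
    i        : Fin (suc d)
    f≤       : ∀ l → ∣ f l ∣ ≤ J₀
    fi≡      : ∣ f i ∣ ≡ J₀
    B′       : List ℕ
    B′-uniq  : Unique B′
    B′⊆R     : ∀ {b} → b ∈ B′ → b ∈ R
    B′-card  : length B′ ≡ m
    near     : ∀ {b} → b ∈ B′ → ∀ l → ∣ gap ξ (b , o) (punchIn i l) ∣ ≤ h * ς
    height   : ∀ {b} → b ∈ B′ → ∣ dot f (gap ξ (b , o)) ∣ ≤ h * (ς * ς)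

dot-gap-swap : ∀ {d} (ξ : ℕ → Vector d) f a b → dot f (gap ξ (a , b)) ≡ ℤ.- dot f (gap ξ (b , a))
dot-gap-swap ξ f a b = begin
  dot f (gap ξ (a , b))                     ≡⟨ trans (dot-comm f _) (dot-- (ξ a) (ξ b) f) ⟩
  dot (ξ a) f ℤ.- dot (ξ b) f               ≡⟨ e (dot (ξ a) f) (dot (ξ b) f) ⟩
  ℤ.- (dot (ξ b) f ℤ.- dot (ξ a) f)         ≡⟨ cong ℤ.-_ (trans (dot-comm f _) (dot-- (ξ b) (ξ a) f)) ⟨
  ℤ.- dot f (gap ξ (b , a))                 ∎
  where
  open ≡-Reasoning
  e : ∀ x y → x ℤ.- y ≡ ℤ.- (y ℤ.- x)
  e = ℤ-ring

record SlabBounds {d} (ξ : ℕ → Vector (suc d)) (R : List ℕ) : Set where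
  field
    J₀ ς Y h Θ : ℕ
    {{ς≢0}} : NonZero ς
    J₀≡Yς   : J₀ ≡ Y * ς
    1≤Θ     : 1 ≤ Θ
    d+5≤h   : d + 5 ≤ h
    ξ≤      : ∀ {b} → b ∈ R → ∀ l → ∣ ξ b l ∣ ≤ J₀
    R-uniq  : Unique R
    many    : suc d * (2 * (suc (4 * Y) ^ d * (3 * Θ))) ≤ length R

module _ {d} {ξ : ℕ → Vector (suc d)} {R : List ℕ} (S : SlabBounds ξ R) where

  open SlabBounds S

  private
    H : ℕ
    H = ς * ς
    Point : Set
    Point = Shallow ξ R J₀ H Θ
    open Shallow

    -- The element of y lies in the cap at the element of x, a cap that holds fewer than Θ elements
    -- by `few`.
    bad : Point → Point → Set
    bad x y = + H ℤ.≤ dot (f x) (gap ξ (o y , o x))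
    bad? : ∀ x y → Dec (bad x y)
    bad? x y = + H ℤₚ.≤? dot (f x) (gap ξ (o y , o x))

    -- The shift by 2 J₀ makes the value nonnegative, so that the cell is not affected by ∣_∣.
    value : Fin (suc d) → Point → ℤ
    value l x = ξ (o x) l ℤ.+ f x l ℤ.+ + (J₀ + J₀)
    cell : Fin (suc d) → Point → ℕ
    cell l x = ∣ value l x ∣ / ς

    -- Only the cells of ξ + f are compared, in the d coordinates other than i₀. Separate cells for
    -- ξ and for f would square the number of classes, which the exponents could not afford.
    Alike : Fin (suc d) → Point → Point → Set
    Alike i₀ x y = i x ≡ i₀ × i y ≡ i₀ × sign-key (f x (i x)) ≡ sign-key (f y (i y)) ×
      (∀ l → cell (punchIn i₀ l) x ≡ cell (punchIn i₀ l) y)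

    module _ {xs : List Point} (R≡ : map o xs ≡ R) where

      o∈R : ∀ {x} → x ∈ xs → o x ∈ R
      o∈R x∈ = subst (_ ∈_) R≡ (∈-map⁺ o x∈)

      map-uniq : Unique (map o xs)
      map-uniq = subst Unique (sym R≡) R-uniq

      ∣ξ+f∣≤ : ∀ l {x} → x ∈ xs → ∣ ξ (o x) l ℤ.+ f x l ∣ ≤ J₀ + J₀
      ∣ξ+f∣≤ l {x} x∈ = ∣i+j∣≤ (ξ (o x) l) (f x l) (ξ≤ (o∈R x∈) l) (f≤ x l)

      cell< : ∀ l {x} → x ∈ xs → cell l x < suc (4 * Y)
      cell< l {x} x∈ = m<n*o⇒m/o<n (≤-<-trans (∣i+j∣≤ (ξ (o x) l ℤ.+ f x l) (+ (J₀ + J₀)) (∣ξ+f∣≤ l x∈) ≤-refl)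
        (≤-<-trans (≤-reflexive (trans (cong (λ j → j + j + (j + j)) J₀≡Yς) (e Y ς))) (m<n+m (4 * Y * ς) (>-nonZero⁻¹ ς))))
        where
        e : ∀ y s → y * s + y * s + (y * s + y * s) ≡ 4 * y * s
        e = ℕ-ring

      same-cell-close : ∀ l {x y} → x ∈ xs → y ∈ xs → cell l x ≡ cell l y →
        ∣ gap ξ (o y , o x) l ℤ.+ (f y l ℤ.- f x l) ∣ ≤ ς
      same-cell-close l {x} {y} x∈ y∈ e = subst (λ z → ∣ z ∣ ≤ ς)
        (trans (cong₂ ℤ._-_ (pos y∈) (pos x∈)) (l₁ (ξ (o y) l) (f y l) (ξ (o x) l) (f x l) (+ (J₀ + J₀))))
        (same-cell ς (sym e))
        where
        pos : ∀ {x} → x ∈ xs → + ∣ value l x ∣ ≡ value l x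
        pos {x} x∈ = ℤₚ.0≤i⇒+∣i∣≡i (∣i∣≤n⇒0≤i+n (ξ (o x) l ℤ.+ f x l) (∣ξ+f∣≤ l x∈))
        l₁ : ∀ a b c e j → (a ℤ.+ b ℤ.+ j) ℤ.- (c ℤ.+ e ℤ.+ j) ≡ (a ℤ.- c) ℤ.+ (b ℤ.- e)
        l₁ = ℤ-ring

      alike-close : ∀ {i₀ x y} → x ∈ xs → y ∈ xs → Alike i₀ x y → ¬ bad x y → ¬ bad y x →
        (∀ l → ∣ gap ξ (o y , o x) (punchIn i₀ l) ∣ ≤ h * ς) × ∣ dot (f x) (gap ξ (o y , o x)) ∣ ≤ h * (ς * ς)
      alike-close {i₀} {x} {y} x∈ y∈ (refl , iy≡ , sign , cells) ¬xy ¬yx =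
        close-coordinates i₀ ς h d+5≤h Δ (f x) (f y) same near ¬xy ¬yx′ , close-height i₀ ς h d+5≤h Δ (f x) (f y) same near ¬xy ¬yx′
        where
        Δ : Vector (suc d)
        Δ = gap ξ (o y , o x)
        same : f x i₀ ≡ f y i₀
        same = trans (same-sign _ _ sign (trans (fi≡ x) (sym (fi≡ y)))) (cong (f y) iy≡)
        near : ∀ l → ∣ Δ (punchIn i₀ l) ℤ.+ (f y (punchIn i₀ l) ℤ.- f x (punchIn i₀ l)) ∣ ≤ ς
        near l = same-cell-close (punchIn i₀ l) x∈ y∈ (cells l)
        ¬yx′ : ¬ (+ H ℤ.≤ ℤ.- dot (f y) Δ)
        ¬yx′ le = ¬yx (subst (+ H ℤ.≤_) (sym (dot-gap-swap ξ (f y) (o x) (o y))) le)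

      cells^d : ℕ
      cells^d = suc (4 * Y) ^ d

      private instance
        cells≢0 : NonZero cells^d
        cells≢0 = m^n≢0 (suc (4 * Y)) d

      length-xs≥ : suc d * (2 * (cells^d * (3 * Θ))) ≤ length xs
      length-xs≥ = ≤-trans many (≤-reflexive (trans (cong length (sym R≡)) (length-map o xs)))

      by-index : ∃[ ys ] ∃[ i₀ ] Unique ys × (∀ {x} → x ∈ ys → x ∈ xs × i x ≡ i₀) × 2 * (cells^d * (3 * Θ)) ≤ length ys
      by-index = split (pigeonholes 1 (λ _ → toℕ ∘ i) (suc d) xs (λ _ _ → toℕ<n _) (Unique.map⁻ map-uniq))
        where
        split : (∃[ ys ] Unique ys × (∀ {x} → x ∈ ys → x ∈ xs) × length xs ≤ suc d ^ 1 * length ys ×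
          (∀ (l : Fin 1) {x y} → x ∈ ys → y ∈ ys → toℕ (i x) ≡ toℕ (i y))) →
          ∃[ ys ] ∃[ i₀ ] Unique ys × (∀ {x} → x ∈ ys → x ∈ xs × i x ≡ i₀) × 2 * (cells^d * (3 * Θ)) ≤ length ys
        split (ys , u , sub , le , same) = ys , i x₀ , u , (λ x∈ → sub x∈ , toℕ-injective (same fz x∈ x₀∈)) , big
          where
          big : 2 * (cells^d * (3 * Θ)) ≤ length ys
          big = *-cancelˡ-≤ (suc d) (≤-trans length-xs≥ (≤-trans le (≤-reflexive (cong (_* length ys) (^-identityʳ (suc d))))))
          1≤ys : 1 ≤ length ys
          1≤ys = ≤-trans (*-mono-≤ {1} {2} (s≤s z≤n) (*-mono-≤ (m^n>0 (suc (4 * Y)) d) (*-mono-≤ {1} {3} (s≤s z≤n) 1≤Θ))) big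
          x₀ : Point
          x₀ = proj₁ (inhabitant ys 1≤ys)
          x₀∈ : x₀ ∈ ys
          x₀∈ = proj₂ (inhabitant ys 1≤ys)

      by-sign : ∀ ys i₀ → Unique ys → (∀ {x} → x ∈ ys → x ∈ xs × i x ≡ i₀) → 2 * (cells^d * (3 * Θ)) ≤ length ys →
        ∃[ zs ] Unique zs × (∀ {x} → x ∈ zs → x ∈ xs × i x ≡ i₀) × cells^d * (3 * Θ) ≤ length zs ×
          (∀ {x y} → x ∈ zs → y ∈ zs → sign-key (f x (i x)) ≡ sign-key (f y (i y)))
      by-sign ys i₀ u sub big = split (pigeonholes 1 (λ _ x → sign-key (f x (i x))) 2 ys (λ _ {x} _ → sign-key<2 (f x (i x))) u)
        where
        split : (∃[ zs ] Unique zs × (∀ {x} → x ∈ zs → x ∈ ys) × length ys ≤ 2 * length zs ×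
          (∀ (l : Fin 1) {x y} → x ∈ zs → y ∈ zs → sign-key (f x (i x)) ≡ sign-key (f y (i y)))) →
          ∃[ zs ] Unique zs × (∀ {x} → x ∈ zs → x ∈ xs × i x ≡ i₀) × cells^d * (3 * Θ) ≤ length zs ×
            (∀ {x y} → x ∈ zs → y ∈ zs → sign-key (f x (i x)) ≡ sign-key (f y (i y)))
        split (zs , u , sub′ , le , same) = zs , u , sub ∘ sub′ , *-cancelˡ-≤ 2 (≤-trans big le) , same fz

      by-cell : ∀ ys i₀ → Unique ys → (∀ {x} → x ∈ ys → x ∈ xs × i x ≡ i₀) → cells^d * (3 * Θ) ≤ length ys →
        (∀ {x y} → x ∈ ys → y ∈ ys → sign-key (f x (i x)) ≡ sign-key (f y (i y))) →
        ∃[ zs ] Unique zs × (∀ {x} → x ∈ zs → x ∈ xs) × 3 * Θ ≤ length zs × (∀ {x y} → x ∈ zs → y ∈ zs → Alike i₀ x y)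
      by-cell ys i₀ u sub big signs = split (pigeonholes d (λ l → cell (punchIn i₀ l)) (suc (4 * Y)) ys
          (λ l x∈ → cell< (punchIn i₀ l) (proj₁ (sub x∈))) u)
        where
        split : (∃[ zs ] Unique zs × (∀ {x} → x ∈ zs → x ∈ ys) × length ys ≤ cells^d * length zs ×
          (∀ l {x y} → x ∈ zs → y ∈ zs → cell (punchIn i₀ l) x ≡ cell (punchIn i₀ l) y)) →
          ∃[ zs ] Unique zs × (∀ {x} → x ∈ zs → x ∈ xs) × 3 * Θ ≤ length zs × (∀ {x y} → x ∈ zs → y ∈ zs → Alike i₀ x y)
        split (zs , u , sub′ , le , same) = zs , u , proj₁ ∘ sub ∘ sub′ , *-cancelˡ-≤ cells^d (≤-trans big le) ,
          λ x∈ y∈ → proj₂ (sub (sub′ x∈)) , proj₂ (sub (sub′ y∈)) , signs (sub′ x∈) (sub′ y∈) , λ l → same l x∈ y∈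

      few-bad : ∀ {ys} → Unique ys → (∀ {x} → x ∈ ys → x ∈ xs) → ∀ x → count (bad? x) ys < Θ
      few-bad {ys} u sub x = ≤-<-trans (length-injection o (Unique.filter⁺ (bad? x) u)
          (λ y∈ → case ∈-filter⁻ (bad? x) {xs = ys} y∈ of λ (y∈ys , b) →
            ∈-filter⁺ (λ b → + H ℤₚ.≤? dot (f x) (gap ξ (b , o x))) (o∈R (sub y∈ys)) b)
          (λ y∈ y′∈ → map-unique-injective o map-uniq
            (sub (proj₁ (∈-filter⁻ (bad? x) {xs = ys} y∈))) (sub (proj₁ (∈-filter⁻ (bad? x) {xs = ys} y′∈)))))
        (few x)

      slab-around : ∀ ys i₀ → Unique ys → (∀ {x} → x ∈ ys → x ∈ xs) → 3 * Θ ≤ length ys →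
        (∀ {x y} → x ∈ ys → y ∈ ys → Alike i₀ x y) → ∀ x → x ∈ ys → count (λ y → bad? y x) ys < Θ → Slab ξ R J₀ ς h Θ
      slab-around ys i₀ u sub 3Θ≤ alike x x∈ few-in = record
        { o = o x ; f = f x ; i = i₀ ; f≤ = f≤ x ; fi≡ = trans (cong (λ j → ∣ f x j ∣) (sym (proj₁ (alike x∈ x∈)))) (fi≡ x)
        ; B′ = take Θ (map o good)
        ; B′-uniq = Unique.take⁺ Θ good-uniq
        ; B′⊆R = λ b∈ → case in-good b∈ of λ { (y , y∈ , refl) → o∈R (sub (proj₁ (good⁻ y∈))) }
        ; B′-card = trans (length-take Θ (map o good)) (m≤n⇒m⊓n≡m (≤-trans Θ≤ (≤-reflexive (sym (length-map o good)))))
        ; near = λ b∈ → case in-good b∈ of λ { (y , y∈ , refl) → proj₁ (close y∈) }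
        ; height = λ b∈ → case in-good b∈ of λ { (y , y∈ , refl) → proj₂ (close y∈) } }
        where
        good? : ∀ y → Dec (¬ bad x y × ¬ bad y x)
        good? y = ¬? (bad? x y) ×-dec ¬? (bad? y x)
        good : List Point
        good = filter good? ys
        good⁻ : ∀ {y} → y ∈ good → y ∈ ys × (¬ bad x y × ¬ bad y x)
        good⁻ = ∈-filter⁻ good? {xs = ys}
        in-good : ∀ {b} → b ∈ take Θ (map o good) → ∃[ y ] y ∈ good × b ≡ o y
        in-good b∈ = ∈-map⁻ o (subst (_ ∈_) (take++drop≡id Θ (map o good)) (∈-++⁺ˡ b∈))
        close : ∀ {y} → y ∈ good → (∀ l → ∣ gap ξ (o y , o x) (punchIn i₀ l) ∣ ≤ h * ς) × ∣ dot (f x) (gap ξ (o y , o x)) ∣ ≤ h * (ς * ς)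
        close y∈ with good⁻ y∈
        ... | y∈ys , ¬xy , ¬yx = alike-close (sub x∈) (sub y∈ys) (alike x∈ y∈ys) ¬xy ¬yx
        good-uniq : Unique (map o good)
        good-uniq = unique-map good (Unique.filter⁺ good? u) (λ y∈ → sub (proj₁ (good⁻ y∈)))
          where
          unique-map : ∀ zs → Unique zs → (∀ {z} → z ∈ zs → z ∈ xs) → Unique (map o zs)
          unique-map []       []      _   = []
          unique-map (z ∷ zs) (p ∷ u) zs⊆ = All.tabulate (λ b∈ e → case ∈-map⁻ o b∈ of λ
              { (y , y∈ , refl) → All.lookup p y∈ (map-unique-injective o map-uniq (zs⊆ (here refl)) (zs⊆ (there y∈)) e) })
            ∷ unique-map zs u (zs⊆ ∘ there)
        -- Of 3 Θ alike points, fewer than Θ lie in the cap at x, and x lies in the caps of fewer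
        -- than Θ of them.
        Θ≤ : Θ ≤ length good
        Θ≤ = +-cancelˡ-≤ (Θ + Θ) Θ (length good) (begin
          Θ + Θ + Θ                                                         ≡⟨ e Θ ⟩
          3 * Θ                                                             ≤⟨ 3Θ≤ ⟩
          length ys                                                         ≤⟨ length-two-filters (bad? x) (λ y → bad? y x) ys ⟩
          count (bad? x) ys + (count (λ y → bad? y x) ys + length good)     ≤⟨ +-mono-≤ (<⇒≤ (few-bad u sub x)) (+-monoˡ-≤ (length good) (<⇒≤ few-in)) ⟩
          Θ + (Θ + length good)                                             ≡⟨ +-assoc Θ Θ (length good) ⟨
          Θ + Θ + length good                                               ∎)
          where
          open ≤-Reasoning
          e : ∀ t → t + t + t ≡ 3 * t
          e = ℕ-ring

      slab : Slab ξ R J₀ ς h Θ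
      slab = around by-index
        where
        around₃ : ∀ i₀ → (∃[ zs ] Unique zs × (∀ {x} → x ∈ zs → x ∈ xs) × 3 * Θ ≤ length zs ×
          (∀ {x y} → x ∈ zs → y ∈ zs → Alike i₀ x y)) → Slab ξ R J₀ ς h Θ
        around₃ i₀ (zs , u , sub , 3Θ≤ , alike) =
          let x , x∈ , few-in = few-in-neighbours bad? Θ zs (≤-trans 1≤Θ (≤-trans (m≤m+n Θ _) 3Θ≤)) (λ {x} _ → few-bad u sub x)
          in slab-around zs i₀ u sub 3Θ≤ alike x x∈ few-in
        around₂ : ∀ i₀ → (∃[ zs ] Unique zs × (∀ {x} → x ∈ zs → x ∈ xs × i x ≡ i₀) × cells^d * (3 * Θ) ≤ length zs ×
          (∀ {x y} → x ∈ zs → y ∈ zs → sign-key (f x (i x)) ≡ sign-key (f y (i y)))) → Slab ξ R J₀ ς h Θ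
        around₂ i₀ (zs , u , sub , big , signs) = around₃ i₀ (by-cell zs i₀ u sub big signs)
        around : (∃[ ys ] ∃[ i₀ ] Unique ys × (∀ {x} → x ∈ ys → x ∈ xs × i x ≡ i₀) × 2 * (cells^d * (3 * Θ)) ≤ length ys) →
          Slab ξ R J₀ ς h Θ
        around (ys , i₀ , u , sub , big) = around₂ i₀ (by-sign ys i₀ u sub big)

  slab-exists : (∀ {o} → o ∈ R → ¬ Deep ξ R J₀ (ς * ς) Θ o) → (Slab ξ R J₀ ς h Θ → ⊥) → ⊥
  slab-exists ¬deep k = shallow-points ξ R J₀ (ς * ς) Θ R ¬deep λ xs R≡ → k (slab R≡)

-- Packing translates of a slab

vecs : ∀ n → ℕ → List (Vec ℕ n)
vecs zero    r = [ [] ]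
vecs (suc n) r = cartesianProductWith _∷_ (upTo r) (vecs n r)

vecs-unique : ∀ n r → Unique (vecs n r)
vecs-unique zero    r = [] ∷ []
vecs-unique (suc n) r = Unique.cartesianProductWith⁺ _∷_ (λ { refl → refl , refl }) (Unique.upTo⁺ r) (vecs-unique n r)

length-vecs : ∀ n r → length (vecs n r) ≡ r ^ n
length-vecs zero    r = refl
length-vecs (suc n) r = trans (length-cartesianProductWith _∷_ (upTo r) (vecs n r)) (cong₂ _*_ (length-upTo r) (length-vecs n r))

lookup-vecs : ∀ n r {v} → v ∈ vecs n r → ∀ l → lookup v l < r
lookup-vecs (suc n) r v∈ l with ∈-cartesianProductWith⁻ _∷_ (upTo r) (vecs n r) v∈
lookup-vecs (suc n) r v∈ fz     | x , w , x∈ , w∈ , refl = ∈-upTo⁻ x∈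
lookup-vecs (suc n) r v∈ (fs l) | x , w , x∈ , w∈ , refl = lookup-vecs n r w∈ l

lookup-ext : ∀ {n} (v w : Vec ℕ n) → (∀ l → lookup v l ≡ lookup w l) → v ≡ w
lookup-ext []      []      e = refl
lookup-ext (x ∷ v) (y ∷ w) e = cong₂ _∷_ (e fz) (lookup-ext v w (e ∘ fs))

grid-separated : ∀ m σ x y {X} → ∣ + m ℤ.* (+ (x * σ) ℤ.- + (y * σ)) ∣ ≤ X → X < m * σ → x ≡ y
grid-separated m σ x y le lt with x ≟ y
... | yes e = e
... | no x≢y = contradiction (begin-strict
  m * σ                                      ≤⟨ *-monoʳ-≤ m (m≤n*m σ (∣ + x ℤ.- + y ∣) {{≢-nonZero ∣x-y∣≢0}}) ⟩
  m * (∣ + x ℤ.- + y ∣ * σ)                  ≡⟨ cong (m *_) (ℤₚ.abs-* (+ x ℤ.- + y) (+ σ)) ⟨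
  m * ∣ (+ x ℤ.- + y) ℤ.* + σ ∣              ≡⟨ ℤₚ.abs-* (+ m) _ ⟨
  ∣ + m ℤ.* ((+ x ℤ.- + y) ℤ.* + σ) ∣        ≡⟨ cong (λ z → ∣ + m ℤ.* z ∣) (trans (cong₂ ℤ._-_ (ℤₚ.pos-* x σ) (ℤₚ.pos-* y σ)) (e (+ x) (+ y) (+ σ))) ⟨
  ∣ + m ℤ.* (+ (x * σ) ℤ.- + (y * σ)) ∣      ≤⟨ le ⟩
  _                                          <⟨ lt ⟩
  m * σ                                      ∎) (<-irrefl refl)
  where
  open ≤-Reasoning
  e : ∀ x y s → x ℤ.* s ℤ.- y ℤ.* s ≡ (x ℤ.- y) ℤ.* s
  e = ℤ-ring
  ∣x-y∣≢0 : ∣ + x ℤ.- + y ∣ ≢ 0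
  ∣x-y∣≢0 z = x≢y (ℤₚ.+-injective (ℤₚ.i-j≡0⇒i≡j (+ x) (+ y) (ℤₚ.∣i∣≡0⇒i≡0 z)))

record PackingBounds {d : ℕ} (𝓕 : Frame (suc d)) (J₀ ς h : ℕ) : Set where
  open Frame 𝓕
  field
    k k′ G₀ σ σᵢ r rᵢ : ℕ
    k′≤L     : k′ ≤ L
    fits     : suc d * (G₀ * (2 * a)) + k′ ≤ k
    rσ≤G₀    : r * σ ≤ G₀
    rᵢσᵢ≤G₀  : rᵢ * σᵢ ≤ G₀
    small    : a * (G₀ + G₀) + 2 * (C * L) ≤ a * J
    sep      : L * ((3 + 2 * T) * ω) + 4 * (k′ * (h * ς)) < L * σ
    sepᵢ     : suc d * (J₀ * (L * ((3 + 2 * T) * ω))) + 4 * (k′ * (h * (ς * ς))) < J₀ * L * σᵢ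

module Packing {d : ℕ} (𝓕 : Frame (suc d)) {J₀ ς h : ℕ} (Bd : PackingBounds 𝓕 J₀ ς h) {R : List ℕ} {m : ℕ}
  (S : Slab (Frame.ξ 𝓕) R J₀ ς h m) (R⊆B : ∀ {b} → b ∈ R → b ∈ Frame.B 𝓕) where

  open Frame 𝓕
  open PackingBounds Bd
  open Slab S

  private
    Cell : Set
    Cell = Vec ℕ d × ℕ

    cells : List Cell
    cells = cartesianProduct (vecs d r) (upTo rᵢ)

    gridℕ : Cell → Fin (suc d) → ℕ
    gridℕ (v , t) = insertAt (λ l → lookup v l * σ) i (t * σᵢ)

    grid : Cell → Vector (suc d)
    grid c l = + gridℕ c l

    at-i : ∀ c → gridℕ c i ≡ proj₂ c * σᵢ
    at-i (v , t) = insertAt-lookup (λ l → lookup v l * σ) i (t * σᵢ)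

    at-punchIn : ∀ c l → gridℕ c (punchIn i l) ≡ lookup (proj₁ c) l * σ
    at-punchIn (v , t) l = insertAt-punchIn (λ l → lookup v l * σ) i (t * σᵢ) l

    grid≤ : ∀ {c} → c ∈ cells → ∀ l → gridℕ c l ≤ G₀
    grid≤ {c} c∈ l with i Data.Fin.≟ l
    ... | yes refl = ≤-trans (≤-reflexive (at-i c)) (≤-trans (*-monoˡ-≤ σᵢ (<⇒≤ (∈-upTo⁻ (proj₂ (∈-cartesianProduct⁻ (vecs d r) (upTo rᵢ) c∈))))) rᵢσᵢ≤G₀)
    ... | no i≢l = subst (λ l → gridℕ c l ≤ G₀) (punchIn-punchOut i≢l) (≤-trans (≤-reflexive (at-punchIn c (punchOut i≢l)))
      (≤-trans (*-monoˡ-≤ σ (<⇒≤ (lookup-vecs d r (proj₁ (∈-cartesianProduct⁻ (vecs d r) (upTo rᵢ) c∈)) (punchOut i≢l)))) rσ≤G₀))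

    B′⊆B : ∀ {b} → b ∈ B′ → b ∈ B
    B′⊆B = R⊆B ∘ B′⊆R

    record Sum (e : ℤ) : Set where
      field
        xs    : List (ℕ × ℕ)
        pairs : PairsIn B′ xs
        len   : length xs ≡ k′
        sum≡  : total xs ≡ e
        c     : Vector (suc d)
        c≤    : ∀ l → a * ∣ c l ∣ ≤ C * L
        coord : e ℤ.- dot c u ∈ E B κ

      len≤L : length xs ≤ L
      len≤L = ≤-trans (≤-reflexive len) k′≤L

      pairsB : PairsIn B xs
      pairsB = All.map (λ (p , q) → B′⊆B p , B′⊆B q) pairs

      err : Vector (suc d)
      err l = + L ℤ.* c l ℤ.- ξsum ξ xs l

      err≤ : ∀ l → ∣ err l ∣ ≤ L * (suc T * ω)
      err≤ = additive 𝓕 xs pairsB len≤L c c≤ (subst (λ z → z ℤ.- dot c u ∈ E B κ) (sym sum≡) coord)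

      S≤ : ∀ l → ∣ ξsum ξ xs (punchIn i l) ∣ ≤ k′ * (2 * (h * ς))
      S≤ l = subst (λ n → ∣ ξsum ξ xs (punchIn i l) ∣ ≤ n * (2 * (h * ς))) len (∣ξsum∣≤ ξ (punchIn i l) (2 * (h * ς)) xs bound)
        where
        bound : ∀ {x} → x ∈ xs → ∣ gap ξ x (punchIn i l) ∣ ≤ 2 * (h * ς)
        bound {b , b′} x∈ with All.lookup pairs x∈
        ... | b∈ , b′∈ = subst₂ _≤_ (cong ∣_∣ (e₁ (ξ b (punchIn i l)) (ξ b′ (punchIn i l)) (ξ o (punchIn i l)))) (e₂ (h * ς))
          (∣i-j∣≤ (gap ξ (b , o) (punchIn i l)) (gap ξ (b′ , o) (punchIn i l)) (near b∈ l) (near b′∈ l))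
          where
          e₁ : ∀ x y z → (x ℤ.- z) ℤ.- (y ℤ.- z) ≡ x ℤ.- y
          e₁ = ℤ-ring
          e₂ : ∀ n → n + n ≡ 2 * n
          e₂ = ℕ-ring

      fS≤ : ∣ dot f (ξsum ξ xs) ∣ ≤ k′ * (2 * (h * (ς * ς)))
      fS≤ = subst (λ n → ∣ dot f (ξsum ξ xs) ∣ ≤ n * (2 * (h * (ς * ς)))) len (∣dot-ξsum∣≤ ξ f (2 * (h * (ς * ς))) xs bound)
        where
        dot-gap : ∀ b b′ → dot f (gap ξ (b , b′)) ≡ dot (ξ b) f ℤ.- dot (ξ b′) f
        dot-gap b b′ = trans (dot-comm f (gap ξ (b , b′))) (dot-- (ξ b) (ξ b′) f)
        bound : ∀ {x} → x ∈ xs → ∣ dot f (gap ξ x) ∣ ≤ 2 * (h * (ς * ς))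
        bound {b , b′} x∈ with All.lookup pairs x∈
        ... | b∈ , b′∈ = subst₂ _≤_ (cong ∣_∣ (trans (cong₂ ℤ._-_ (dot-gap b o) (dot-gap b′ o))
            (trans (e₁ (dot (ξ b) f) (dot (ξ b′) f) (dot (ξ o) f)) (sym (dot-gap b b′))))) (e₂ (h * (ς * ς)))
          (∣i-j∣≤ (dot f (gap ξ (b , o))) (dot f (gap ξ (b′ , o))) (height b∈) (height b′∈))
          where
          e₁ : ∀ x y z → (x ℤ.- z) ℤ.- (y ℤ.- z) ≡ x ℤ.- y
          e₁ = ℤ-ring
          e₂ : ∀ n → n + n ≡ 2 * n
          e₂ = ℕ-ring

    sum-of : ∀ {e} → e ∈ E B′ k′ → Sum e
    sum-of {e} e∈ = record { xs = proj₁ t ; pairs = proj₁ (proj₂ t) ; len = proj₁ (proj₂ (proj₂ t)) ; sum≡ = proj₂ (proj₂ (proj₂ t))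
                       ; c = proj₁ s ; c≤ = proj₁ (proj₂ s) ; coord = proj₂ (proj₂ s) }
      where
      t : ∃[ xs ] PairsIn B′ xs × length xs ≡ k′ × total xs ≡ e
      t = E⇒total k′ e∈
      s : ∃[ c ] (∀ l → a * ∣ c l ∣ ≤ C * L) × e ℤ.- dot c u ∈ E B κ
      s = span L (E-mono b₀∈ k′≤L (E-⊆ B′⊆B k′ e∈))

    module _ {c₁ c₂ : Cell} (c₁∈ : c₁ ∈ cells) (c₂∈ : c₂ ∈ cells) {e₁ e₂ : ℤ} (s₁ : Sum e₁) (s₂ : Sum e₂)
      (eq : dot (grid c₁) u ℤ.+ e₁ ≡ dot (grid c₂) u ℤ.+ e₂) where

      private
        module S₁ = Sum s₁
        module S₂ = Sum s₂
        X : ℕ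
        X = L * ((3 + 2 * T) * ω)
        δ q rest : Vector (suc d)
        δ l = grid c₁ l ℤ.- grid c₂ l
        q l = δ l ℤ.+ (S₁.c l ℤ.- S₂.c l)
        rest l = (+ L ℤ.* q l ℤ.- S₁.err l) ℤ.+ S₂.err l

      q≤ω : ∀ l → ∣ q l ∣ ≤ ω
      q≤ω = independent q q≤J q·u∈
        where
        q≤J : ∀ l → ∣ q l ∣ ≤ J
        q≤J l = *-cancelˡ-≤ a (≤-trans (*-monoʳ-≤ a (∣i+j∣≤ (δ l) (S₁.c l ℤ.- S₂.c l)
            (∣i-j∣≤ (grid c₁ l) (grid c₂ l) (grid≤ c₁∈ l) (grid≤ c₂∈ l)) (∣i-j∣≤ (S₁.c l) (S₂.c l) ≤-refl ≤-refl)))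
          (≤-trans (≤-reflexive (l₁ a (G₀ + G₀) (∣ S₁.c l ∣) (∣ S₂.c l ∣)))
          (≤-trans (+-monoʳ-≤ (a * (G₀ + G₀)) (≤-trans (+-mono-≤ (S₁.c≤ l) (S₂.c≤ l)) (≤-reflexive (l₂ (C * L))))) small)))
          where
          l₁ : ∀ a g x y → a * (g + (x + y)) ≡ a * g + (a * x + a * y)
          l₁ = ℕ-ring
          l₂ : ∀ x → x + x ≡ 2 * x
          l₂ = ℕ-ring
        q·u∈ : dot q u ∈ E B (8 * κ)
        q·u∈ = E-mono b₀∈ (≤-trans (m≤m+n (κ + κ) (6 * κ)) (≤-reflexive (l₂ κ))) (subst (_∈ E B (κ + κ))
          (trans (l₁ (dot (grid c₁) u) (dot (grid c₂) u) e₁ e₂ (dot S₁.c u) (dot S₂.c u) eq)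
            (sym (trans (dot-+ δ (λ l → S₁.c l ℤ.- S₂.c l) u) (cong₂ ℤ._+_ (dot-- (grid c₁) (grid c₂) u) (dot-- S₁.c S₂.c u)))))
          (E-sub κ S₂.coord S₁.coord))
          where
          l₂ : ∀ κ → κ + κ + 6 * κ ≡ 8 * κ
          l₂ = ℕ-ring
          l₃ : ∀ g₁ g₂ e₁ e₂ x y → (e₂ ℤ.- y) ℤ.- (e₁ ℤ.- x) ≡ ((g₂ ℤ.+ e₂) ℤ.- g₂ ℤ.- e₁) ℤ.+ (x ℤ.- y)
          l₃ = ℤ-ring
          l₄ : ∀ g₁ g₂ e₁ → (g₁ ℤ.+ e₁) ℤ.- g₂ ℤ.- e₁ ≡ g₁ ℤ.- g₂
          l₄ = ℤ-ring
          l₁ : ∀ g₁ g₂ e₁ e₂ x y → g₁ ℤ.+ e₁ ≡ g₂ ℤ.+ e₂ → (e₂ ℤ.- y) ℤ.- (e₁ ℤ.- x) ≡ (g₁ ℤ.- g₂) ℤ.+ (x ℤ.- y)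
          l₁ g₁ g₂ e₁ e₂ x y eq = trans (l₃ g₁ g₂ e₁ e₂ x y)
            (cong (ℤ._+ (x ℤ.- y)) (trans (cong (λ z → z ℤ.- g₂ ℤ.- e₁) (sym eq)) (l₄ g₁ g₂ e₁)))

      rest≤ : ∀ l → ∣ rest l ∣ ≤ X
      rest≤ l = ≤-trans (∣i+j∣≤ (+ L ℤ.* q l ℤ.- S₁.err l) (S₂.err l) (∣i-j∣≤ (+ L ℤ.* q l) (S₁.err l)
          (≤-trans (≤-reflexive (ℤₚ.abs-* (+ L) (q l))) (*-monoʳ-≤ L (q≤ω l))) (S₁.err≤ l)) (S₂.err≤ l))
        (≤-reflexive (l₁ L T ω))
        where
        l₁ : ∀ L T ω → L * ω + L * ((1 + T) * ω) + L * ((1 + T) * ω) ≡ L * ((3 + 2 * T) * ω)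
        l₁ = ℕ-ring

      Lδ≡ : ∀ l → + L ℤ.* δ l ≡ (rest l ℤ.- ξsum ξ S₁.xs l) ℤ.+ ξsum ξ S₂.xs l
      Lδ≡ l = l₁ (+ L) (δ l) (S₁.c l) (S₂.c l) (ξsum ξ S₁.xs l) (ξsum ξ S₂.xs l)
        where
        l₁ : ∀ L δ x y s t → L ℤ.* δ ≡
          ((L ℤ.* (δ ℤ.+ (x ℤ.- y)) ℤ.- (L ℤ.* x ℤ.- s)) ℤ.+ (L ℤ.* y ℤ.- t) ℤ.- s) ℤ.+ t
        l₁ = ℤ-ring

      same-lookup : ∀ l → lookup (proj₁ c₁) l ≡ lookup (proj₁ c₂) l
      same-lookup l = grid-separated L σ _ _ (≤-trans (≤-reflexive (cong (λ z → ∣ + L ℤ.* z ∣)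
          (sym (cong₂ (λ x y → + x ℤ.- + y) (at-punchIn c₁ l) (at-punchIn c₂ l))))) bound) sep
        where
        l₂ : ∀ x k n → x + k * (2 * n) + k * (2 * n) ≡ x + 4 * (k * n)
        l₂ = ℕ-ring
        bound : ∣ + L ℤ.* δ (punchIn i l) ∣ ≤ X + 4 * (k′ * (h * ς))
        bound = ≤-trans (≤-reflexive (cong ∣_∣ (Lδ≡ (punchIn i l))))
          (≤-trans (∣i+j∣≤ (rest (punchIn i l) ℤ.- ξsum ξ S₁.xs (punchIn i l)) (ξsum ξ S₂.xs (punchIn i l))
            (∣i-j∣≤ (rest (punchIn i l)) (ξsum ξ S₁.xs (punchIn i l)) (rest≤ (punchIn i l)) (S₁.S≤ l)) (S₂.S≤ l)) (≤-reflexive (l₂ X k′ (h * ς))))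

      δ-elsewhere : ∀ l → δ (punchIn i l) ≡ 0ℤ
      δ-elsewhere l = trans (cong₂ (λ x y → + x ℤ.- + y) (at-punchIn c₁ l) (trans (at-punchIn c₂ l) (cong (_* σ) (sym (same-lookup l)))))
        (ℤₚ.+-inverseʳ (+ (lookup (proj₁ c₁) l * σ)))

      dot-fδ : dot f δ ≡ f i ℤ.* δ i
      dot-fδ = trans (dot-punchIn i f δ) (trans (cong (λ z → f i ℤ.* δ i ℤ.+ z)
        (trans (dot-cong {f = f ∘ punchIn i} (λ _ → refl) δ-elsewhere) (trans (dot-comm (f ∘ punchIn i) (λ _ → 0ℤ)) (dot-0 (f ∘ punchIn i))))) (ℤₚ.+-identityʳ _))

      LfδI : + L ℤ.* dot f δ ≡ (dot f rest ℤ.- dot f (ξsum ξ S₁.xs)) ℤ.+ dot f (ξsum ξ S₂.xs)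
      LfδI = begin
        + L ℤ.* dot f δ                                               ≡⟨ cong (λ z → + L ℤ.* z) (dot-comm f δ) ⟩
        + L ℤ.* dot δ f                                               ≡⟨ dot-* (+ L) δ f ⟨
        dot (λ l → + L ℤ.* δ l) f                                     ≡⟨ dot-cong {g = f} Lδ≡ (λ _ → refl) ⟩
        dot (λ l → (rest l ℤ.- Ξ₁ l) ℤ.+ Ξ₂ l) f                      ≡⟨ dot-+ (λ l → rest l ℤ.- Ξ₁ l) Ξ₂ f ⟩
        dot (λ l → rest l ℤ.- Ξ₁ l) f ℤ.+ dot Ξ₂ f                    ≡⟨ cong (ℤ._+ dot Ξ₂ f) (dot-- rest Ξ₁ f) ⟩
        (dot rest f ℤ.- dot Ξ₁ f) ℤ.+ dot Ξ₂ f                        ≡⟨ cong₂ ℤ._+_ (cong₂ ℤ._-_ (dot-comm rest f) (dot-comm Ξ₁ f)) (dot-comm Ξ₂ f) ⟩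
        (dot f rest ℤ.- dot f Ξ₁) ℤ.+ dot f Ξ₂                        ∎
        where
        open ≡-Reasoning
        Ξ₁ Ξ₂ : Vector (suc d)
        Ξ₁ = ξsum ξ S₁.xs
        Ξ₂ = ξsum ξ S₂.xs

      same-i : proj₂ c₁ ≡ proj₂ c₂
      same-i = grid-separated (J₀ * L) σᵢ _ _ (≤-trans (≤-reflexive (trans (cong (λ z → ∣ + (J₀ * L) ℤ.* z ∣)
          (sym (cong₂ (λ x y → + x ℤ.- + y) (at-i c₁) (at-i c₂)))) abs≡)) bound) sepᵢ
        where
        l₁ : ∀ j m x → j * m * x ≡ m * (j * x)
        l₁ = ℕ-ring
        l₂ : ∀ x k n → x + k * (2 * n) + k * (2 * n) ≡ x + 4 * (k * n)
        l₂ = ℕ-ring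
        abs≡ : ∣ + (J₀ * L) ℤ.* δ i ∣ ≡ ∣ + L ℤ.* dot f δ ∣
        abs≡ = begin
          ∣ + (J₀ * L) ℤ.* δ i ∣        ≡⟨ ℤₚ.abs-* (+ (J₀ * L)) (δ i) ⟩
          J₀ * L * ∣ δ i ∣              ≡⟨ l₁ J₀ L (∣ δ i ∣) ⟩
          L * (J₀ * ∣ δ i ∣)            ≡⟨ cong (λ j → L * (j * ∣ δ i ∣)) fi≡ ⟨
          L * (∣ f i ∣ * ∣ δ i ∣)       ≡⟨ cong (L *_) (ℤₚ.abs-* (f i) (δ i)) ⟨
          L * ∣ f i ℤ.* δ i ∣           ≡⟨ cong (λ z → L * ∣ z ∣) dot-fδ ⟨
          L * ∣ dot f δ ∣               ≡⟨ ℤₚ.abs-* (+ L) (dot f δ) ⟨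
          ∣ + L ℤ.* dot f δ ∣           ∎
          where open ≡-Reasoning
        bound : ∣ + L ℤ.* dot f δ ∣ ≤ suc d * (J₀ * X) + 4 * (k′ * (h * (ς * ς)))
        bound = ≤-trans (≤-reflexive (cong ∣_∣ LfδI))
          (≤-trans (∣i+j∣≤ (dot f rest ℤ.- dot f (ξsum ξ S₁.xs)) (dot f (ξsum ξ S₂.xs))
            (∣i-j∣≤ (dot f rest) (dot f (ξsum ξ S₁.xs)) (dot-∣∣≤ {f = f} {g = rest} J₀ X f≤ rest≤) S₁.fS≤) S₂.fS≤) (≤-reflexive (l₂ (suc d * (J₀ * X)) k′ (h * (ς * ς)))))

      same-cell-index : c₁ ≡ c₂
      same-cell-index = cong₂ _,_ (lookup-ext (proj₁ c₁) (proj₁ c₂) same-lookup) same-i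

      same-element : e₁ ≡ e₂
      same-element = ℤ-cancelˡ (dot (grid c₁) u) (trans eq (cong (λ c → dot (grid c) u ℤ.+ e₂) (sym same-cell-index)))

  -- If two translates meet, the difference δ of the grid points, corrected by the coordinates of
  -- the two slab sums, is a relation and hence at most ω. So L δ is nearly a difference of two
  -- ξ-sums over the slab. These are small in the coordinates other than i, and the spacing σ forces
  -- δ to vanish there. Then f · δ = f i δ i, and the thinness of the slab along f makes the spacing
  -- σᵢ sufficient.
  packing : r ^ d * rᵢ * length (E B′ k′) ≤ length (E B k)
  packing = subst (λ n → n * length (E B′ k′) ≤ length (E B k))
    (trans (length-cartesianProductWith _,_ (vecs d r) (upTo rᵢ)) (cong₂ _*_ (length-vecs d r) (length-upTo rᵢ)))
    (length-packing (λ c e → dot (grid c) u ℤ.+ e) (Unique.cartesianProduct⁺ (vecs-unique d r) (Unique.upTo⁺ rᵢ)) (E-unique k′)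
      (λ {c} {e} c∈ e∈ → E-mono b₀∈ fits (E-+ (suc d * (G₀ * (2 * a))) (dot-E (grid c) u (grid≤ c∈) u∈ b₀∈) (E-⊆ B′⊆B k′ e∈)))
      (λ c∈ c′∈ e∈ e′∈ eq → same-cell-index c∈ c′∈ (sum-of e∈) (sum-of e′∈) eq , same-element c∈ c′∈ (sum-of e∈) (sum-of e′∈) eq))

-- Non-averaging sets and regular subsets

infix 4 _∈ᴺ?_
_∈ᴺ?_ : ∀ (x : ℕ) xs → Dec (x ∈ xs)
x ∈ᴺ? xs = any? (x ≟_) xs

Unique-same-↭ : ∀ {xs ys : List ℕ} → Unique xs → Unique ys → (∀ {x} → x ∈ xs → x ∈ ys) → (∀ {x} → x ∈ ys → x ∈ xs) → xs ↭ ys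
Unique-same-↭ {[]}     {[]}     _ _ _ _ = ↭-refl
Unique-same-↭ {[]}     {y ∷ ys} _ _ _ g = case g (here refl) of λ ()
Unique-same-↭ {x ∷ xs} {ys} (x∉ ∷ u) v f g with ∈⇒↭ (f (here refl))
... | zs , p = ↭-trans (prep x (Unique-same-↭ u (tail-unique v′) into back)) (↭-sym p)
  where
  v′ : Unique (x ∷ zs)
  v′ = Unique-↭ p v
  tail-unique : ∀ {z : ℕ} {zs} → Unique (z ∷ zs) → Unique zs
  tail-unique (_ ∷ u) = u
  into : ∀ {y} → y ∈ xs → y ∈ zs
  into y∈ with ∈-resp-↭ p (f (there y∈))
  ... | here refl = contradiction refl (All.lookup x∉ y∈)
  ... | there y∈zs = y∈zs
  back : ∀ {y} → y ∈ zs → y ∈ xs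
  back y∈ with g (∈-resp-↭ (↭-sym p) (there y∈))
  ... | here refl = contradiction y∈ (Unique.Unique[x∷xs]⇒x∉xs v′)
  ... | there y∈xs = y∈xs

-- `NonAveraging` speaks of sublists; the members of S in the order of A form one, with the same
-- length and sum.
no-average : ∀ {A S a} → NonAveraging A → Unique A → Unique S → (∀ {x} → x ∈ S → x ∈ A) → a ∈ A → a ∉ S →
  1 ≤ length S → length S * a ≡ sum S → ⊥
no-average {A} {S} {a} nonavg uA uS S⊆A a∈ a∉ 1≤S avg = nonavg (a , S₀ , a∈ , filter-⊆ (_∈ᴺ? S) A ,
    (λ a∈S₀ → a∉ (∈-resp-↭ p a∈S₀)) , (λ S₀≡[] → contradiction (trans (sym (↭-length p)) (cong length S₀≡[])) (>⇒≢ 1≤S)) ,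
    trans (cong (_* a) (↭-length p)) (trans avg (sym (sum-↭ p))))
  where
  S₀ : List ℕ
  S₀ = filter (_∈ᴺ? S) A
  p : S₀ ↭ S
  p = Unique-same-↭ (Unique.filter⁺ (_∈ᴺ? S) uA) uS (λ x∈ → proj₂ (∈-filter⁻ (_∈ᴺ? S) {xs = A} x∈)) (λ x∈ → ∈-filter⁺ (_∈ᴺ? S) (S⊆A x∈) x∈)

total-steps : ∀ o T → total (map (_, o) T) ≡ + sum T ℤ.- + (length T * o)
total-steps o []      = refl
total-steps o (x ∷ T) = trans (cong (λ z → (+ x ℤ.- + o) ℤ.+ z) (total-steps o T))
  (trans (e (+ x) (+ o) (+ sum T) (+ (length T * o))) (cong₂ ℤ._-_ (sym (ℤₚ.pos-+ x (sum T))) (sym (ℤₚ.pos-+ o (length T * o)))))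
  where
  e : ∀ x o s l → (x ℤ.- o) ℤ.+ (s ℤ.- l) ≡ (x ℤ.+ s) ℤ.- (o ℤ.+ l)
  e = ℤ-ring

record Core (A B : List ℕ) : Set where
  field
    {R}       : List ℕ
    {P}       : List (ℕ × ℕ)
    {t}       : ℤ
    n₀        : ℕ
    nonavg    : NonAveraging A
    A-uniq    : Unique A
    B-uniq    : Unique B
    B⊆A       : ∀ {b} → b ∈ B → b ∈ A
    B↭        : B ↭ flat P ++ R
    1≤P       : 1 ≤ length P
    t∈        : t ∈ V P
    absorbs   : ∀ {y} → y ∈ E B n₀ → t ℤ.+ y ∈ V P

  R⊆B : ∀ {b} → b ∈ R → b ∈ B
  R⊆B b∈ = ∈-resp-↭ (↭-sym B↭) (∈-++⁺ʳ (flat P) b∈)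

  R-uniq : Unique R
  R-uniq = Unique-++ʳ (flat P) (Unique-↭ B↭ B-uniq)

  flat-uniq : Unique (flat P)
  flat-uniq = Unique-++ˡ (flat P) (Unique-↭ B↭ B-uniq)

  disjoint : ∀ {x} → x ∈ flat P → x ∈ R → ⊥
  disjoint = Unique-disjoint (flat P) (Unique-↭ B↭ B-uniq)

  private
    choice : ∃[ T ] Unique T × (∀ {x} → x ∈ T → x ∈ flat P) × length T ≡ length P × + sum T ≡ t
    choice = V-choice P flat-uniq t∈

  -- The choice with sum t is the reference from which all corrections are measured.
  T : List ℕ
  T = proj₁ choice

  T-length : length T ≡ length P
  T-length = proj₁ (proj₂ (proj₂ (proj₂ choice)))

  T⊆B : ∀ {x} → x ∈ T → x ∈ B
  T⊆B x∈ = ∈-resp-↭ (↭-sym B↭) (∈-++⁺ˡ (proj₁ (proj₂ (proj₂ choice)) x∈))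

  -- If the surplus of T ∪ Y over the mean o is absorbed, replacing T by another choice T′ makes o the exact mean of T′ ∪ Y.
  balanced : ∀ {o Y Rest} → o ∈ R → R ↭ Y ++ Rest → o ∉ Y → total (map (_, o) T) ℤ.+ total (map (_, o) Y) ∈ E B n₀ → ⊥
  balanced {o} {Y} {Rest} o∈ R↭ o∉ v∈ = no-average nonavg A-uniq uniq within (B⊆A (R⊆B o∈)) o∉S
      (≤-trans 1≤P (≤-trans (≤-reflexive (sym len′)) (≤-trans (m≤m+n (length T′) (length Y)) (≤-reflexive (sym (length-++ T′))))))
      (ℤₚ.+-injective mean)
    where
    v : ℤ
    v = total (map (_, o) T) ℤ.+ total (map (_, o) Y)
    choice′ : ∃[ T′ ] Unique T′ × (∀ {x} → x ∈ T′ → x ∈ flat P) × length T′ ≡ length P × + sum T′ ≡ t ℤ.+ ℤ.- v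
    choice′ = V-choice P flat-uniq (absorbs (E-neg n₀ v∈))
    T′ : List ℕ
    T′ = proj₁ choice′
    T′⊆ : ∀ {x} → x ∈ T′ → x ∈ flat P
    T′⊆ = proj₁ (proj₂ (proj₂ choice′))
    len′ : length T′ ≡ length P
    len′ = proj₁ (proj₂ (proj₂ (proj₂ choice′)))
    Y⊆R : ∀ {x} → x ∈ Y → x ∈ R
    Y⊆R x∈ = ∈-resp-↭ (↭-sym R↭) (∈-++⁺ˡ x∈)
    uniq : Unique (T′ ++ Y)
    uniq = Unique.++⁺ (proj₁ (proj₂ choice′)) (Unique-++ˡ Y (Unique-↭ R↭ R-uniq)) (λ (x∈T′ , x∈Y) → disjoint (T′⊆ x∈T′) (Y⊆R x∈Y))
    within : ∀ {x} → x ∈ T′ ++ Y → x ∈ A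
    within x∈ with ∈-++⁻ T′ x∈
    ... | inj₁ h = B⊆A (∈-resp-↭ (↭-sym B↭) (∈-++⁺ˡ (T′⊆ h)))
    ... | inj₂ h = B⊆A (R⊆B (Y⊆R h))
    o∉S : o ∉ T′ ++ Y
    o∉S x∈ with ∈-++⁻ T′ x∈
    ... | inj₁ h = disjoint (T′⊆ h) o∈
    ... | inj₂ h = o∉ h
    mean : + (length (T′ ++ Y) * o) ≡ + sum (T′ ++ Y)
    mean = begin
      + (length (T′ ++ Y) * o)                        ≡⟨ cong +_ (trans (cong (_* o) (length-++ T′)) (*-distribʳ-+ o (length T′) (length Y))) ⟩
      + (length T′ * o + length Y * o)                ≡⟨ ℤₚ.pos-+ (length T′ * o) (length Y * o) ⟩
      + (length T′ * o) ℤ.+ + (length Y * o)          ≡⟨ cong (λ n → + (n * o) ℤ.+ + (length Y * o)) (trans len′ (sym T-length)) ⟩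
      + (length T * o) ℤ.+ + (length Y * o)           ≡⟨ e (+ sum T) (+ (length T * o)) (+ sum Y) (+ (length Y * o)) ⟩
      (+ sum T ℤ.+ ℤ.- ((+ sum T ℤ.- + (length T * o)) ℤ.+ (+ sum Y ℤ.- + (length Y * o)))) ℤ.+ + sum Y
        ≡⟨ cong₂ (λ x y → (x ℤ.+ ℤ.- y) ℤ.+ + sum Y) (proj₂ (proj₂ (proj₂ (proj₂ choice)))) (cong₂ ℤ._+_ (sym (total-steps o T)) (sym (total-steps o Y))) ⟩
      (t ℤ.+ ℤ.- v) ℤ.+ + sum Y                       ≡⟨ cong (ℤ._+ + sum Y) (sym (proj₂ (proj₂ (proj₂ (proj₂ choice′))))) ⟩
      + sum T′ ℤ.+ + sum Y                            ≡⟨ trans (cong +_ (sum-++ T′ Y)) (ℤₚ.pos-+ (sum T′) (sum Y)) ⟨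
      + sum (T′ ++ Y)                                 ∎
      where
      open ≡-Reasoning
      e : ∀ s l s′ l′ → l ℤ.+ l′ ≡ (s ℤ.+ ℤ.- ((s ℤ.- l) ℤ.+ (s′ ℤ.- l′))) ℤ.+ s′
      e = ℤ-ring

-- y + E B′ m and E B′ m both lie in E B k, which is too small to contain them disjointly. A common
-- element writes y as a difference of two elements of E B′ m.
meet : ∀ {B B′ n m k} → (∀ {b} → b ∈ B′ → b ∈ B) → n + m ≡ k → ∀ {b} → b ∈ B → length (E B k) < 2 * length (E B′ m) →
  ∀ {y} → y ∈ E B n → y ∈ E B′ (m + m)
meet {B} {B′} {n} {m} {k} sub refl b∈ big {y} y∈ with any? (λ e → (y ℤ.+ e) ∈? E B′ m) (E B′ m)
... | yes p = case find p of λ (e , e∈ , ye∈) → subst (_∈ E B′ (m + m)) (l y e) (E-sub m ye∈ e∈)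
  where
  l : ∀ y e → y ℤ.+ e ℤ.- e ≡ y
  l = ℤ-ring
... | no ¬p = contradiction big (≤⇒≯ (subst (_≤ length (E B (n + m)))
    (trans (length-++ (map (λ e → y ℤ.+ e) (E B′ m))) (trans (cong (_+ length (E B′ m)) (length-map _ (E B′ m))) (e (length (E B′ m)))))
    (length-⊆ (Unique.++⁺ (Unique.map⁺ (ℤ-cancelˡ y) (E-unique m)) (E-unique m) disj) into)))
  where
  e : ∀ x → x + x ≡ 2 * x
  e = ℕ-ring
  disj : ∀ {z} → z ∈ map (λ e → y ℤ.+ e) (E B′ m) × z ∈ E B′ m → ⊥
  disj (z∈ , z∈′) with ∈-map⁻ (λ e → y ℤ.+ e) z∈
  ... | e , e∈ , refl = ¬p (lose e∈ z∈′)
  into : ∀ {z} → z ∈ map (λ e → y ℤ.+ e) (E B′ m) ++ E B′ m → z ∈ E B (n + m)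
  into z∈ with ∈-++⁻ (map (λ e → y ℤ.+ e) (E B′ m)) z∈
  ... | inj₂ h = E-mono b∈ (m≤n+m m n) (E-⊆ sub m h)
  ... | inj₁ h with ∈-map⁻ (λ e → y ℤ.+ e) h
  ...   | e , e∈ , refl = E-+ n y∈ (E-⊆ sub m e∈)

-- m is at least 79 k / 80, and (80 / 79) ^ 10 is well below 4. This is the inequality k ^ 5 < 2 m ^
-- 5, squared.
k^10<4m^10 : ∀ n m k → n + m ≡ k → 80 * n ≤ k → 1 ≤ m → k ^ 10 < 4 * m ^ 10
k^10<4m^10 n m k refl 80n≤k 1≤m = *-cancelˡ-< (79 ^ 10) (k ^ 10) (4 * m ^ 10) (begin-strict
  79 ^ 10 * k ^ 10          ≡⟨ ^-distribʳ-* 79 k 10 ⟨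
  (79 * k) ^ 10             ≤⟨ ^-monoˡ-≤ 10 79k≤80m ⟩
  (80 * m) ^ 10             ≡⟨ ^-distribʳ-* 80 m 10 ⟩
  80 ^ 10 * m ^ 10          <⟨ *-monoˡ-< (m ^ 10) {{m^n≢0 m 10 {{>-nonZero 1≤m}}}} (<ᵇ⇒< (80 ^ 10) (79 ^ 10 * 4) _) ⟩
  79 ^ 10 * 4 * m ^ 10      ≡⟨ *-assoc (79 ^ 10) 4 (m ^ 10) ⟩
  79 ^ 10 * (4 * m ^ 10)    ∎)
  where
  open ≤-Reasoning
  79k≤80m : 79 * (n + m) ≤ 80 * m
  79k≤80m = +-cancelˡ-≤ (80 * n) _ _ (begin
    80 * n + 79 * (n + m)    ≤⟨ +-monoˡ-≤ (79 * (n + m)) 80n≤k ⟩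
    n + m + 79 * (n + m)     ≡⟨ e n m ⟩
    80 * n + 80 * m          ∎)
    where
    e : ∀ n m → n + m + 79 * (n + m) ≡ 80 * n + 80 * m
    e = ℕ-ring

-- With p′ = 10 p − 1 this says |E′| ≥ |E| (m / k) ^ (5 − 1 / 2p) > |E| / 2.
more-than-half : ∀ p p′ n m k e e′ → suc p′ ≡ 10 * p → 1 ≤ p → n + m ≡ k → 80 * n ≤ k → 1 ≤ m → 1 ≤ e′ →
  e ^ (2 * p) * m ^ p′ ≤ e′ ^ (2 * p) * k ^ p′ → e < 2 * e′
more-than-half p p′ n m k e e′ p′≡ 1≤p n+m≡k 80n≤k 1≤m 1≤e′ reg with e <? 2 * e′
... | yes lt = lt
... | no ¬lt = contradiction (begin-strict
  (4 * m ^ 10) ^ p              ≡⟨ trans (^-distribʳ-* 4 (m ^ 10) p) (cong (4 ^ p *_) (trans (^-*-assoc m 10 p) (cong (m ^_) (sym p′≡)))) ⟩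
  4 ^ p * (m * m ^ p′)          ≤⟨ *-monoʳ-≤ (4 ^ p) (*-monoˡ-≤ (m ^ p′) m≤k) ⟩
  4 ^ p * (k * m ^ p′)          ≡⟨ l (4 ^ p) k (m ^ p′) ⟩
  k * (4 ^ p * m ^ p′)          ≤⟨ *-monoʳ-≤ k cancelled ⟩
  k * k ^ p′                    ≡⟨ trans (cong (k ^_) p′≡) (sym (^-*-assoc k 10 p)) ⟩
  (k ^ 10) ^ p                  <⟨ ^-monoˡ-< p {{>-nonZero 1≤p}} (k^10<4m^10 n m k n+m≡k 80n≤k 1≤m) ⟩
  (4 * m ^ 10) ^ p              ∎) (<-irrefl refl)
  where
  open ≤-Reasoning
  l : ∀ a k m → a * (k * m) ≡ k * (a * m)
  l = ℕ-ring
  m≤k : m ≤ k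
  m≤k = ≤-trans (m≤n+m m n) (≤-reflexive n+m≡k)
  cancelled : 4 ^ p * m ^ p′ ≤ k ^ p′
  cancelled = *-cancelˡ-≤ (e′ ^ (2 * p)) {{m^n≢0 e′ (2 * p) {{>-nonZero 1≤e′}}}} (begin
    e′ ^ (2 * p) * (4 ^ p * m ^ p′)    ≡⟨ l₂ (e′ ^ (2 * p)) (4 ^ p) (m ^ p′) ⟩
    4 ^ p * e′ ^ (2 * p) * m ^ p′      ≡⟨ cong (λ z → z * e′ ^ (2 * p) * m ^ p′) (^-*-assoc 2 2 p) ⟩
    2 ^ (2 * p) * e′ ^ (2 * p) * m ^ p′ ≡⟨ cong (_* m ^ p′) (^-distribʳ-* 2 e′ (2 * p)) ⟨
    (2 * e′) ^ (2 * p) * m ^ p′        ≤⟨ *-monoˡ-≤ (m ^ p′) (^-monoˡ-≤ (2 * p) (≮⇒≥ ¬lt)) ⟩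
    e ^ (2 * p) * m ^ p′               ≤⟨ reg ⟩
    e′ ^ (2 * p) * k ^ p′              ∎)
    where
    l₂ : ∀ x y z → x * (y * z) ≡ y * x * z
    l₂ = ℕ-ring

-- B minimises |E B k| / k ^ (5 − 1 / 2p) among the subsets of size k s; here p′ = 10 p − 1.
record Regular (p p′ s k : ℕ) (B : List ℕ) : Set where
  field
    uniq    : Unique B
    card    : length B ≡ k * s
    minimal : ∀ {r B′} → 1 ≤ r → r < k → Unique B′ → (∀ {b} → b ∈ B′ → b ∈ B) → length B′ ≡ r * s →
      length (E B k) ^ (2 * p) * r ^ p′ ≤ length (E B′ r) ^ (2 * p) * k ^ p′

-- Descent on k: a set B′ that violates minimality satisfies the same upper bound with r in place of
-- k, so the search continues there. The factor U survives the descent and later keeps k large.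
regular-exists : ∀ p p′ s U A k B → 1 ≤ k → Unique B → (∀ {b} → b ∈ B → b ∈ A) → length B ≡ k * s →
  length (E B k) ^ (2 * p) * U ≤ k ^ p′ →
  (∀ k B → 1 ≤ k → Regular p p′ s k B → (∀ {b} → b ∈ B → b ∈ A) → length (E B k) ^ (2 * p) * U ≤ k ^ p′ → ⊥) → ⊥
regular-exists p p′ s U A k₀ B₀ 1≤k₀ u₀ sub₀ card₀ bd₀ cont = <-rec Goal step k₀ B₀ 1≤k₀ u₀ sub₀ card₀ bd₀
  where
  Goal : ℕ → Set
  Goal k = ∀ B → 1 ≤ k → Unique B → (∀ {b} → b ∈ B → b ∈ A) → length B ≡ k * s → length (E B k) ^ (2 * p) * U ≤ k ^ p′ → ⊥
  step : ∀ k → (∀ {r} → r < k → Goal r) → Goal k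
  step k rec B 1≤k u sub card bd = cont k B 1≤k (record { uniq = u ; card = card ; minimal = minimal }) sub bd
    where
    minimal : ∀ {r B′} → 1 ≤ r → r < k → Unique B′ → (∀ {b} → b ∈ B′ → b ∈ B) → length B′ ≡ r * s →
      length (E B k) ^ (2 * p) * r ^ p′ ≤ length (E B′ r) ^ (2 * p) * k ^ p′
    minimal {r} {B′} 1≤r r<k u′ sub′ card′ with length (E B k) ^ (2 * p) * r ^ p′ ≤? length (E B′ r) ^ (2 * p) * k ^ p′
    ... | yes le = le
    ... | no ¬le = ⊥-elim (rec r<k B′ 1≤r u′ (sub ∘ sub′) card′ (*-cancelʳ-≤ (e′ * U) (r ^ p′) (k ^ p′) {{m^n≢0 k p′ {{>-nonZero 1≤k}}}} (begin
        e′ * U * k ^ p′      ≡⟨ l₁ e′ U (k ^ p′) ⟩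
        U * (e′ * k ^ p′)    ≤⟨ *-monoʳ-≤ U (<⇒≤ (≰⇒> ¬le)) ⟩
        U * (e * r ^ p′)     ≡⟨ l₂ U e (r ^ p′) ⟩
        r ^ p′ * (e * U)     ≤⟨ *-monoʳ-≤ (r ^ p′) bd ⟩
        r ^ p′ * k ^ p′      ∎)))
      where
      open ≤-Reasoning
      e e′ : ℕ
      e  = length (E B k) ^ (2 * p)
      e′ = length (E B′ r) ^ (2 * p)
      l₁ : ∀ e U k → e * U * k ≡ U * (e * k)
      l₁ = ℕ-ring
      l₂ : ∀ U e r → U * (e * r) ≡ r * (e * U)
      l₂ = ℕ-ring

record CoreBounds (p p′ s k h n n₀ : ℕ) : Set where
  field
    p′≡   : suc p′ ≡ 10 * p
    1≤p   : 1 ≤ p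
    1≤k   : 1 ≤ k
    1≤n₀  : 1 ≤ n₀
    80n₀≤k : 80 * n₀ ≤ k
    small : suc (suc n * n + suc n * n) < 2 ^ h
    room  : 2 * suc (h * (4 * (2 * k) * h)) ≤ n₀ * s

module _ {p p′ s k h n n₀ : ℕ} (Bd : CoreBounds p p′ s k h n n₀) {A B : List ℕ} (reg : Regular p p′ s k B)
  (nonavg : NonAveraging A) (A-uniq : Unique A) (B⊆A : ∀ {b} → b ∈ B → b ∈ A) (A≤n : ∀ {b} → b ∈ A → b ≤ n) where

  open CoreBounds Bd
  open Regular reg

  private
    m : ℕ
    m = k ∸ n₀
    n₀≤k : n₀ ≤ k
    n₀≤k = ≤-trans (m≤m+n n₀ (79 * n₀)) 80n₀≤k
    n₀+m≡k : n₀ + m ≡ k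
    n₀+m≡k = m+[n∸m]≡n n₀≤k
    n₀<k : n₀ < k
    n₀<k = ≤-trans (m<m+n n₀ (≤-trans 1≤n₀ (m≤m+n n₀ (78 * n₀)))) 80n₀≤k
    1≤m : 1 ≤ m
    1≤m = m<n⇒0<n∸m n₀<k
    m<k : m < k
    m<k = ≤-trans (m<n+m m 1≤n₀) (≤-reflexive n₀+m≡k)

    |B|≤ : length B ≤ suc n
    |B|≤ = subst (length B ≤_) (length-upTo (suc n)) (length-⊆ uniq (λ b∈ → ∈-upTo⁺ (s≤s (A≤n (B⊆A b∈)))))

    small-V : ∀ Q R → B ↭ flat Q ++ R → length (V Q) < 2 ^ h
    small-V Q R p = ≤-<-trans (length-interval (suc n * n) (V-unique Q) (λ v∈ → ≤-trans
        (V-bounded Q (λ x∈ → A≤n (B⊆A (∈-resp-↭ (↭-sym p) (∈-++⁺ˡ x∈)))) v∈) (*-monoˡ-≤ n |Q|≤))) small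
      where
      |Q|≤ : length Q ≤ suc n
      |Q|≤ = ≤-trans (≤-trans (m≤m+n (length Q) (length Q + 0)) (≤-reflexive (sym (length-flat Q))))
        (≤-trans (length-++-≤ˡ (flat Q)) (≤-trans (≤-reflexive (sym (↭-length p))) |B|≤))

  -- Absorption with q = 2 k gives t + E R (2 k) ⊆ V P. Since P is small, m s elements remain
  -- outside it, and minimality makes their m-fold differences more than half as many as E B k. By
  -- `meet`, E B n₀ then lies in E R (2 m), which is absorbed.
  core-exists : (∀ (c : Core A B) → Core.n₀ c ≡ n₀ → length (Core.P c) ≤ suc (h * (4 * (2 * k) * h)) → m * s ≤ length (Core.R c) → ⊥) → ⊥
  core-exists cont = start B refl 2≤B
    where
    2≤B : 2 ≤ length B
    2≤B = ≤-trans (*-monoʳ-≤ 2 (s≤s (z≤n {h * (4 * (2 * k) * h)}))) (≤-trans room (≤-trans (*-monoˡ-≤ s n₀≤k) (≤-reflexive (sym card))))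
    instance
      2k≢0 : NonZero (2 * k)
      2k≢0 = m*n≢0 2 k {{_}} {{>-nonZero 1≤k}}
    conclude : ∀ P R t → B ↭ flat P ++ R → 1 ≤ length P → length P ≤ suc (h * (4 * (2 * k) * h)) → Absorber (2 * k) P R t → ⊥
    conclude P R t B↭ 1≤P P≤ (t∈ , ab) = cont (record
        { n₀ = n₀ ; nonavg = nonavg ; A-uniq = A-uniq ; B-uniq = uniq ; B⊆A = B⊆A ; B↭ = B↭ ; 1≤P = 1≤P ; t∈ = t∈
        ; absorbs = λ y∈ → ab (E-mono r∈ 2m≤2k (E-⊆ R′⊆R (m + m) (meet {B′ = R′} R′⊆B n₀+m≡k (R⊆B r∈) half y∈))) }) refl P≤ ms≤R
      where
      R⊆B : ∀ {b} → b ∈ R → b ∈ B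
      R⊆B b∈ = ∈-resp-↭ (↭-sym B↭) (∈-++⁺ʳ (flat P) b∈)
      ms≤R : m * s ≤ length R
      ms≤R = +-cancelˡ-≤ (n₀ * s) (m * s) (length R) (begin
        n₀ * s + m * s                ≡⟨ trans (sym (*-distribʳ-+ s n₀ m)) (cong (_* s) n₀+m≡k) ⟩
        k * s                         ≡⟨ trans (sym card) (↭-length B↭) ⟩
        length (flat P ++ R)          ≡⟨ trans (length-++ (flat P)) (cong (_+ length R) (length-flat P)) ⟩
        2 * length P + length R       ≤⟨ +-monoˡ-≤ (length R) (≤-trans (*-monoʳ-≤ 2 P≤) room) ⟩
        n₀ * s + length R             ∎)
        where open ≤-Reasoning
      R′ : List ℕ
      R′ = take (m * s) R
      R′⊆R : ∀ {b} → b ∈ R′ → b ∈ R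
      R′⊆R {b} b∈ = subst (b ∈_) (take++drop≡id (m * s) R) (∈-++⁺ˡ b∈)
      R′⊆B : ∀ {b} → b ∈ R′ → b ∈ B
      R′⊆B = R⊆B ∘ R′⊆R
      R′-uniq : Unique R′
      R′-uniq = Unique.take⁺ (m * s) (Unique-++ʳ (flat P) (Unique-↭ B↭ uniq))
      R′-card : length R′ ≡ m * s
      R′-card = trans (length-take (m * s) R) (m≤n⇒m⊓n≡m ms≤R)
      1≤s : 1 ≤ s
      1≤s = n≢0⇒n>0 λ s≡0 → contradiction (≤-trans (*-monoʳ-≤ 2 (s≤s (z≤n {h * (4 * (2 * k) * h)})))
        (≤-trans room (≤-reflexive (trans (cong (n₀ *_) s≡0) (*-zeroʳ n₀))))) λ ()
      r : ∃[ r ] r ∈ R′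
      r = inhabitant R′ (≤-trans (*-mono-≤ 1≤m 1≤s) (≤-reflexive (sym R′-card)))
      r∈ : proj₁ r ∈ R
      r∈ = R′⊆R (proj₂ r)
      2m≤2k : m + m ≤ 2 * k
      2m≤2k = ≤-trans (+-mono-≤ (<⇒≤ m<k) (<⇒≤ m<k)) (≤-reflexive (cong (λ z → k + z) (sym (+-identityʳ k))))
      half : length (E B k) < 2 * length (E R′ m)
      half = more-than-half p p′ n₀ m k (length (E B k)) (length (E R′ m)) p′≡ 1≤p n₀+m≡k 80n₀≤k 1≤m (E-nonempty (proj₂ r) m)
        (minimal 1≤m m<k R′-uniq R′⊆B R′-card)
    start : ∀ B′ → B′ ≡ B → 2 ≤ length B′ → ⊥
    start (_ ∷ []) refl (s≤s ())
    -- One pair is present from the outset, so that the set to be averaged is never empty.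
    start (x ∷ x′ ∷ R₀) refl _ = absorb (2 * k) h (x ∷ x′ ∷ R₀) small-V h 0 ((x , x′) ∷ []) R₀ refl ↭-refl
      (V-nonempty ((x , x′) ∷ [])) (s≤s z≤n) ≤-refl conclude

-- Choice of scales

grow : ∀ m {n} → 1 ≤ n → m ≤ m * n
grow m {n} 1≤n = m≤m*n m n {{>-nonZero 1≤n}}

1≤* : ∀ {m n} → 1 ≤ m → 1 ≤ n → 1 ≤ m * n
1≤* = *-mono-≤

-- With ω = h ^ m, X = h ^ x, Y = h ^ y, Z = h ^ w, the quantities below are explicit powers of h up to the factor a.
record Scales {d : ℕ} (𝓕 : Frame d) (k s h : ℕ) : Set where
  open Frame 𝓕
  field
    X Y₁ Z : ℕ

  Q : ℕ
  Q  = h * h * h * h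
  Y : ℕ
  Y  = Q * Y₁
  p₁ : ℕ
  p₁ = ω * X * (Y * Y) * Q
  p₀ : ℕ
  p₀ = h * p₁
  μ : ℕ
  μ  = p₀ * Q
  ς : ℕ
  ς  = μ * Y
  -- J₀ μ = ς ς, so depth for the walk and shallowness for the slab use the same margin. Moreover J₀
  -- = h G₀.
  J₀ : ℕ
  J₀ = ς * Y
  G₀ : ℕ
  G₀ = p₁ * Q * (Y * Y)
  L₂ : ℕ
  L₂ = a * p₁
  -- k′ X = a G₀ = L: the scale of the slab is smaller by X, which bounds the number of cells in the
  -- pigeonhole argument.
  k′ : ℕ
  k′ = a * ω * (Y * Y * (Y * Y)) * (Q * Q)
  σ : ℕ
  σ  = ω * (Y * Y * Y) * (Q * Q * Q)
  -- σᵢ Y = σ: the finer spacing is what the thinness of the slab earns.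
  σᵢ : ℕ
  σᵢ = ω * (Y * Y) * (Q * Q * Q)
  n₀ : ℕ
  n₀ = a * (J * Z)
  -- The cardinality at which `Regular.minimal` can be applied to a slab, with r = k′.
  Θ : ℕ
  Θ  = k′ * s

  field
    1≤X    : 1 ≤ X
    1≤Y₁   : 1 ≤ Y₁
    1≤Z    : 1 ≤ Z
    1≤ω    : 1 ≤ ω
    16d≤h  : 16 * (d + 10) ≤ h
    16C≤h  : 16 * C ≤ h
    4T≤h   : 4 * (T + 2) ≤ h
    κ≤     : κ * (h * h) ≤ ω * a
    J≡     : J ≡ h * h * G₀
    L≡     : 2 ^ T ≡ a * G₀
    hn₀≤k  : h * n₀ ≤ k
    k≤n₀h² : k ≤ n₀ * (h * h)
    s≥     : Q * Q * (Q * Q) * (Y * Y) * (Z * Z) * X ≤ s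

module ScaleFacts {d : ℕ} {𝓕 : Frame d} {k s h : ℕ} (Sc : Scales 𝓕 k s h) where

  open Frame 𝓕 hiding (L)
  open Scales Sc

  16d≤ : 16 * d ≤ h
  16d≤ = ≤-trans (*-monoʳ-≤ 16 (m≤m+n d 10)) 16d≤h

  160≤h : 160 ≤ h
  160≤h = ≤-trans (*-monoʳ-≤ 16 (m≤n+m 10 d)) 16d≤h

  1≤h : 1 ≤ h
  1≤h = ≤-trans (s≤s z≤n) 160≤h

  1≤a : 1 ≤ a
  1≤a = >-nonZero⁻¹ a

  1≤hh : 1 ≤ h * h
  1≤hh = 1≤* 1≤h 1≤h

  1≤Q : 1 ≤ Q
  1≤Q = 1≤* (1≤* 1≤hh 1≤h) 1≤h

  1≤Y : 1 ≤ Y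
  1≤Y = 1≤* 1≤Q 1≤Y₁

  1≤YY : 1 ≤ Y * Y
  1≤YY = 1≤* 1≤Y 1≤Y

  1≤p₁ : 1 ≤ p₁
  1≤p₁ = 1≤* (1≤* (1≤* 1≤ω 1≤X) 1≤YY) 1≤Q

  1≤p₀ : 1 ≤ p₀
  1≤p₀ = 1≤* 1≤h 1≤p₁

  1≤μ : 1 ≤ μ
  1≤μ = 1≤* 1≤p₀ 1≤Q

  1≤ς : 1 ≤ ς
  1≤ς = 1≤* 1≤μ 1≤Y

  1≤J₀ : 1 ≤ J₀
  1≤J₀ = 1≤* 1≤ς 1≤Y

  1≤G₀ : 1 ≤ G₀
  1≤G₀ = 1≤* (1≤* 1≤p₁ 1≤Q) 1≤YY

  1≤k′ : 1 ≤ k′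
  1≤k′ = 1≤* (1≤* (1≤* 1≤a 1≤ω) (1≤* 1≤YY 1≤YY)) (1≤* 1≤Q 1≤Q)

  1≤s : 1 ≤ s
  1≤s = ≤-trans (1≤* (1≤* (1≤* (1≤* (1≤* 1≤Q 1≤Q) (1≤* 1≤Q 1≤Q)) 1≤YY) (1≤* 1≤Z 1≤Z)) 1≤X) s≥

  h≤Q : h ≤ Q
  h≤Q = ≤-trans (grow h (1≤* 1≤hh 1≤h)) (≤-reflexive (e h))
    where
    e : ∀ h → h * (h * h * h) ≡ h * h * h * h
    e = ℕ-ring

  hh≤Q : h * h ≤ Q
  hh≤Q = ≤-trans (grow (h * h) 1≤hh) (≤-reflexive (e h))
    where
    e : ∀ h → h * h * (h * h) ≡ h * h * h * h
    e = ℕ-ring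

  ω≤p₁ : ω ≤ p₁
  ω≤p₁ = ≤-trans (grow ω (1≤* (1≤* 1≤X 1≤YY) 1≤Q)) (≤-reflexive (e ω X (Y * Y) Q))
    where
    e : ∀ w x y q → w * (x * y * q) ≡ w * x * y * q
    e = ℕ-ring

  ω≤G₀ : ω ≤ G₀
  ω≤G₀ = ≤-trans ω≤p₁ (≤-trans (grow p₁ (1≤* 1≤Q 1≤YY)) (≤-reflexive (sym (*-assoc p₁ Q (Y * Y)))))

  J₀≡hG₀ : J₀ ≡ h * G₀
  J₀≡hG₀ = e h p₁ Q Y
    where
    e : ∀ h p q y → h * p * q * y * y ≡ h * (p * q * (y * y))
    e = ℕ-ring

  κ≤aω : κ ≤ a * ω
  κ≤aω = ≤-trans (grow κ 1≤hh) (≤-trans κ≤ (≤-reflexive (*-comm ω a)))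

  T+2≤h : 2 + T ≤ h
  T+2≤h = ≤-trans (≤-reflexive (+-comm 2 T)) (≤-trans (m≤n*m (T + 2) 4) 4T≤h)

  3+2T≤h : 3 + 2 * T ≤ h
  3+2T≤h = ≤-trans (≤-trans (m≤m+n (3 + 2 * T) (5 + 2 * T)) (≤-reflexive (e T))) 4T≤h
    where
    e : ∀ t → 3 + 2 * t + (5 + 2 * t) ≡ 4 * (t + 2)
    e = ℕ-ring

  k′X≡aG₀ : k′ * X ≡ a * G₀
  k′X≡aG₀ = e a ω Y Q X
    where
    e : ∀ a w y q x → a * w * (y * y * (y * y)) * (q * q) * x ≡ a * (w * x * (y * y) * q * q * (y * y))
    e = ℕ-ring

  L≡k′X : 2 ^ T ≡ k′ * X
  L≡k′X = trans L≡ (sym k′X≡aG₀)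

  ahG₀≤n₀ : a * (h * G₀) ≤ n₀
  ahG₀≤n₀ = *-monoʳ-≤ a (≤-trans (≤-trans (grow (h * G₀) 1≤h) (≤-reflexive (trans (e h G₀) (sym J≡)))) (grow J 1≤Z))
    where
    e : ∀ h g → h * g * h ≡ h * h * g
    e = ℕ-ring

  1≤n₀ : 1 ≤ n₀
  1≤n₀ = ≤-trans (1≤* 1≤a (1≤* 1≤h 1≤G₀)) ahG₀≤n₀

  2n₀≤k : n₀ + n₀ ≤ k
  2n₀≤k = ≤-trans (≤-reflexive (cong (λ z → n₀ + z) (sym (+-identityʳ n₀)))) (≤-trans (*-monoˡ-≤ n₀ (≤-trans (s≤s (s≤s z≤n)) 160≤h)) hn₀≤k)

  n₀<k : n₀ < k
  n₀<k = ≤-trans (m<m+n n₀ 1≤n₀) 2n₀≤k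

  k′≤aG₀ : k′ ≤ a * G₀
  k′≤aG₀ = ≤-trans (grow k′ 1≤X) (≤-reflexive k′X≡aG₀)

  k′<k : k′ < k
  k′<k = ≤-<-trans (≤-trans k′≤aG₀ (≤-trans (*-monoʳ-≤ a (m≤n*m G₀ h {{>-nonZero 1≤h}})) ahG₀≤n₀)) n₀<k

  n₀s≤ : ∀ {R : List ℕ} → (k ∸ n₀) * s ≤ length R → n₀ * s ≤ length R
  n₀s≤ le = ≤-trans (*-monoˡ-≤ s (m+n≤o⇒m≤o∸n n₀ 2n₀≤k)) le

  2C≤h : 2 * C ≤ h
  2C≤h = ≤-trans (*-monoˡ-≤ C (s≤s (s≤s (z≤n {14})))) 16C≤h

  walk-bounds : WalkBounds 𝓕
  walk-bounds = record
    { J₀ = J₀ ; G₀ = G₀ ; p₀ = p₀ ; μ = μ ; L₂ = L₂ ; Θ = Θ ; 1≤J₀ = 1≤J₀ ; 1≤μ = 1≤μ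
    ; L₂≤L = ≤-trans (*-monoʳ-≤ a (≤-trans (grow p₁ (1≤* 1≤Q 1≤YY)) (≤-reflexive (sym (*-assoc p₁ Q (Y * Y)))))) (≤-reflexive (sym L≡))
    ; 2Cκ≤aω = ≤-trans (≤-reflexive (e₀ C κ)) (≤-trans (*-monoˡ-≤ κ 2C≤h) (≤-trans (≤-trans (grow (h * κ) 1≤h) (≤-reflexive (e₅ h κ))) (≤-trans κ≤ (≤-reflexive (*-comm ω a)))))
    ; L₂J₀≡Lp₀ = trans (e₁ a p₁ h Q Y) (cong (_* p₀) (sym L≡))
    ; Ω≤p₀ = *-mono-≤ T+2≤h ω≤p₁
    ; drift = drift
    ; square = square }
    where
    open ≤-Reasoning
    e₀ : ∀ c k → c * (2 * k) ≡ 2 * c * k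
    e₀ = ℕ-ring
    e₅ : ∀ h k → h * k * h ≡ k * (h * h)
    e₅ = ℕ-ring
    e₁ : ∀ a p h q y → a * p * (h * p * q * y * y) ≡ a * (p * q * (y * y)) * (h * p)
    e₁ = ℕ-ring
    8d≤Q : 8 * d ≤ Q
    8d≤Q = ≤-trans (*-monoˡ-≤ d (m≤m+n 8 8)) (≤-trans 16d≤ h≤Q)
    drift : 4 * (d * p₀ + J₀ * (d * ((2 + T) * ω))) ≤ p₀ * μ
    drift = begin
      4 * (d * p₀ + J₀ * (d * ((2 + T) * ω)))     ≤⟨ *-monoʳ-≤ 4 (+-mono-≤ (grow (d * p₀) 1≤N) (*-monoʳ-≤ J₀ (*-monoʳ-≤ d (*-monoˡ-≤ ω T+2≤h)))) ⟩
      4 * (d * p₀ * N + J₀ * (d * (h * ω)))       ≡⟨ e₂ d p₀ h ω Q Y ⟩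
      p₀ * (8 * d * N)                            ≤⟨ *-monoʳ-≤ p₀ (*-monoˡ-≤ N 8d≤Q) ⟩
      p₀ * (Q * N)                                ≤⟨ grow (p₀ * (Q * N)) 1≤X ⟩
      p₀ * (Q * N) * X                            ≡⟨ e₃ p₀ Q h ω Y X ⟩
      p₀ * μ                                      ∎
      where
      N : ℕ
      N = h * ω * Q * (Y * Y)
      1≤N : 1 ≤ N
      1≤N = 1≤* (1≤* (1≤* 1≤h 1≤ω) 1≤Q) 1≤YY
      e₂ : ∀ d p h w q y → 4 * (d * p * (h * w * q * (y * y)) + p * q * y * y * (d * (h * w))) ≡ p * (8 * d * (h * w * q * (y * y)))
      e₂ = ℕ-ring
      e₃ : ∀ p q h w y x → p * (q * (h * w * q * (y * y))) * x ≡ p * (h * (w * x * (y * y) * q) * q)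
      e₃ = ℕ-ring
    square : 8 * (J₀ * (d * (p₀ * p₀))) ≤ G₀ * (p₀ * μ)
    square = begin
      8 * (J₀ * (d * (p₀ * p₀)))        ≡⟨ cong (λ j → 8 * (j * (d * (p₀ * p₀)))) J₀≡hG₀ ⟩
      8 * (h * G₀ * (d * (p₀ * p₀)))    ≡⟨ e₂ h G₀ d p₀ ⟩
      8 * d * h * (G₀ * (p₀ * p₀))      ≤⟨ *-monoˡ-≤ (G₀ * (p₀ * p₀)) (≤-trans (*-monoˡ-≤ h (≤-trans (*-monoˡ-≤ d (m≤m+n 8 8)) 16d≤)) hh≤Q) ⟩
      Q * (G₀ * (p₀ * p₀))              ≡⟨ e₃ Q G₀ p₀ ⟩
      G₀ * (p₀ * μ)                     ∎
      where
      e₂ : ∀ h g d p → 8 * (h * g * (d * (p * p))) ≡ 8 * d * h * (g * (p * p))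
      e₂ = ℕ-ring
      e₃ : ∀ q g p → q * (g * (p * p)) ≡ g * (p * (p * q))
      e₃ = ℕ-ring

  ξ≤CG₀ : ∀ {b} → b ∈ B → ∀ i → 2 * ∣ ξ b i ∣ ≤ J₀
  ξ≤CG₀ {b} b∈ i = *-cancelˡ-≤ a (begin
    a * (2 * ∣ ξ b i ∣)     ≡⟨ e₁ a (∣ ξ b i ∣) ⟩
    2 * (a * ∣ ξ b i ∣)     ≤⟨ *-monoʳ-≤ 2 (proj₁ (ξ-spec b∈) i) ⟩
    2 * (C * 2 ^ T)         ≡⟨ cong (λ l → 2 * (C * l)) L≡ ⟩
    2 * (C * (a * G₀))      ≡⟨ e₂ C a G₀ ⟩
    a * (2 * C * G₀)        ≤⟨ *-monoʳ-≤ a (*-monoˡ-≤ G₀ 2C≤h) ⟩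
    a * (h * G₀)            ≡⟨ cong (a *_) J₀≡hG₀ ⟨
    a * J₀                  ∎)
    where
    open ≤-Reasoning
    e₁ : ∀ a x → a * (2 * x) ≡ 2 * (a * x)
    e₁ = ℕ-ring
    e₂ : ∀ c a g → 2 * (c * (a * g)) ≡ a * (2 * c * g)
    e₂ = ℕ-ring

  ξ≤J₀ : ∀ {b} → b ∈ B → ∀ i → ∣ ξ b i ∣ ≤ J₀
  ξ≤J₀ {b} b∈ i = ≤-trans (m≤n*m (∣ ξ b i ∣) 2) (ξ≤CG₀ b∈ i)

  gap≤J₀ : ∀ {b o} → b ∈ B → o ∈ B → ∀ i → ∣ gap ξ (b , o) i ∣ ≤ J₀
  gap≤J₀ {b} {o} b∈ o∈ i = *-cancelˡ-≤ 2 (≤-trans (*-monoʳ-≤ 2 (ℤₚ.∣i-j∣≤∣i∣+∣j∣ (ξ b i) (ξ o i)))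
    (≤-trans (≤-reflexive (*-distribˡ-+ 2 (∣ ξ b i ∣) (∣ ξ o i ∣)))
      (≤-trans (+-mono-≤ (ξ≤CG₀ b∈ i) (ξ≤CG₀ o∈ i)) (≤-reflexive (cong (λ z → J₀ + z) (sym (+-identityʳ J₀)))))))

  -- Gs bounds the starting coordinates, as the reference choice has O(k h²) elements; fuel bounds
  -- the initial energy divided by the loss per block.
  Gs fuel : ℕ
  Gs   = h * Q * (J * Z)
  fuel = Q * Q * (Q * Q) * Q * (Y * Y * (Y * Y)) * (Z * Z)

  start-bound : ∀ {n x} → n ≤ suc (h * (4 * (2 * k) * h)) → a * x ≤ C * n → x ≤ Gs
  start-bound {n} {x} n≤ ax≤ = *-cancelˡ-≤ a (begin
    a * x                                     ≤⟨ ax≤ ⟩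
    C * n                                     ≤⟨ *-monoʳ-≤ C (≤-trans n≤ (+-monoˡ-≤ (h * (4 * (2 * k) * h)) (1≤* (≤-trans 1≤n₀ (<⇒≤ n₀<k)) 1≤hh))) ⟩
    C * (k * (h * h) + h * (4 * (2 * k) * h)) ≡⟨ e₁ C k h ⟩
    9 * C * (h * h) * k                       ≤⟨ *-mono-≤ (*-monoˡ-≤ (h * h) (≤-trans (*-monoˡ-≤ C (m≤m+n 9 7)) 16C≤h)) k≤n₀h² ⟩
    h * (h * h) * (n₀ * (h * h))              ≡⟨ e₂ h a (J * Z) ⟩
    a * Gs                                    ∎)
    where
    open ≤-Reasoning
    e₁ : ∀ c k h → c * (k * (h * h) + h * (4 * (2 * k) * h)) ≡ 9 * c * (h * h) * k
    e₁ = ℕ-ring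
    e₂ : ∀ h a j → h * (h * h) * (a * j * (h * h)) ≡ a * (h * (h * h * h * h) * j)
    e₂ = ℕ-ring

  energy-bound : J₀ * (d * (Gs * Gs)) ≤ fuel * (G₀ * (p₀ * μ))
  energy-bound = begin
    J₀ * (d * (Gs * Gs))
      ≡⟨ cong₂ (λ j j′ → j * (d * (h * Q * (j′ * Z) * (h * Q * (j′ * Z))))) J₀≡hG₀ J≡ ⟩
    h * G₀ * (d * (h * Q * (h * h * G₀ * Z) * (h * Q * (h * h * G₀ * Z))))
      ≡⟨ e₁ h G₀ d Q Z p₁ (Y * Y) ⟩
    d * (h * h * h * h * h * h * h) * M
      ≤⟨ *-monoˡ-≤ M (*-monoˡ-≤ (h * h * h * h * h * h * h) (≤-trans (m≤n*m d 16) 16d≤)) ⟩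
    h * (h * h * h * h * h * h * h) * M
      ≤⟨ *-monoˡ-≤ M (≤-trans (grow (h * (h * h * h * h * h * h * h)) 1≤hh) (≤-reflexive (e₂ h))) ⟩
    Q * Q * (h * h) * M
      ≡⟨ e₃ Q h G₀ Z p₁ (Y * Y) ⟩
    fuel * (G₀ * (p₀ * μ)) ∎
    where
    open ≤-Reasoning
    M : ℕ
    M = Q * Q * (Z * Z) * G₀ * (p₁ * Q * (Y * Y) * (p₁ * Q * (Y * Y)))
    e₁ : ∀ h g d q z p y → h * (p * q * y) * (d * (h * q * (h * h * (p * q * y) * z) * (h * q * (h * h * (p * q * y) * z)))) ≡
      d * (h * h * h * h * h * h * h) * (q * q * (z * z) * (p * q * y) * (p * q * y * (p * q * y)))
    e₁ h g d q z p y = l h d q z (p * q * y)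
      where
      l : ∀ h d q z g → h * g * (d * (h * q * (h * h * g * z) * (h * q * (h * h * g * z)))) ≡
        d * (h * h * h * h * h * h * h) * (q * q * (z * z) * g * (g * g))
      l = ℕ-ring
    e₂ : ∀ h → h * (h * h * h * h * h * h * h) * (h * h) ≡ h * h * h * h * (h * h * h * h) * (h * h)
    e₂ = ℕ-ring
    e₃ : ∀ q h g z p y → q * q * (h * h) * (q * q * (z * z) * g * (p * q * y * (p * q * y))) ≡
      q * q * (q * q) * q * (y * y) * (z * z) * (g * (h * p * (h * p * q)))
    e₃ = ℕ-ring

  fuel-bound : fuel * L₂ ≤ Θ
  fuel-bound = begin
    fuel * L₂                                                 ≡⟨ e Q Y Z a ω X ⟩
    k′ * (Q * Q * (Q * Q) * (Y * Y) * (Z * Z) * X)            ≤⟨ *-monoʳ-≤ k′ s≥ ⟩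
    Θ                                                         ∎
    where
    open ≤-Reasoning
    e : ∀ q y z a w x → q * q * (q * q) * q * (y * y * (y * y)) * (z * z) * (a * (w * x * (y * y) * q)) ≡
      a * w * (y * y * (y * y)) * (q * q) * (q * q * (q * q) * (y * y) * (z * z) * x)
    e = ℕ-ring

  end-bound : κ + d * (G₀ * (2 * a)) ≤ n₀
  end-bound = begin
    κ + d * (G₀ * (2 * a))     ≤⟨ +-monoˡ-≤ _ (≤-trans κ≤aω (*-monoʳ-≤ a ω≤G₀)) ⟩
    a * G₀ + d * (G₀ * (2 * a)) ≡⟨ e a G₀ d ⟩
    (1 + 2 * d) * (a * G₀)     ≤⟨ *-monoˡ-≤ (a * G₀) (≤-trans (≤-trans (m≤m+n (1 + 2 * d) (159 + 14 * d)) (≤-reflexive (e₂ d))) 16d≤h) ⟩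
    h * (a * G₀)               ≡⟨ e₃ h a G₀ ⟩
    a * (h * G₀)               ≤⟨ ahG₀≤n₀ ⟩
    n₀                         ∎
    where
    open ≤-Reasoning
    e : ∀ a g d → a * g + d * (g * (2 * a)) ≡ (1 + 2 * d) * (a * g)
    e = ℕ-ring
    e₂ : ∀ d → 1 + 2 * d + (159 + 14 * d) ≡ 16 * (d + 10)
    e₂ = ℕ-ring
    e₃ : ∀ h a g → h * (a * g) ≡ a * (h * g)
    e₃ = ℕ-ring

module NoDeep {d : ℕ} {𝓕 : Frame d} {k s h : ℕ} (Sc : Scales 𝓕 k s h) {A : List ℕ} (core : Core A (Frame.B 𝓕))
  (n₀≡ : Core.n₀ core ≡ Scales.n₀ Sc) (P≤ : length (Core.P core) ≤ suc (h * (4 * (2 * k) * h))) where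

  open Frame 𝓕
  open Scales Sc
  open ScaleFacts Sc
  open Core core using (R; R⊆B; balanced) renaming (T to pairing; T-length to pairing-length; T⊆B to pairing⊆B)

  no-deep : ∀ {o} → o ∈ R → ¬ Deep ξ R J₀ (J₀ * μ) Θ o
  no-deep {o} o∈ deep = conclude (walk fuel begin-state (fuel-bound , energy≤))
    where
    xs : List (ℕ × ℕ)
    xs = map (_, o) pairing
    pairs : PairsIn B xs
    pairs = All.map⁺ (All.tabulate (λ b∈ → pairing⊆B b∈ , R⊆B o∈))
    w : ℤ
    w = total xs
    len≤ : length xs ≤ suc (h * (4 * (2 * k) * h))
    len≤ = ≤-trans (≤-reflexive (trans (length-map (_, o) pairing) pairing-length)) P≤
    origin : ∃[ c ] (∀ i → a * ∣ c i ∣ ≤ C * length xs) × w ℤ.- dot c u ∈ E B κ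
    origin = span (length xs) (total∈E xs pairs)
    g₀ : Vector d
    g₀ = proj₁ origin
    target : Target 𝓕 walk-bounds
    target = record { R = R ; R⊆B = R⊆B ; o = o ; o∈B = R⊆B o∈ ; gap≤ = λ b∈ → gap≤J₀ b∈ (R⊆B o∈) ; deep = deep ; w = w }
    open Walk.Steering 𝓕 walk-bounds target
    begin-state : State []
    begin-state = state {Rest = R} g₀ ↭-refl (λ ()) (subst (λ z → z ℤ.- dot g₀ u ∈ E B κ) (sym (ℤₚ.+-identityʳ w)) (proj₂ (proj₂ origin)))
    g₀≤ : ∀ i → ∣ g₀ i ∣ ≤ Gs
    g₀≤ i = start-bound len≤ (proj₁ (proj₂ origin) i)
    energy≤ : + J₀ ℤ.* dot g₀ g₀ ℤ.≤ + (fuel * (G₀ * (p₀ * μ)))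
    energy≤ = +≤⇒∣∣ (≤-trans (≤-reflexive (ℤₚ.abs-* (+ J₀) (dot g₀ g₀))) (≤-trans (*-monoʳ-≤ J₀ (dot-∣∣≤ Gs Gs g₀≤ g₀≤)) energy-bound))
    conclude : Result → ⊥
    -- Coordinates at most G₀ together with the error κ put the final surplus into E B n₀.
    conclude (Y , state {Rest} g R↭ o∉ at , close) = balanced o∈ R↭ o∉
      (subst (λ n → w ℤ.+ total (map (_, o) Y) ∈ E B n) (sym n₀≡) (E-mono b₀∈ end-bound
        (subst (_∈ E B (κ + d * (G₀ * (2 * a)))) (l (w ℤ.+ total (map (_, o) Y)) (dot g u)) (E-+ κ at (dot-E g u close u∈ b₀∈)))))
      where
      l : ∀ x y → x ℤ.- y ℤ.+ y ≡ x
      l = ℤ-ring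

-- X Z Q bounds k / k′. On the right stands the number of packed translates, with r = X Y₁ steps in
-- δ directions and r Y steps in the thin one.
record Volume (p p′ δ X Y₁ Z Q : ℕ) : Set where
  field
    cells  : suc (4 * (Q * Y₁)) ^ δ ≤ X
    volume : (X * Z * Q) ^ p′ < ((X * Y₁) ^ δ * (X * Y₁ * (Q * Y₁))) ^ (2 * p)

module NoSlab {d : ℕ} {𝓕 : Frame (suc d)} {k s h : ℕ} (Sc : Scales 𝓕 k s h) {p p′ : ℕ} (reg : Regular p p′ s k (Frame.B 𝓕))
  (Vol : Volume p p′ d (Scales.X Sc) (Scales.Y₁ Sc) (Scales.Z Sc) (Scales.Q Sc))
  {R : List ℕ} (R⊆B : ∀ {b} → b ∈ R → b ∈ Frame.B 𝓕) (R-uniq : Unique R) (R-card : (k ∸ Scales.n₀ Sc) * s ≤ length R) where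

  open Frame 𝓕 hiding (L)
  open Scales Sc
  open ScaleFacts Sc
  open Volume Vol

  private
    instance
      ς≢0 : NonZero ς
      ς≢0 = >-nonZero 1≤ς

    6d≤h : 6 * suc d ≤ h
    6d≤h = ≤-trans (*-monoˡ-≤ (suc d) (m≤m+n 6 10)) 16d≤

    5hh<Q : 5 * (h * h) < Q
    5hh<Q = begin-strict
      5 * (h * h)       <⟨ *-monoˡ-< (h * h) {{>-nonZero 1≤hh}} (s≤s (s≤s (s≤s (s≤s (s≤s (s≤s (z≤n {0}))))))) ⟩
      6 * (h * h)       ≤⟨ *-monoˡ-≤ (h * h) (≤-trans (≤-trans (m≤m+n 6 154) 160≤h) (grow h 1≤h)) ⟩
      h * h * (h * h)   ≡⟨ e h ⟩
      Q                 ∎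
      where
      open ≤-Reasoning
      e : ∀ h → h * h * (h * h) ≡ h * h * h * h
      e = ℕ-ring

  slab-bounds : SlabBounds ξ R
  slab-bounds = record
    { J₀ = J₀ ; ς = ς ; Y = Y ; h = h ; Θ = Θ ; J₀≡Yς = *-comm ς Y ; 1≤Θ = 1≤* 1≤k′ 1≤s
    ; d+5≤h = ≤-trans (≤-trans (m≤m+n (d + 5) (171 + 15 * d)) (≤-reflexive (e₁ d))) 16d≤h
    ; ξ≤ = λ b∈ → ξ≤J₀ (R⊆B b∈) ; R-uniq = R-uniq ; many = many }
    where
    open ≤-Reasoning
    e₁ : ∀ d → d + 5 + (171 + 15 * d) ≡ 16 * (1 + d + 10)
    e₁ = ℕ-ring
    e₂ : ∀ d x k s → (1 + d) * (2 * (x * (3 * (k * s)))) ≡ 6 * (1 + d) * (k * x) * s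
    e₂ = ℕ-ring
    e₃ : ∀ h a g → h * (a * g) ≡ a * (h * g)
    e₃ = ℕ-ring
    many : suc d * (2 * (suc (4 * Y) ^ d * (3 * Θ))) ≤ length R
    many = begin
      suc d * (2 * (suc (4 * Y) ^ d * (3 * Θ)))      ≤⟨ *-monoʳ-≤ (suc d) (*-monoʳ-≤ 2 (*-monoˡ-≤ (3 * Θ) cells)) ⟩
      suc d * (2 * (X * (3 * Θ)))                    ≡⟨ e₂ d X k′ s ⟩
      6 * suc d * (k′ * X) * s                       ≤⟨ *-monoˡ-≤ s (*-mono-≤ 6d≤h (≤-reflexive k′X≡aG₀)) ⟩
      h * (a * G₀) * s                               ≤⟨ *-monoˡ-≤ s (≤-trans (≤-reflexive (e₃ h a G₀)) ahG₀≤n₀) ⟩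
      n₀ * s                                         ≤⟨ n₀s≤ {R} R-card ⟩
      length R                                       ∎

  packing-bounds : PackingBounds 𝓕 J₀ ς h
  packing-bounds = record
    { k = k ; k′ = k′ ; G₀ = G₀ ; σ = σ ; σᵢ = σᵢ ; r = X * Y₁ ; rᵢ = X * Y₁ * Y
    ; k′≤L = ≤-trans k′≤aG₀ (≤-reflexive (sym L≡)) ; fits = fits
    ; rσ≤G₀ = ≤-reflexive (e₁ X Y₁ ω Q) ; rᵢσᵢ≤G₀ = ≤-reflexive (e₂ X Y₁ ω Q)
    ; small = small ; sep = sep ; sepᵢ = sepᵢ }
    where
    open ≤-Reasoning
    e₁ : ∀ x y w q → x * y * (w * (q * y * (q * y) * (q * y)) * (q * q * q)) ≡ w * x * (q * y * (q * y)) * q * q * (q * y * (q * y))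
    e₁ = ℕ-ring
    e₂ : ∀ x y w q → x * y * (q * y) * (w * (q * y * (q * y)) * (q * q * q)) ≡ w * x * (q * y * (q * y)) * q * q * (q * y * (q * y))
    e₂ = ℕ-ring
    fits : suc d * (G₀ * (2 * a)) + k′ ≤ k
    fits = begin
      suc d * (G₀ * (2 * a)) + k′          ≤⟨ +-monoʳ-≤ (suc d * (G₀ * (2 * a))) k′≤aG₀ ⟩
      suc d * (G₀ * (2 * a)) + a * G₀      ≡⟨ e₃ d G₀ a ⟩
      (2 * suc d + 1) * (a * G₀)           ≤⟨ *-monoˡ-≤ (a * G₀) (≤-trans (≤-trans (m≤m+n _ (173 + 14 * d)) (≤-reflexive (e₄ d))) 16d≤h) ⟩
      h * (a * G₀)                         ≡⟨ e₅ h a G₀ ⟩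
      a * (h * G₀)                         ≤⟨ ≤-trans ahG₀≤n₀ (<⇒≤ n₀<k) ⟩
      k                                    ∎
      where
      e₃ : ∀ d g a → (1 + d) * (g * (2 * a)) + a * g ≡ (2 * (1 + d) + 1) * (a * g)
      e₃ = ℕ-ring
      e₄ : ∀ d → 2 * (1 + d) + 1 + (173 + 14 * d) ≡ 16 * (1 + d + 10)
      e₄ = ℕ-ring
      e₅ : ∀ h a g → h * (a * g) ≡ a * (h * g)
      e₅ = ℕ-ring
    small : a * (G₀ + G₀) + 2 * (C * 2 ^ T) ≤ a * J
    small = begin
      a * (G₀ + G₀) + 2 * (C * 2 ^ T)         ≡⟨ cong (λ l → a * (G₀ + G₀) + 2 * (C * l)) L≡ ⟩
      a * (G₀ + G₀) + 2 * (C * (a * G₀))      ≡⟨ e₃ a G₀ C ⟩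
      a * ((2 + 2 * C) * G₀)                  ≤⟨ *-monoʳ-≤ a (*-monoˡ-≤ G₀ (+-mono-≤ (≤-trans (s≤s (s≤s z≤n)) 160≤h) 2C≤h)) ⟩
      a * ((h + h) * G₀)                      ≡⟨ cong (λ z → a * (z * G₀)) (e₄ h) ⟩
      a * (2 * h * G₀)                        ≤⟨ *-monoʳ-≤ a (*-monoˡ-≤ G₀ (*-monoˡ-≤ h (≤-trans (s≤s (s≤s z≤n)) 160≤h))) ⟩
      a * (h * h * G₀)                        ≡⟨ cong (a *_) J≡ ⟨
      a * J                                   ∎
      where
      e₃ : ∀ a g c → a * (g + g) + 2 * (c * (a * g)) ≡ a * ((2 + 2 * c) * g)
      e₃ = ℕ-ring
      e₄ : ∀ h → h + h ≡ 2 * h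
      e₄ = ℕ-ring
    5hhM<QM : ∀ M → 1 ≤ M → h * h * M + 4 * (h * h) * M < Q * M
    5hhM<QM M 1≤M = ≤-<-trans (≤-reflexive (e (h * h) M)) (*-monoˡ-< M {{>-nonZero 1≤M}} 5hh<Q)
      where
      e : ∀ h m → h * m + 4 * h * m ≡ 5 * h * m
      e = ℕ-ring
    sep : 2 ^ T * ((3 + 2 * T) * ω) + 4 * (k′ * (h * ς)) < 2 ^ T * σ
    sep = begin-strict
      2 ^ T * ((3 + 2 * T) * ω) + 4 * (k′ * (h * ς))  ≡⟨ cong (λ l → l * ((3 + 2 * T) * ω) + 4 * (k′ * (h * ς))) L≡k′X ⟩
      k′ * X * ((3 + 2 * T) * ω) + 4 * (k′ * (h * ς)) ≤⟨ +-monoˡ-≤ _ (≤-trans (*-monoʳ-≤ (k′ * X) (*-monoˡ-≤ ω (≤-trans 3+2T≤h (grow h 1≤h)))) (grow _ 1≤N)) ⟩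
      k′ * X * (h * h * ω) * N + 4 * (k′ * (h * ς))   ≡⟨ e₃ k′ X h ω Y Q ⟩
      h * h * M + 4 * (h * h) * M                     <⟨ 5hhM<QM M (1≤* (1≤* 1≤k′ 1≤X) (1≤* 1≤ω 1≤N)) ⟩
      Q * M                                           ≡⟨ e₄ k′ X ω Y Q ⟩
      k′ * X * σ                                      ≡⟨ cong (_* σ) L≡k′X ⟨
      2 ^ T * σ                                       ∎
      where
      N M : ℕ
      N = Y * Y * Y * (Q * Q)
      M = k′ * X * (ω * N)
      1≤N : 1 ≤ N
      1≤N = 1≤* (1≤* 1≤YY 1≤Y) (1≤* 1≤Q 1≤Q)
      e₃ : ∀ k x h w y q → k * x * (h * h * w) * (y * y * y * (q * q)) + 4 * (k * (h * (h * (w * x * (y * y) * q) * q * y))) ≡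
        h * h * (k * x * (w * (y * y * y * (q * q)))) + 4 * (h * h) * (k * x * (w * (y * y * y * (q * q))))
      e₃ = ℕ-ring
      e₄ : ∀ k x w y q → q * (k * x * (w * (y * y * y * (q * q)))) ≡ k * x * (w * (y * y * y) * (q * q * q))
      e₄ = ℕ-ring
    sepᵢ : suc d * (J₀ * (2 ^ T * ((3 + 2 * T) * ω))) + 4 * (k′ * (h * (ς * ς))) < J₀ * 2 ^ T * σᵢ
    sepᵢ = begin-strict
      suc d * (J₀ * (2 ^ T * ((3 + 2 * T) * ω))) + 4 * (k′ * (h * (ς * ς)))
        ≡⟨ cong (λ l → suc d * (J₀ * (l * ((3 + 2 * T) * ω))) + 4 * (k′ * (h * (ς * ς)))) L≡k′X ⟩
      suc d * (J₀ * (k′ * X * ((3 + 2 * T) * ω))) + 4 * (k′ * (h * (ς * ς)))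
        ≤⟨ +-monoˡ-≤ _ (≤-trans (*-mono-≤ (≤-trans (m≤n*m (suc d) 16) 16d≤) (*-monoʳ-≤ J₀ (*-monoʳ-≤ (k′ * X) (*-monoˡ-≤ ω 3+2T≤h)))) (grow _ 1≤N)) ⟩
      h * (J₀ * (k′ * X * (h * ω))) * N + 4 * (k′ * (h * (ς * ς)))
        ≡⟨ e₃ k′ X h ω Y Q (h * (ω * X * (Y * Y) * Q)) ⟩
      h * h * M + 4 * (h * h) * M
        <⟨ 5hhM<QM M (1≤* (1≤* 1≤J₀ (1≤* 1≤k′ 1≤X)) (1≤* 1≤ω 1≤N)) ⟩
      Q * M
        ≡⟨ e₄ J₀ k′ X ω Y Q ⟩
      J₀ * (k′ * X) * σᵢ
        ≡⟨ cong (λ l → J₀ * l * σᵢ) L≡k′X ⟨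
      J₀ * 2 ^ T * σᵢ ∎
      where
      N M : ℕ
      N = Y * Y * (Q * Q)
      M = J₀ * (k′ * X) * (ω * N)
      1≤N : 1 ≤ N
      1≤N = 1≤* 1≤YY (1≤* 1≤Q 1≤Q)
      e₃ : ∀ k x h w y q p → h * (h * (w * x * (y * y) * q) * q * y * y * (k * x * (h * w))) * (y * y * (q * q)) +
          4 * (k * (h * (h * (w * x * (y * y) * q) * q * y * (h * (w * x * (y * y) * q) * q * y)))) ≡
        h * h * (h * (w * x * (y * y) * q) * q * y * y * (k * x) * (w * (y * y * (q * q)))) +
          4 * (h * h) * (h * (w * x * (y * y) * q) * q * y * y * (k * x) * (w * (y * y * (q * q))))
      e₃ = ℕ-ring
      e₄ : ∀ j k x w y q → q * (j * (k * x) * (w * (y * y * (q * q)))) ≡ j * (k * x) * (w * (y * y) * (q * q * q))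
      e₄ = ℕ-ring

  -- The translates packed into E B k exceed what regularity allows for the slab.
  no-slab : Slab ξ R J₀ ς h Θ → ⊥
  no-slab S = <-irrefl refl (<-≤-trans volume grid≤)
    where
    open ≤-Reasoning
    open Slab S using (B′; B′-uniq; B′⊆R; B′-card)
    grid e e′ : ℕ
    grid = (X * Y₁) ^ d * (X * Y₁ * Y)
    e    = length (E (Frame.B 𝓕) k)
    e′   = length (E B′ k′)
    packed : grid * e′ ≤ e
    packed = Packing.packing 𝓕 packing-bounds S R⊆B
    regular : e ^ (2 * p) * k′ ^ p′ ≤ e′ ^ (2 * p) * k ^ p′
    regular = Regular.minimal reg 1≤k′ k′<k B′-uniq (R⊆B ∘ B′⊆R) B′-card
    1≤e′ : 1 ≤ e′
    1≤e′ = E-nonempty (proj₂ (inhabitant B′ (≤-trans (1≤* 1≤k′ 1≤s) (≤-reflexive (sym B′-card))))) k′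
    k≤ : k ≤ k′ * (X * Z * Q)
    k≤ = ≤-trans k≤n₀h² (≤-reflexive (trans (cong (λ j → a * (j * Z) * (h * h)) J≡) (trans (l₁ a h G₀ Z)
      (trans (cong (λ z → z * Z * Q) (sym k′X≡aG₀)) (l₂ k′ X Z Q)))))
      where
      l₁ : ∀ a h g z → a * (h * h * g * z) * (h * h) ≡ a * g * z * (h * h * h * h)
      l₁ = ℕ-ring
      l₂ : ∀ k x z q → k * x * z * q ≡ k * (x * z * q)
      l₂ = ℕ-ring
    grid≤ : grid ^ (2 * p) ≤ (X * Z * Q) ^ p′
    grid≤ = *-cancelˡ-≤ (e′ ^ (2 * p) * k′ ^ p′) {{m*n≢0 _ _ {{m^n≢0 e′ (2 * p) {{>-nonZero 1≤e′}}}} {{m^n≢0 k′ p′ {{>-nonZero 1≤k′}}}}}} (begin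
      e′ ^ (2 * p) * k′ ^ p′ * grid ^ (2 * p)          ≡⟨ l (e′ ^ (2 * p)) (k′ ^ p′) (grid ^ (2 * p)) ⟩
      grid ^ (2 * p) * e′ ^ (2 * p) * k′ ^ p′          ≡⟨ cong (_* k′ ^ p′) (^-distribʳ-* grid e′ (2 * p)) ⟨
      (grid * e′) ^ (2 * p) * k′ ^ p′                  ≤⟨ *-monoˡ-≤ (k′ ^ p′) (^-monoˡ-≤ (2 * p) packed) ⟩
      e ^ (2 * p) * k′ ^ p′                            ≤⟨ regular ⟩
      e′ ^ (2 * p) * k ^ p′                            ≤⟨ *-monoʳ-≤ (e′ ^ (2 * p)) (^-monoˡ-≤ p′ k≤) ⟩
      e′ ^ (2 * p) * (k′ * (X * Z * Q)) ^ p′           ≡⟨ cong (e′ ^ (2 * p) *_) (^-distribʳ-* k′ (X * Z * Q) p′) ⟩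
      e′ ^ (2 * p) * (k′ ^ p′ * (X * Z * Q) ^ p′)      ≡⟨ *-assoc (e′ ^ (2 * p)) (k′ ^ p′) ((X * Z * Q) ^ p′) ⟨
      e′ ^ (2 * p) * k′ ^ p′ * (X * Z * Q) ^ p′        ∎)
      where
      l : ∀ e k g → e * k * g ≡ g * e * k
      l = ℕ-ring

  no-slabs : (∀ {o} → o ∈ R → ¬ Deep ξ R J₀ (ς * ς) Θ o) → ⊥
  no-slabs ¬deep = slab-exists slab-bounds ¬deep no-slab

finish : ∀ {d} (𝓕 : Frame d) {A k s h p p′} (Sc : Scales 𝓕 k s h) (core : Core A (Frame.B 𝓕)) → Core.n₀ core ≡ Scales.n₀ Sc →
  length (Core.P core) ≤ suc (h * (4 * (2 * k) * h)) → (k ∸ Scales.n₀ Sc) * s ≤ length (Core.R core) →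
  Regular p p′ s k (Frame.B 𝓕) → Volume p p′ (pred d) (Scales.X Sc) (Scales.Y₁ Sc) (Scales.Z Sc) (Scales.Q Sc) → ⊥
-- With no generators there are no directions, so every point is vacuously deep.
finish {zero} 𝓕 {k = k} {s} Sc core n₀≡ P≤ R-card reg vol = NoDeep.no-deep Sc core n₀≡ P≤ (proj₂ o) (λ f f≤ (i , _) → case i of λ ())
  where
  open ScaleFacts Sc
  o : ∃[ o ] o ∈ Core.R core
  o = inhabitant (Core.R core) (≤-trans (1≤* 1≤n₀ 1≤s) (n₀s≤ {Core.R core} R-card))
finish {suc d} 𝓕 {h = h} Sc core n₀≡ P≤ R-card reg vol =
  NoSlab.no-slabs Sc reg vol (Core.R⊆B core) (Core.R-uniq core) R-card
    (λ {o} o∈ deep → NoDeep.no-deep Sc core n₀≡ P≤ o∈ (subst (λ H → Deep (Frame.ξ 𝓕) (Core.R core) J₀ H Θ o) (e μ Y) deep))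
  where
  open Scales Sc
  e : ∀ m y → m * y * (m * y) ≡ m * y * y * m
  e = ℕ-ring

-- Exponents

-- With δ + 1 generators left and Z = h ^ w, Y₁ = h ^ yExp and X = h ^ xExp are large enough for Volume.
yExp : ℕ → ℕ → ℕ
yExp p w = 2 * p * (36 + 5 * w)

-- X has to exceed the number (4 Y + 1) ^ δ of cells, which is at most (5 h ^ (4 + y)) ^ δ.
xExp : ℕ → ℕ → ℕ → ℕ
xExp p δ w = (yExp p w + 5) * δ

-- The exponent of J / ω. Of the final 10, the two factors Q account for 8 and h h for 2.
window : ℕ → ℕ → ℕ → ℕ
window p δ w = xExp p δ w + ((4 + yExp p w) + (4 + yExp p w) + ((4 + yExp p w) + (4 + yExp p w)) + 10)

-- `depth p (suc d)` is the number of powers of h reserved for the stage with d generators and all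
-- later ones. The recursion starts at the last stage: the room Z = h ^ `depth p d` for the later
-- stages is itself a loss in the comparison of volumes, so it has to be known before y and x are
-- chosen.
depth : ℕ → ℕ → ℕ
depth p zero    = 0
depth p (suc d) = depth p d + (window p (pred d) (depth p d) + 3)

depth-mono : ∀ p {d D} → d ≤ D → depth p d ≤ depth p D
depth-mono p {D = zero}  z≤n = z≤n
depth-mono p {d} {suc D} d≤ with d ≟ suc D
... | yes refl = ≤-refl
... | no d≢ = ≤-trans (depth-mono p (≤-pred (≤∧≢⇒< d≤ d≢))) (m≤m+n (depth p D) _)

-- The terms in y have the surplus (δ - 1) (δ - 2). For δ = 1 and δ = 2 it vanishes, and what
-- remains is one copy of x + w + 4, from 10 p - 1 in place of 10 p; since x ≥ y there, it pays for
-- the constant losses, at most 2 p (36 + 5 w) = y.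
volume-exponent : ∀ p p′ δ w → suc p′ ≡ 10 * p → 1 ≤ p → let y = yExp p w ; x = xExp p δ w in
  (x + w + 4) * p′ < ((x + y) * δ + (x + y + (4 + y))) * (2 * p)
volume-exponent p p′ δ w p′≡ 1≤p = +-cancelˡ-< t (t * p′) (N * (2 * p)) (begin-strict
  t + t * p′             ≡⟨ trans (sym (*-suc t p′)) (cong (t *_) p′≡) ⟩
  t * (10 * p)           <⟨ key δ ⟩
  t + N * (2 * p)        ∎)
  where
  open ≤-Reasoning
  y t N : ℕ
  y = yExp p w
  t = xExp p δ w + w + 4
  N = (xExp p δ w + y) * δ + (xExp p δ w + y + (4 + y))
  key : ∀ δ → let x = (y + 5) * δ in (x + w + 4) * (10 * p) < (x + w + 4) + ((x + y) * δ + (x + y + (4 + y))) * (2 * p)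
  key zero = begin-strict
    ((y + 5) * 0 + w + 4) * (10 * p)               ≡⟨ e₁ y w p ⟩
    (5 * w + 20) * (2 * p)                         ≤⟨ *-monoˡ-≤ (2 * p) (≤-trans (≤-trans (m≤m+n _ (16 + (y + 4))) (≤-reflexive (e₂ w y)))
                                                        (+-monoˡ-≤ (y + 4) (grow′ (36 + 5 * w)))) ⟩
    (y + (y + 4)) * (2 * p)                        <⟨ m<n+m _ (s≤s (z≤n {w + 3})) ⟩
    (suc (w + 3)) + (y + (y + 4)) * (2 * p)        ≡⟨ e₃ y w p ⟩
    ((y + 5) * 0 + w + 4) + (((y + 5) * 0 + y) * 0 + ((y + 5) * 0 + y + (4 + y))) * (2 * p) ∎
    where
    e₁ : ∀ y w p → ((y + 5) * 0 + w + 4) * (10 * p) ≡ (5 * w + 20) * (2 * p)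
    e₁ = ℕ-ring
    e₂ : ∀ w y → 5 * w + 20 + (16 + (y + 4)) ≡ 36 + 5 * w + (y + 4)
    e₂ = ℕ-ring
    e₃ : ∀ y w p → (1 + (w + 3)) + (y + (y + 4)) * (2 * p) ≡
      ((y + 5) * 0 + w + 4) + (((y + 5) * 0 + y) * 0 + ((y + 5) * 0 + y + (4 + y))) * (2 * p)
    e₃ = ℕ-ring
    grow′ : ∀ n → n ≤ 2 * p * n
    grow′ n = m≤n*m n (2 * p) {{m*n≢0 2 p {{_}} {{>-nonZero 1≤p}}}}
  key (suc zero) = begin-strict
    ((y + 5) * 1 + w + 4) * (10 * p)               ≡⟨ e₁ y w p ⟩
    2 * p * (31 + 5 * w) + (5 * y + 14) * (2 * p)  ≤⟨ +-monoˡ-≤ _ (*-monoʳ-≤ (2 * p) (+-monoˡ-≤ (5 * w) (m≤m+n 31 5))) ⟩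
    y + (5 * y + 14) * (2 * p)                     <⟨ +-monoˡ-< _ (m<m+n y (s≤s (z≤n {w + 8}))) ⟩
    y + suc (w + 8) + (5 * y + 14) * (2 * p)       ≡⟨ e₂ y w p ⟩
    ((y + 5) * 1 + w + 4) + (((y + 5) * 1 + y) * 1 + ((y + 5) * 1 + y + (4 + y))) * (2 * p) ∎
    where
    e₁ : ∀ y w p → ((y + 5) * 1 + w + 4) * (10 * p) ≡ 2 * p * (31 + 5 * w) + (5 * y + 14) * (2 * p)
    e₁ = ℕ-ring
    e₂ : ∀ y w p → y + (1 + (w + 8)) + (5 * y + 14) * (2 * p) ≡
      ((y + 5) * 1 + w + 4) + (((y + 5) * 1 + y) * 1 + ((y + 5) * 1 + y + (4 + y))) * (2 * p)
    e₂ = ℕ-ring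
  key (suc (suc j)) = begin-strict
    (x + w + 4) * (10 * p)                         ≤⟨ m≤m+n _ ((y * (j * (1 + j)) + 5 * (j * j)) * (2 * p)) ⟩
    (x + w + 4) * (10 * p) + (y * (j * (1 + j)) + 5 * (j * j)) * (2 * p)
                                                   ≡⟨ e₁ y w p j ⟩
    2 * p * (36 + 5 * w) + N′ * (2 * p)            ≤⟨ +-monoˡ-≤ (N′ * (2 * p)) (≤-trans (m≤m+n y (y + 10 + (y + 5) * j)) (≤-reflexive (e₂ y j))) ⟩
    x + N′ * (2 * p)                               <⟨ +-monoˡ-< (N′ * (2 * p)) (m<m+n x (s≤s (z≤n {w + 3}))) ⟩
    x + suc (w + 3) + N′ * (2 * p)                 ≡⟨ cong (_+ N′ * (2 * p)) (e₃ x w) ⟩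
    x + w + 4 + N′ * (2 * p)                       ∎
    where
    x N′ : ℕ
    x = (y + 5) * (2 + j)
    N′ = (x + y) * (2 + j) + (x + y + (4 + y))
    e₁ : ∀ y w p j → ((y + 5) * (2 + j) + w + 4) * (10 * p) + (y * (j * (1 + j)) + 5 * (j * j)) * (2 * p) ≡
      2 * p * (36 + 5 * w) + (((y + 5) * (2 + j) + y) * (2 + j) + ((y + 5) * (2 + j) + y + (4 + y))) * (2 * p)
    e₁ = ℕ-ring
    e₂ : ∀ y j → y + (y + 10 + (y + 5) * j) ≡ (y + 5) * (2 + j)
    e₂ = ℕ-ring
    e₃ : ∀ x w → x + (1 + (w + 3)) ≡ x + w + 4
    e₃ = ℕ-ring

module Powers (h : ℕ) (160≤h : 160 ≤ h) where

  private
    instance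
      h≢0 : NonZero h
      h≢0 = >-nonZero (≤-trans (s≤s z≤n) 160≤h)

  h^4≡ : h ^ 4 ≡ h * h * h * h
  h^4≡ = trans (cong (λ z → h * (h * (h * z))) (*-identityʳ h)) (e h)
    where
    e : ∀ h → h * (h * (h * h)) ≡ h * h * h * h
    e = ℕ-ring

  h^[4+n] : ∀ n → h ^ (4 + n) ≡ h * h * h * h * h ^ n
  h^[4+n] n = trans (^-distribˡ-+-* h 4 n) (cong (_* h ^ n) h^4≡)

  h^window : ∀ p δ w → let Y = h * h * h * h * h ^ yExp p w ; Q = h * h * h * h in
    h ^ window p δ w ≡ h * h * (h ^ xExp p δ w * (Y * Y) * Q * Q * (Y * Y))
  h^window p δ w = begin
    h ^ (x + (y + y + (y + y) + 10))                              ≡⟨ ^-distribˡ-+-* h x _ ⟩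
    h ^ x * h ^ (y + y + (y + y) + 10)                            ≡⟨ cong (h ^ x *_) (trans (^-distribˡ-+-* h (y + y + (y + y)) 10) (cong (_* h ^ 10)
                                                                      (trans (^-distribˡ-+-* h (y + y) (y + y)) (cong₂ _*_ (^-distribˡ-+-* h y y) (^-distribˡ-+-* h y y))))) ⟩
    h ^ x * (h ^ y * h ^ y * (h ^ y * h ^ y) * h ^ 10)            ≡⟨ cong₂ (λ Y H → h ^ x * (Y * Y * (Y * Y) * H)) (h^[4+n] (yExp p w)) h^10 ⟩
    h ^ x * (Y * Y * (Y * Y) * (Q * Q * (h * h)))                 ≡⟨ e (h ^ x) Y Q h ⟩
    h * h * (h ^ x * (Y * Y) * Q * Q * (Y * Y))                   ∎
    where
    open ≡-Reasoning
    x y Y Q : ℕ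
    x = xExp p δ w
    y = 4 + yExp p w
    Q = h * h * h * h
    Y = Q * h ^ yExp p w
    h^10 : h ^ 10 ≡ Q * Q * (h * h)
    h^10 = trans (^-distribˡ-+-* h 8 2) (cong₂ _*_ (trans (^-distribˡ-+-* h 4 4) (cong₂ _*_ h^4≡ h^4≡)) (cong (h *_) (*-identityʳ h)))
    e : ∀ x y q h → x * (y * y * (y * y) * (q * q * (h * h))) ≡ h * h * (x * (y * y) * q * q * (y * y))
    e = ℕ-ring

  volume : ∀ p p′ δ w → suc p′ ≡ 10 * p → 1 ≤ p → Volume p p′ δ (h ^ xExp p δ w) (h ^ yExp p w) (h ^ w) (h * h * h * h)
  volume p p′ δ w p′≡ 1≤p = record { cells = cells ; volume = vol }
    where
    open ≤-Reasoning
    x y : ℕ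
    x = xExp p δ w
    y = yExp p w
    cells : suc (4 * (h * h * h * h * h ^ y)) ^ δ ≤ h ^ x
    cells = begin
      suc (4 * (h * h * h * h * h ^ y)) ^ δ      ≡⟨ cong (λ z → suc (4 * z) ^ δ) (h^[4+n] y) ⟨
      suc (4 * h ^ (4 + y)) ^ δ                  ≤⟨ ^-monoˡ-≤ δ (+-monoˡ-≤ (4 * h ^ (4 + y)) (m^n>0 h (4 + y))) ⟩
      (5 * h ^ (4 + y)) ^ δ                      ≤⟨ ^-monoˡ-≤ δ (*-monoˡ-≤ (h ^ (4 + y)) (≤-trans (m≤m+n 5 155) 160≤h)) ⟩
      (h ^ (5 + y)) ^ δ                          ≡⟨ trans (^-*-assoc h (5 + y) δ) (cong (λ z → h ^ (z * δ)) (+-comm 5 y)) ⟩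
      h ^ x                                      ∎
    lhs : h ^ x * h ^ w * (h * h * h * h) ≡ h ^ (x + w + 4)
    lhs = trans (cong₂ _*_ (sym (^-distribˡ-+-* h x w)) (sym h^4≡)) (sym (^-distribˡ-+-* h (x + w) 4))
    rhs : (h ^ x * h ^ y) ^ δ * (h ^ x * h ^ y * (h * h * h * h * h ^ y)) ≡ h ^ ((x + y) * δ + (x + y + (4 + y)))
    rhs = trans (cong₂ (λ u v → u ^ δ * (u * v)) (sym (^-distribˡ-+-* h x y)) (sym (h^[4+n] y)))
      (trans (cong₂ _*_ (^-*-assoc h (x + y) δ) (sym (^-distribˡ-+-* h (x + y) (4 + y)))) (sym (^-distribˡ-+-* h ((x + y) * δ) (x + y + (4 + y)))))
    vol : (h ^ x * h ^ w * (h * h * h * h)) ^ p′ < ((h ^ x * h ^ y) ^ δ * (h ^ x * h ^ y * (h * h * h * h * h ^ y))) ^ (2 * p)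
    vol = begin-strict
      (h ^ x * h ^ w * (h * h * h * h)) ^ p′                      ≡⟨ trans (cong (_^ p′) lhs) (^-*-assoc h (x + w + 4) p′) ⟩
      h ^ ((x + w + 4) * p′)                                      <⟨ ^-monoʳ-< h (≤-trans (s≤s (s≤s z≤n)) 160≤h) (volume-exponent p p′ δ w p′≡ 1≤p) ⟩
      h ^ (((x + y) * δ + (x + y + (4 + y))) * (2 * p))           ≡⟨ trans (cong (_^ (2 * p)) rhs) (^-*-assoc h ((x + y) * δ + (x + y + (4 + y))) (2 * p)) ⟨
      ((h ^ x * h ^ y) ^ δ * (h ^ x * h ^ y * (h * h * h * h * h ^ y))) ^ (2 * p) ∎

-- Descent on the number of generators

record Environment : Set where
  field
    {A B}           : List ℕ
    {b₀}            : ℕ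
    b₀∈             : b₀ ∈ B
    p p′ s k e α D M : ℕ

  -- h and a are powers of two so that L = a G₀ is one too, as the binary trees of differences
  -- require.
  h : ℕ
  h = 2 ^ e
  a : ℕ
  a = 2 ^ α
  n₀ : ℕ
  n₀ = a * h ^ M

  field
    p′≡    : suc p′ ≡ 10 * p
    1≤p    : 1 ≤ p
    core   : Core A B
    n₀≡    : Core.n₀ core ≡ n₀
    P≤     : length (Core.P core) ≤ suc (h * (4 * (2 * k) * h))
    R-card : (k ∸ n₀) * s ≤ length (Core.R core)
    reg    : Regular p p′ s k B
    hn₀≤k  : h * n₀ ≤ k
    k≤n₀h² : k ≤ n₀ * (h * h)
    16D≤h  : 16 * (D + 10) ≤ h
    k⁴≤    : (4 * k) ^ 4 ≤ 2 ^ h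
    s≥     : h ^ (2 * depth p (suc D)) ≤ s

module Descent (Env : Environment) where

  open Environment Env

  160≤h : 160 ≤ h
  160≤h = ≤-trans (*-monoʳ-≤ 16 (m≤n+m 10 D)) 16D≤h

  open Powers h 160≤h

  private
    instance
      a≢0 : NonZero a
      a≢0 = m^n≢0 2 α
      h≢0 : NonZero h
      h≢0 = m^n≢0 2 e

  -- d generators are left, ω = h ^ (m + 3), and M − m counts the powers of h used up below k.
  record Stage (d m C κ : ℕ) (u : Vector d) : Set where
    field
      d≤D  : d ≤ D
      m≡   : m + depth p (suc d) ≡ M
      1≤C  : 1 ≤ C
      C≤h  : 16 * C * 4 ^ d ≤ h
      κ≤   : κ * (h * h) ≤ h ^ (m + 3) * a
      u∈   : ∀ i → u i ∈ E B (2 * a)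
      span : Span B a u C κ

  module AtStage {d m C κ : ℕ} {u : Vector d} (S : Stage d m C κ u) where

    open Stage S

    w x y Λ ω J Y₁ X Z Q G₀ T : ℕ
    w = depth p d
    x = xExp p (pred d) w
    y = yExp p w
    Λ = window p (pred d) w
    ω = h ^ (m + 3)
    J = h ^ (m + 3 + Λ)
    Y₁ = h ^ y
    X = h ^ x
    Z = h ^ w
    Q = h * h * h * h
    G₀ = ω * X * (Q * Y₁ * (Q * Y₁)) * Q * Q * (Q * Y₁ * (Q * Y₁))
    T = α + e * (m + 3 + (x + ((4 + y) + (4 + y) + ((4 + y) + (4 + y)) + 8)))

    J≡ωΛ : J ≡ ω * h ^ Λ
    J≡ωΛ = ^-distribˡ-+-* h (m + 3) Λ

    J≡ : J ≡ h * h * G₀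
    J≡ = trans J≡ωΛ (trans (cong (ω *_) (h^window p (pred d) w)) (l ω h X (Q * Y₁) Q))
      where
      l : ∀ o h x y q → o * (h * h * (x * (y * y) * q * q * (y * y))) ≡ h * h * (o * x * (y * y) * q * q * (y * y))
      l = ℕ-ring

    L≡ : 2 ^ T ≡ a * G₀
    L≡ = begin
      2 ^ T                                            ≡⟨ ^-distribˡ-+-* 2 α _ ⟩
      a * 2 ^ (e * (m + 3 + t))                        ≡⟨ cong (a *_) (^-*-assoc 2 e (m + 3 + t)) ⟨
      a * h ^ (m + 3 + t)                              ≡⟨ cong (a *_) (*-cancelˡ-≡ (h ^ (m + 3 + t)) G₀ (h * h) {{m*n≢0 h h}} (trans h²· J≡)) ⟩
      a * G₀                                           ∎
      where
      open ≡-Reasoning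
      t : ℕ
      t = x + ((4 + y) + (4 + y) + ((4 + y) + (4 + y)) + 8)
      l : ∀ m x y → 2 + (m + 3 + (x + (y + y + (y + y) + 8))) ≡ m + 3 + (x + (y + y + (y + y) + 10))
      l = ℕ-ring
      h²· : h * h * h ^ (m + 3 + t) ≡ J
      h²· = trans (*-assoc h h _) (cong (h ^_) (l m x (4 + y)))

    n₀≡aJZ : n₀ ≡ a * (J * Z)
    n₀≡aJZ = cong (a *_) (trans (cong (h ^_) (trans (sym m≡) (l m w Λ))) (^-distribˡ-+-* h (m + 3 + Λ) w))
      where
      l : ∀ m w v → m + (w + (v + 3)) ≡ m + 3 + v + w
      l = ℕ-ring

    1≤^ : ∀ n → 1 ≤ h ^ n
    1≤^ = m^n>0 h

    16C≤h : 16 * C ≤ h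
    16C≤h = ≤-trans (grow (16 * C) (m^n>0 4 d)) C≤h

    4CL≤aJ : 4 * (C * 2 ^ T) ≤ a * J
    4CL≤aJ = begin
      4 * (C * 2 ^ T)        ≡⟨ cong (λ l → 4 * (C * l)) L≡ ⟩
      4 * (C * (a * G₀))     ≡⟨ l₁ C a G₀ ⟩
      a * (4 * C * G₀)       ≤⟨ *-monoʳ-≤ a (*-monoˡ-≤ G₀ (≤-trans (≤-trans (*-monoˡ-≤ C (m≤m+n 4 12)) 16C≤h) (m≤m*n h h))) ⟩
      a * (h * h * G₀)       ≡⟨ cong (a *_) J≡ ⟨
      a * J                  ∎
      where
      open ≤-Reasoning
      l₁ : ∀ c a g → 4 * (c * (a * g)) ≡ a * (4 * c * g)
      l₁ = ℕ-ring

    -- 2 ^ T = L is at most k, and h is at least the logarithm of (4 k) ^ 4. So a factor for the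
    -- number of levels costs only one power of h.
    4T≤h : 4 * (T + 2) ≤ h
    4T≤h = ≮⇒≥ λ lt → <-irrefl refl (begin-strict
      2 ^ h                     <⟨ ^-monoʳ-< 2 (s≤s (s≤s z≤n)) lt ⟩
      2 ^ (4 * (T + 2))         ≡⟨ trans (cong (2 ^_) (*-comm 4 (T + 2))) (sym (^-*-assoc 2 (T + 2) 4)) ⟩
      (2 ^ (T + 2)) ^ 4         ≡⟨ cong (_^ 4) (trans (^-distribˡ-+-* 2 T 2) (*-comm (2 ^ T) 4)) ⟩
      (4 * 2 ^ T) ^ 4           ≤⟨ ^-monoˡ-≤ 4 (*-monoʳ-≤ 4 L≤k) ⟩
      (4 * k) ^ 4               ≤⟨ k⁴≤ ⟩
      2 ^ h                     ∎)
      where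
      open ≤-Reasoning
      L≤k : 2 ^ T ≤ k
      L≤k = begin
        2 ^ T               ≡⟨ L≡ ⟩
        a * G₀              ≤⟨ *-monoʳ-≤ a (m≤n*m G₀ (h * h) {{m*n≢0 h h}}) ⟩
        a * (h * h * G₀)    ≡⟨ cong (a *_) J≡ ⟨
        a * J               ≤⟨ *-monoʳ-≤ a (grow J (1≤^ w)) ⟩
        a * (J * Z)         ≡⟨ n₀≡aJZ ⟨
        n₀                  ≤⟨ m≤n*m n₀ h ⟩
        h * n₀              ≤⟨ hn₀≤k ⟩
        k                   ∎

    enough : Q * Q * (Q * Q) * (Q * Y₁ * (Q * Y₁)) * (Z * Z) * X ≤ s
    enough = begin
      Q * Q * (Q * Q) * (Q * Y₁ * (Q * Y₁)) * (Z * Z) * X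
        ≡⟨ cong (λ v → Q * Q * (Q * Q) * (v * v) * (Z * Z) * X) (h^[4+n] y) ⟨
      Q * Q * (Q * Q) * (h ^ (4 + y) * h ^ (4 + y)) * (Z * Z) * X
        ≡⟨ cong (λ q → q * q * (q * q) * (h ^ (4 + y) * h ^ (4 + y)) * (Z * Z) * X) h^4≡ ⟨
      h ^ 4 * h ^ 4 * (h ^ 4 * h ^ 4) * (h ^ (4 + y) * h ^ (4 + y)) * (Z * Z) * X
        ≡⟨ collect ⟩
      h ^ (4 + 4 + (4 + 4) + ((4 + y) + (4 + y)) + (w + w) + x)
        ≤⟨ ^-monoʳ-≤ h (≤-trans (m≤m+n (4 + 4 + (4 + 4) + ((4 + y) + (4 + y)) + (w + w) + x) (x + 6 * (4 + y) + 10)) (≤-reflexive (l x (4 + y) w))) ⟩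
      h ^ (2 * depth p (suc d))                               ≤⟨ ^-monoʳ-≤ h (*-monoʳ-≤ 2 (depth-mono p (s≤s d≤D))) ⟩
      h ^ (2 * depth p (suc D))                               ≤⟨ s≥ ⟩
      s                                                       ∎
      where
      open ≤-Reasoning
      merge : ∀ i j {u v} → u ≡ h ^ i → v ≡ h ^ j → u * v ≡ h ^ (i + j)
      merge i j refl refl = sym (^-distribˡ-+-* h i j)
      collect : h ^ 4 * h ^ 4 * (h ^ 4 * h ^ 4) * (h ^ (4 + y) * h ^ (4 + y)) * (Z * Z) * X ≡
        h ^ (4 + 4 + (4 + 4) + ((4 + y) + (4 + y)) + (w + w) + x)
      collect = merge (4 + 4 + (4 + 4) + ((4 + y) + (4 + y)) + (w + w)) x (merge (4 + 4 + (4 + 4) + ((4 + y) + (4 + y))) (w + w)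
        (merge (4 + 4 + (4 + 4)) ((4 + y) + (4 + y)) (merge (4 + 4) (4 + 4) (merge 4 4 refl refl) (merge 4 4 refl refl))
          (merge (4 + y) (4 + y) refl refl)) (merge w w refl refl)) refl
      l : ∀ x y w → 4 + 4 + (4 + 4) + (y + y) + (w + w) + x + (x + 6 * y + 10) ≡ 2 * (w + (x + (y + y + (y + y) + 10) + 3))
      l = ℕ-ring

    conclude : IndependentUpTo B u κ J ω → ⊥
    conclude independent = finish 𝓕 Sc core (trans n₀≡ n₀≡aJZ) P≤ (subst (λ n → (k ∸ n) * s ≤ length (Core.R core)) n₀≡aJZ R-card) reg
        (volume p p′ (pred d) w p′≡ 1≤p)
      where
      ξs : ∃[ ξ ] Coordinates B b₀ a u C κ T ξ
      ξs = coordinates {a = a} {C = C} b₀∈ span T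
      𝓕 : Frame d
      𝓕 = record { B = B ; b₀∈ = b₀∈ ; a = a ; C = C ; κ = κ ; J = J ; ω = ω ; T = T ; u = u ; u∈ = u∈ ; span = span
                 ; independent = independent ; 4CL≤aJ = 4CL≤aJ ; ξ = proj₁ ξs ; ξ-spec = proj₂ ξs }
      Sc : Scales 𝓕 k s h
      Sc = record { X = X ; Y₁ = Y₁ ; Z = Z ; 1≤X = 1≤^ x ; 1≤Y₁ = 1≤^ y ; 1≤Z = 1≤^ w ; 1≤ω = 1≤^ (m + 3)
                  ; 16d≤h = ≤-trans (*-monoʳ-≤ 16 (+-monoˡ-≤ 10 d≤D)) 16D≤h ; 16C≤h = 16C≤h ; 4T≤h = 4T≤h ; κ≤ = κ≤
                  ; J≡ = J≡ ; L≡ = L≡ ; hn₀≤k = subst (λ n → h * n ≤ k) n₀≡aJZ hn₀≤k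
                  ; k≤n₀h² = subst (λ n → k ≤ n * (h * h)) n₀≡aJZ k≤n₀h² ; s≥ = enough }

    ω≤J : ω ≤ J
    ω≤J = ≤-trans (grow ω (1≤^ Λ)) (≤-reflexive (sym J≡ωΛ))

    κ≤aω : κ ≤ a * ω
    κ≤aω = ≤-trans (m≤m*n κ (h * h) {{m*n≢0 h h}}) (≤-trans κ≤ (≤-reflexive (*-comm ω a)))

    32Cκ≤ωa : 32 * C * κ ≤ ω * a
    32Cκ≤ωa = begin
      32 * C * κ        ≡⟨ l₁ C κ ⟩
      2 * (16 * C) * κ  ≤⟨ *-monoˡ-≤ κ (*-mono-≤ (≤-trans (s≤s (s≤s z≤n)) 160≤h) 16C≤h) ⟩
      h * h * κ         ≡⟨ *-comm (h * h) κ ⟩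
      κ * (h * h)       ≤⟨ κ≤ ⟩
      ω * a             ∎
      where
      open ≤-Reasoning
      l₁ : ∀ c k → 32 * c * k ≡ 2 * (16 * c) * k
      l₁ = ℕ-ring

    -- The new error has order J a, the entire range of this stage, so the next ω is J h ^ 3.
    κ′≤ : 4 * (2 * J * a + κ) * (h * h) ≤ h ^ (m + (Λ + 3) + 3) * a
    κ′≤ = begin
      4 * (2 * J * a + κ) * (h * h)        ≤⟨ *-monoˡ-≤ (h * h) (*-monoʳ-≤ 4 (+-monoʳ-≤ (2 * J * a) (≤-trans κ≤aω (*-monoʳ-≤ a ω≤J)))) ⟩
      4 * (2 * J * a + a * J) * (h * h)    ≡⟨ l₁ J a h ⟩
      12 * (J * a * (h * h))               ≤⟨ *-monoˡ-≤ (J * a * (h * h)) (≤-trans (m≤m+n 12 148) 160≤h) ⟩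
      h * (J * a * (h * h))                ≡⟨ l₂ h J a ⟩
      J * (h * (h * (h * 1))) * a          ≡⟨ cong (_* a) (^-distribˡ-+-* h (m + 3 + Λ) 3) ⟨
      h ^ (m + 3 + Λ + 3) * a              ≡⟨ cong (λ n → h ^ n * a) (l₃ m Λ) ⟩
      h ^ (m + (Λ + 3) + 3) * a            ∎
      where
      open ≤-Reasoning
      l₁ : ∀ j a h → 4 * (2 * j * a + a * j) * (h * h) ≡ 12 * (j * a * (h * h))
      l₁ = ℕ-ring
      l₂ : ∀ h j a → h * (j * a * (h * h)) ≡ j * (h * (h * (h * 1))) * a
      l₂ = ℕ-ring
      l₃ : ∀ m v → m + 3 + v + 3 ≡ m + (v + 3) + 3
      l₃ = ℕ-ring

  next-stage : ∀ {d m C κ u} (S : Stage (suc d) m C κ u) i →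
    Span B a (u ∘ punchIn i) (4 * C) (4 * (2 * AtStage.J S * a + κ)) →
    Stage d (m + (window p d (depth p (suc d)) + 3)) (4 * C) (4 * (2 * AtStage.J S * a + κ)) (u ∘ punchIn i)
  next-stage {d} {m} {C} {κ} {u} S i span = record
    { d≤D = ≤-trans (n≤1+n d) (Stage.d≤D S) ; m≡ = trans (l₁ m _ (depth p (suc d))) (Stage.m≡ S)
    ; 1≤C = ≤-trans (Stage.1≤C S) (m≤n*m C 4) ; C≤h = ≤-trans (≤-reflexive (l₂ C (4 ^ d))) (Stage.C≤h S)
    ; κ≤ = AtStage.κ′≤ S ; u∈ = Stage.u∈ S ∘ punchIn i ; span = span }
    where
    l₁ : ∀ m v w → m + v + w ≡ m + (w + v)
    l₁ = ℕ-ring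
    l₂ : ∀ c f → 16 * (4 * c) * f ≡ 16 * c * (4 * f)
    l₂ = ℕ-ring

  descend : ∀ d {m C κ u} → Stage d m C κ u → ⊥
  descend zero    S = AtStage.conclude S λ _ _ _ ()
  descend (suc d) S = AtStage.conclude S (independent-or-eliminate b₀∈ (AtStage.J S) (AtStage.ω S) {{>-nonZero (Stage.1≤C S)}}
    (Stage.span S) (Stage.u∈ S) (AtStage.32Cκ≤ωa S) λ i span → descend d (next-stage S i span))

-- Large regular sets do not exist

n<2^n : ∀ n → n < 2 ^ n
n<2^n zero    = s≤s z≤n
n<2^n (suc n) = ≤-trans (+-mono-≤ (m^n>0 2 n) (n<2^n n)) (≤-reflexive (cong (λ z → 2 ^ n + z) (sym (+-identityʳ (2 ^ n)))))

n<b^n : ∀ {b} → 2 ≤ b → ∀ n → n < b ^ n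
n<b^n 2≤b n = <-≤-trans (n<2^n n) (^-monoˡ-≤ n 2≤b)

last-below : ∀ (f : ℕ → ℕ) n fuel → f 0 ≤ n → n < f fuel → ∃[ j ] f j ≤ n × n < f (suc j)
last-below f n fuel lo hi = search fuel 0 lo hi
  where
  search : ∀ fuel j → f j ≤ n → n < f (j + fuel) → ∃[ j ] f j ≤ n × n < f (suc j)
  search zero       j lo hi = contradiction (≤-<-trans lo (subst (λ i → n < f i) (+-identityʳ j) hi)) (<-irrefl refl)
  search (suc fuel) j lo hi with n <? f (suc j)
  ... | yes lt = j , lo , lt
  ... | no ¬lt = search fuel (suc j) (≮⇒≥ ¬lt) (subst (λ i → n < f i) (+-suc j fuel) hi)

log : ∀ c b k → 1 ≤ c → 2 ≤ b → c ≤ k → ∃[ j ] c * b ^ j ≤ k × k < c * b ^ suc j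
log c b k 1≤c 2≤b c≤k = last-below (λ j → c * b ^ j) k k (≤-trans (≤-reflexive (*-identityʳ c)) c≤k)
  (<-≤-trans (n<b^n 2≤b k) (m≤n*m (b ^ k) c {{>-nonZero 1≤c}}))

^-cancel-≤ : ∀ {m n} k → 1 ≤ k → m ^ k ≤ n ^ k → m ≤ n
^-cancel-≤ {m} {n} k 1≤k le with m ≤? n
... | yes p = p
... | no ¬p = contradiction le (<⇒≱ (^-monoˡ-< k {{>-nonZero 1≤k}} (≰⇒> ¬p)))

module _ {B : List ℕ} {b₀ : ℕ} (b₀∈ : b₀ ∈ B) (D : ℕ) where

  slow-or-fast : ∀ J → (∃[ j ] j < J × length (E B (8 * 8 ^ j)) < D * length (E B (8 ^ j))) ⊎ D ^ J ≤ length (E B (8 ^ J))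
  slow-or-fast zero = inj₂ (E-nonempty b₀∈ 1)
  slow-or-fast (suc J) with slow-or-fast J
  ... | inj₁ (j , j<J , slow) = inj₁ (j , m<n⇒m<1+n j<J , slow)
  ... | inj₂ fast with length (E B (8 * 8 ^ J)) <? D * length (E B (8 ^ J))
  ... | yes slow = inj₁ (J , n<1+n J , slow)
  ... | no ¬slow = inj₂ (≤-trans (*-monoʳ-≤ D fast) (≮⇒≥ ¬slow))

  -- If every step from 8 ^ j to 8 ^ (j + 1) up to about √k multiplied the size by D, the bound k ^
  -- 5 would be exceeded. With i + 1 steps k ^ 5 < 8 ^ (20 + 10 i), whence the exponent 21. Stopping
  -- at √k leaves many powers of h between the scale and k.
  slow-scale : 8 ^ 21 ≤ D → ∀ k → 64 ≤ k → length (E B k) ≤ k ^ 5 →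
    ∃[ j ] 64 * 64 ^ j ≤ k × length (E B (8 * 8 ^ j)) < D * length (E B (8 ^ j))
  slow-scale 8^21≤D k 64≤k small = pick (log 64 64 k (s≤s z≤n) (s≤s (s≤s z≤n)) 64≤k)
    where
    open ≤-Reasoning
    pick : ∃[ i ] 64 * 64 ^ i ≤ k × k < 64 * 64 ^ suc i → ∃[ j ] 64 * 64 ^ j ≤ k × length (E B (8 * 8 ^ j)) < D * length (E B (8 ^ j))
    pick (i , lo , hi) with slow-or-fast (suc i)
    ... | inj₁ (j , j<J , slow) = j , ≤-trans (*-monoʳ-≤ 64 (^-monoʳ-≤ 64 (≤-pred j<J))) lo , slow
    ... | inj₂ fast = contradiction (begin-strict
      k ^ 5                          <⟨ ^-monoˡ-< 5 hi ⟩
      (64 ^ (2 + i)) ^ 5             ≡⟨ trans (^-*-assoc 64 (2 + i) 5) (trans (^-*-assoc 8 2 ((2 + i) * 5)) refl) ⟩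
      8 ^ (2 * ((2 + i) * 5))        ≤⟨ ^-monoʳ-≤ 8 (≤-trans (m≤m+n (2 * ((2 + i) * 5)) (1 + 11 * i)) (≤-reflexive (e i))) ⟩
      8 ^ (21 * suc i)               ≡⟨ ^-*-assoc 8 21 (suc i) ⟨
      (8 ^ 21) ^ suc i               ≤⟨ ^-monoˡ-≤ (suc i) 8^21≤D ⟩
      D ^ suc i                      ≤⟨ fast ⟩
      length (E B (8 ^ suc i))       ≤⟨ length-⊆ (E-unique (8 ^ suc i)) (E-mono b₀∈ (≤-trans (^-monoˡ-≤ (suc i) (m≤m+n 8 56)) lo)) ⟩
      length (E B k)                 ≤⟨ small ⟩
      k ^ 5                          ∎) (<-irrefl refl)
      where
      e : ∀ i → 2 * ((2 + i) * 5) + (1 + 11 * i) ≡ 21 * (1 + i)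
      e = ℕ-ring

quartic-bound : ∀ N n H → n < N → (4 * N) ^ 4 ≤ H → suc (N * n + N * n) < H
quartic-bound N n H n<N le = begin-strict
  suc (N * n + N * n)       ≤⟨ s≤s (+-mono-≤ (*-monoʳ-≤ N (<⇒≤ n<N)) (*-monoʳ-≤ N (<⇒≤ n<N))) ⟩
  suc (K + K)               <⟨ n<1+n (suc (K + K)) ⟩
  1 + 1 + (K + K)           ≤⟨ +-monoˡ-≤ (K + K) (+-mono-≤ 1≤K 1≤K) ⟩
  K + K + (K + K)           ≡⟨ e₁ K ⟩
  4 * K                     ≤⟨ *-mono-≤ (m≤m+n 4 252) (m≤m*n K K {{>-nonZero 1≤K}}) ⟩
  256 * (K * K)             ≡⟨ e₂ N ⟩
  (4 * N) ^ 4               ≤⟨ le ⟩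
  H                         ∎
  where
  open ≤-Reasoning
  K : ℕ
  K = N * N
  1≤N : 1 ≤ N
  1≤N = ≤-trans (s≤s z≤n) n<N
  1≤K : 1 ≤ K
  1≤K = *-mono-≤ 1≤N 1≤N
  e₁ : ∀ k → k + k + (k + k) ≡ 4 * k
  e₁ = ℕ-ring
  e₂ : ∀ m → 256 * (m * m * (m * m)) ≡ 4 * m * (4 * m * (4 * m * (4 * m * 1)))
  e₂ = ℕ-ring

record Large (p p′ e D n : ℕ) : Set where
  h : ℕ
  h = 2 ^ e
  W : ℕ
  W = depth p (suc D)
  -- h ^ (2 W) supplies the walk, and h ^ 5 makes the pairs used for absorption few compared with n₀
  -- s.
  s : ℕ
  s = h ^ (2 * W + 5)
  -- U ≤ k ^ p′ ≤ k ^ (10 p) forces k ≥ h ^ (2 W + 2). As a a ≤ k, at least W powers of h then fit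
  -- between a and k.
  U : ℕ
  U = (h ^ (2 * W + 2)) ^ (10 * p)

  field
    p′≡    : suc p′ ≡ 10 * p
    1≤p    : 1 ≤ p
    8^21≤D : 8 ^ 21 ≤ D
    16D≤h  : 16 * (D + 10) ≤ h
    4^D≤h  : 16 * 4 ^ D ≤ h
    n⁴≤    : (4 * suc n) ^ 4 ≤ 2 ^ h

module NoRegular {p p′ e D n : ℕ} (Lg : Large p p′ e D n) {k : ℕ} {A B : List ℕ} (1≤k : 1 ≤ k)
  (reg : Regular p p′ (Large.s Lg) k B) (bound : length (E B k) ^ (2 * p) * Large.U Lg ≤ k ^ p′)
  (nonavg : NonAveraging A) (A-uniq : Unique A) (B⊆A : ∀ {b} → b ∈ B → b ∈ A) (A≤n : ∀ {b} → b ∈ A → b ≤ n) where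

  open Large Lg
  open Regular reg

  private
    160≤h : 160 ≤ h
    160≤h = ≤-trans (*-monoʳ-≤ 16 (m≤n+m 10 D)) 16D≤h
    instance
      h≢0 : NonZero h
      h≢0 = m^n≢0 2 e
      k≢0 : NonZero k
      k≢0 = >-nonZero 1≤k

    1≤s : 1 ≤ s
    1≤s = m^n>0 h (2 * W + 5)

    b₀ : ∃[ b ] b ∈ B
    b₀ = inhabitant B (≤-trans (1≤* 1≤k 1≤s) (≤-reflexive (sym card)))

    b₀∈ : proj₁ b₀ ∈ B
    b₀∈ = proj₂ b₀

    k^p′≤ : k ^ p′ ≤ k ^ (10 * p)
    k^p′≤ = ^-monoʳ-≤ k (≤-trans (n≤1+n p′) (≤-reflexive p′≡))

    E≤k^5 : length (E B k) ≤ k ^ 5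
    E≤k^5 = ^-cancel-≤ (2 * p) (≤-trans 1≤p (m≤n*m p 2)) (begin
      length (E B k) ^ (2 * p)            ≤⟨ m≤m*n _ U {{m^n≢0 (h ^ (2 * W + 2)) (10 * p) {{m^n≢0 h (2 * W + 2)}}}} ⟩
      length (E B k) ^ (2 * p) * U        ≤⟨ ≤-trans bound k^p′≤ ⟩
      k ^ (10 * p)                        ≡⟨ cong (k ^_) (e₁ p) ⟩
      k ^ (5 * (2 * p))                   ≡⟨ ^-*-assoc k 5 (2 * p) ⟨
      (k ^ 5) ^ (2 * p)                   ∎)
      where
      open ≤-Reasoning
      e₁ : ∀ p → 10 * p ≡ 5 * (2 * p)
      e₁ = ℕ-ring

    large-k : h ^ (2 * W + 2) ≤ k
    large-k = ^-cancel-≤ (10 * p) (≤-trans 1≤p (m≤n*m p 10)) (≤-trans (≤-trans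
      (m≤n*m U (length (E B k) ^ (2 * p)) {{m^n≢0 (length (E B k)) (2 * p) {{>-nonZero (E-nonempty b₀∈ k)}}}}) bound) k^p′≤)

    hh≤k : h * h ≤ k
    hh≤k = ≤-trans (≤-trans (≤-reflexive (cong (h *_) (sym (*-identityʳ h)))) (^-monoʳ-≤ h (m≤n+m 2 (2 * W)))) large-k

    64≤k : 64 ≤ k
    64≤k = ≤-trans (≤-trans (m≤m+n 64 96) 160≤h) (≤-trans (m≤m*n h h) hh≤k)

    k≤sn : k ≤ suc n
    k≤sn = ≤-trans (m≤m*n k s {{m^n≢0 h (2 * W + 5)}}) (≤-trans (≤-reflexive (sym card))
      (subst (length B ≤_) (length-upTo (suc n)) (length-⊆ uniq (λ b∈ → ∈-upTo⁺ (s≤s (A≤n (B⊆A b∈)))))))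

  module AtScale (j : ℕ) (64^≤k : 64 * 64 ^ j ≤ k) where

    r α a : ℕ
    r = 8 ^ j
    α = suc (3 * j)
    a = 2 ^ α

    r+r≡a : r + r ≡ a
    r+r≡a = trans (cong (λ z → z + z) (^-*-assoc 2 3 j)) (cong (λ z → 2 ^ (3 * j) + z) (sym (+-identityʳ (2 ^ (3 * j)))))

    aa≤k : a * a ≤ k
    aa≤k = begin
      a * a                  ≡⟨ cong (λ z → z * z) r+r≡a ⟨
      (r + r) * (r + r)      ≡⟨ e₁ r ⟩
      4 * (r * r)            ≡⟨ cong (4 *_) (^-distribʳ-* 8 8 j) ⟨
      4 * 64 ^ j             ≤⟨ *-monoˡ-≤ (64 ^ j) (m≤m+n 4 60) ⟩
      64 * 64 ^ j            ≤⟨ 64^≤k ⟩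
      k                      ∎
      where
      open ≤-Reasoning
      e₁ : ∀ r → (r + r) * (r + r) ≡ 4 * (r * r)
      e₁ = ℕ-ring

    ah≤k : a * h ≤ k
    ah≤k = square-cancel (a * h) k (≤-trans (≤-reflexive (e₁ a h)) (*-mono-≤ aa≤k hh≤k))
      where
      e₁ : ∀ a h → a * h * (a * h) ≡ a * a * (h * h)
      e₁ = ℕ-ring

    module AtHeight (M : ℕ) (lo : a * h * h ^ M ≤ k) (hi : k < a * h * h ^ suc M) where

      n₀ : ℕ
      n₀ = a * h ^ M

      hn₀≤k : h * n₀ ≤ k
      hn₀≤k = ≤-trans (≤-reflexive (e₁ h a (h ^ M))) lo
        where
        e₁ : ∀ h a m → h * (a * m) ≡ a * h * m
        e₁ = ℕ-ring

      k≤n₀h² : k ≤ n₀ * (h * h)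
      k≤n₀h² = ≤-trans (<⇒≤ hi) (≤-reflexive (e₁ h a (h ^ M)))
        where
        e₁ : ∀ h a m → a * h * (h * m) ≡ a * m * (h * h)
        e₁ = ℕ-ring

      W≤M : W ≤ M
      W≤M = ≮⇒≥ λ M<W → <-irrefl refl (<-≤-trans (*-cancelˡ-< k k (h ^ (2 * W + 2)) (begin-strict
        k * k                                               <⟨ *-mono-< hi hi ⟩
        a * h * h ^ suc M * (a * h * h ^ suc M)             ≤⟨ *-mono-≤ (*-monoʳ-≤ (a * h) (^-monoʳ-≤ h M<W)) (*-monoʳ-≤ (a * h) (^-monoʳ-≤ h M<W)) ⟩
        a * h * h ^ W * (a * h * h ^ W)                     ≡⟨ e₁ a h (h ^ W) ⟩
        a * a * (h ^ W * h ^ W * (h * (h * 1)))             ≤⟨ *-monoˡ-≤ _ aa≤k ⟩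
        k * (h ^ W * h ^ W * (h * (h * 1)))                 ≡⟨ cong (k *_) powers ⟩
        k * h ^ (2 * W + 2)                                 ∎)) large-k)
        where
        open ≤-Reasoning
        e₁ : ∀ a h w → a * h * w * (a * h * w) ≡ a * a * (w * w * (h * (h * 1)))
        e₁ = ℕ-ring
        powers : h ^ W * h ^ W * (h * (h * 1)) ≡ h ^ (2 * W + 2)
        powers = trans (cong (_* h ^ 2) (trans (sym (^-distribˡ-+-* h W W)) (cong (λ z → h ^ (W + z)) (sym (+-identityʳ W))))) (sym (^-distribˡ-+-* h (2 * W) 2))

      core-bounds : CoreBounds p p′ s k h n n₀
      core-bounds = record
        { p′≡ = p′≡ ; 1≤p = 1≤p ; 1≤k = 1≤k ; 1≤n₀ = 1≤n₀
        ; 80n₀≤k = ≤-trans (*-monoˡ-≤ n₀ (≤-trans (m≤m+n 80 80) 160≤h)) hn₀≤k ; small = quartic-bound (suc n) n (2 ^ h) (n<1+n n) n⁴≤ ; room = room }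
        where
        open ≤-Reasoning
        1≤n₀ : 1 ≤ n₀
        1≤n₀ = 1≤* (m^n>0 2 α) (m^n>0 h M)
        room : 2 * suc (h * (4 * (2 * k) * h)) ≤ n₀ * s
        room = begin
          2 * suc (h * (4 * (2 * k) * h))                  ≤⟨ *-monoʳ-≤ 2 (+-monoˡ-≤ (h * (4 * (2 * k) * h)) (1≤* 1≤k (1≤* (>-nonZero⁻¹ h) (>-nonZero⁻¹ h)))) ⟩
          2 * (k * (h * h) + h * (4 * (2 * k) * h))        ≡⟨ e₁ k h ⟩
          18 * (k * (h * h))                               ≤⟨ *-mono-≤ (≤-trans (m≤m+n 18 142) 160≤h) (*-monoˡ-≤ (h * h) k≤n₀h²) ⟩
          h * (n₀ * (h * h) * (h * h))                     ≡⟨ e₂ h n₀ ⟩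
          n₀ * h ^ 5                                       ≤⟨ *-monoʳ-≤ n₀ (^-monoʳ-≤ h (m≤n+m 5 (2 * W))) ⟩
          n₀ * s                                           ∎
          where
          e₁ : ∀ k h → 2 * (k * (h * h) + h * (4 * (2 * k) * h)) ≡ 18 * (k * (h * h))
          e₁ = ℕ-ring
          e₂ : ∀ h n → h * (n * (h * h) * (h * h)) ≡ n * (h * (h * (h * (h * (h * 1)))))
          e₂ = ℕ-ring

      module WithCore (core : Core A B) (n₀≡ : Core.n₀ core ≡ n₀) (P≤ : length (Core.P core) ≤ suc (h * (4 * (2 * k) * h)))
        (R-card : (k ∸ n₀) * s ≤ length (Core.R core)) where

        env : Environment
        env = record
          { b₀∈ = b₀∈ ; p = p ; p′ = p′ ; s = s ; k = k ; e = e ; α = α ; D = D ; M = M ; p′≡ = p′≡ ; 1≤p = 1≤p ; core = core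
          ; n₀≡ = n₀≡ ; P≤ = P≤ ; R-card = R-card ; reg = reg ; hn₀≤k = hn₀≤k ; k≤n₀h² = k≤n₀h² ; 16D≤h = 16D≤h
          ; k⁴≤ = ≤-trans (^-monoˡ-≤ 4 (*-monoʳ-≤ 4 k≤sn)) n⁴≤ ; s≥ = ^-monoʳ-≤ h (m≤m+n (2 * W) 5) }

        stage : ∀ {d} {u : Vector d} → d ≤ D → (∀ i → u i ∈ E B (2 * a)) → Span B a u 1 a →
          Descent.Stage env d (M ∸ depth p (suc d)) 1 a u
        stage {d} d≤D u∈ span = record
          { d≤D = d≤D ; m≡ = m∸n+n≡m (≤-trans (depth-mono p (s≤s d≤D)) W≤M) ; 1≤C = ≤-refl
          ; C≤h = ≤-trans (*-monoʳ-≤ 16 (^-monoʳ-≤ 4 d≤D)) 4^D≤h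
          ; κ≤ = ≤-trans (≤-reflexive (trans (*-comm a (h * h)) (cong (λ z → h * z * a) (sym (*-identityʳ h)))))
                   (*-monoˡ-≤ a (^-monoʳ-≤ h (≤-trans (n≤1+n 2) (m≤n+m 3 (M ∸ depth p (suc d))))))
          ; u∈ = u∈ ; span = span }

        contradict : ∀ {d} {u : Vector d} → d ≤ D → (∀ i → u i ∈ E B (2 * a)) → Span B a u 1 a → ⊥
        contradict {d} d≤D u∈ span = Descent.descend env d (stage d≤D u∈ span)

      Contradiction : Set
      Contradiction = ∀ {d} {u : Vector d} → d ≤ D → (∀ i → u i ∈ E B (2 * a)) → Span B a u 1 a → ⊥

      spanning : length (E B (8 * r)) < D * length (E B r) →
        (∃[ d ] Σ (Vector d) λ u → d * length (E B r) ≤ length (E B (8 * r)) × (∀ i → u i ∈ E B (2 * (r + r))) × Span B (r + r) u 1 (r + r)) →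
        Contradiction → ⊥
      spanning slow (d , u , few , u∈ , span) k = k {d} {u} (<⇒≤ (*-cancelʳ-< (length (E B r)) d D (≤-<-trans few slow)))
        (λ i → subst (λ a → u i ∈ E B (2 * a)) r+r≡a (u∈ i)) (subst (λ a → Span B a u 1 a) r+r≡a span)

      at-height : length (E B (8 * r)) < D * length (E B r) → ⊥
      at-height slow = core-exists core-bounds reg nonavg A-uniq B⊆A A≤n λ core n₀≡ P≤ R-card →
        spanning slow (initial-span B r {{m^n≢0 8 j}} b₀∈) (WithCore.contradict core n₀≡ P≤ R-card)

    at-scale : length (E B (8 * r)) < D * length (E B r) → ⊥
    at-scale slow = from-log (log (a * h) h k (1≤* (m^n>0 2 α) (>-nonZero⁻¹ h)) (≤-trans (s≤s (s≤s z≤n)) 160≤h) ah≤k)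
      where
      from-log : ∃[ M ] a * h * h ^ M ≤ k × k < a * h * h ^ suc M → ⊥
      from-log (M , lo , hi) = AtHeight.at-height M lo hi slow

  no-regular : ⊥
  no-regular = from-scale (slow-scale b₀∈ D 8^21≤D k 64≤k E≤k^5)
    where
    from-scale : ∃[ j ] 64 * 64 ^ j ≤ k × length (E B (8 * 8 ^ j)) < D * length (E B (8 ^ j)) → ⊥
    from-scale (j , 64^≤k , slow) = AtScale.at-scale j 64^≤k slow

-- The upper bound

-- Collects the powers of h in (2 s V₀) ^ 4, with 3 bounded by h and 2 s by h ^ i. The result does
-- not depend on n.
growth : ℕ → ℕ → ℕ
growth p D = (i + (2 * p + i * (8 * p) + (2 * W + 2) * (10 * p))) * 4
  where
  W i : ℕ
  W = depth p (suc D)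
  i = 1 + (2 * W + 5)

module _ {p p′ t e D n : ℕ} (Lg : Large p p′ e D n) (t≡ : suc t ≡ 4 * p) where

  open Large Lg

  private
    instance
      h≢0 : NonZero h
      h≢0 = m^n≢0 2 e

    1≤s : 1 ≤ s
    1≤s = m^n>0 h (2 * W + 5)

    1≤U : 1 ≤ U
    1≤U = m^n>0 (h ^ (2 * W + 2)) {{m^n≢0 h (2 * W + 2)}} (10 * p)

  V₀ : ℕ
  V₀ = 3 ^ (2 * p) * (2 * s) ^ (8 * p) * U

  private
    1≤2s : 1 ≤ 2 * s
    1≤2s = 1≤* {2} (s≤s z≤n) 1≤s

    1≤V₀ : 1 ≤ V₀
    1≤V₀ = 1≤* (1≤* (m^n>0 3 (2 * p)) (m^n>0 (2 * s) {{>-nonZero 1≤2s}} (8 * p))) 1≤U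

    p′≡′ : p′ ≡ 2 * p + (2 * t + 1)
    p′≡′ = suc-injective (trans p′≡ (trans (e₁ p) (trans (cong (λ z → 2 * p + 2 * z) (sym t≡)) (e₂ p t))))
      where
      e₁ : ∀ p → 10 * p ≡ 2 * p + 2 * (4 * p)
      e₁ = ℕ-ring
      e₂ : ∀ p t → 2 * p + 2 * (1 + t) ≡ 1 + (2 * p + (2 * t + 1))
      e₂ = ℕ-ring

  -- The exponent splits as p′ = 2 p + 2 t + 1: k₀ ^ (2 p) comes from |E B₀ k₀| ≤ 3 k₀ n, k₀ ^ (2 t)
  -- from n ^ (2 p), and the last factor k₀ ≥ V₀ absorbs all constants, all powers of s, and U.
  no-large-set : ∀ {A} → Unique A → (∀ {b} → b ∈ A → b ≤ n) → NonAveraging A → 1 ≤ length A → n ^ p ≤ length A ^ t →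
    (2 * s * V₀) ^ 4 < n → ⊥
  no-large-set {A} uA A≤n nonavg 1≤A n^p≤ V₀<n = regular-exists p p′ s U A k₀ B₀ 1≤k₀ (Unique.take⁺ (k₀ * s) uA) B₀⊆A B₀-card bound
      λ k B 1≤k reg B⊆A bd → NoRegular.no-regular Lg 1≤k reg bd nonavg uA B⊆A A≤n
    where
    open ≤-Reasoning
    instance
      s≢0 : NonZero s
      s≢0 = >-nonZero 1≤s
    N k₀ : ℕ
    N  = length A
    k₀ = N / s
    B₀ : List ℕ
    B₀ = take (k₀ * s) A
    B₀⊆A : ∀ {b} → b ∈ B₀ → b ∈ A
    B₀⊆A {b} b∈ = subst (b ∈_) (take++drop≡id (k₀ * s) A) (∈-++⁺ˡ b∈)
    B₀-card : length B₀ ≡ k₀ * s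
    B₀-card = trans (length-take (k₀ * s) A) (m≤n⇒m⊓n≡m (m/n*n≤m N s))
    N<[1+k₀]s : N < suc k₀ * s
    N<[1+k₀]s = subst (_< suc k₀ * s) (sym (m≡m%n+[m/n]*n N s)) (+-monoˡ-< (k₀ * s) (m%n<n N s))
    n≤N⁴ : n ≤ N ^ 4
    n≤N⁴ = ^-cancel-≤ p 1≤p (begin
      n ^ p             ≤⟨ n^p≤ ⟩
      N ^ t             ≤⟨ m≤n*m (N ^ t) N {{>-nonZero 1≤A}} ⟩
      N ^ suc t         ≡⟨ trans (cong (N ^_) t≡) (sym (^-*-assoc N 4 p)) ⟩
      (N ^ 4) ^ p       ∎)
    V₀≤k₀ : V₀ ≤ k₀
    V₀≤k₀ = ≮⇒≥ λ k₀<V₀ → <-irrefl refl (begin-strict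
      n                    ≤⟨ n≤N⁴ ⟩
      N ^ 4                ≤⟨ ^-monoˡ-≤ 4 (begin
        N                    ≤⟨ <⇒≤ N<[1+k₀]s ⟩
        suc k₀ * s           ≤⟨ *-monoˡ-≤ s k₀<V₀ ⟩
        V₀ * s               ≡⟨ *-comm V₀ s ⟩
        s * V₀               ≤⟨ *-monoˡ-≤ V₀ (m≤n*m s 2) ⟩
        2 * s * V₀           ∎) ⟩
      (2 * s * V₀) ^ 4     <⟨ V₀<n ⟩
      n                    ∎)
    1≤k₀ : 1 ≤ k₀
    1≤k₀ = ≤-trans 1≤V₀ V₀≤k₀
    1≤n : 1 ≤ n
    1≤n = ≤-trans (s≤s z≤n) V₀<n
    N≤2sk₀ : N ≤ 2 * s * k₀
    N≤2sk₀ = begin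
      N                  ≤⟨ <⇒≤ N<[1+k₀]s ⟩
      s + k₀ * s         ≤⟨ +-monoˡ-≤ (k₀ * s) (m≤n*m s k₀ {{>-nonZero 1≤k₀}}) ⟩
      k₀ * s + k₀ * s    ≡⟨ l k₀ s ⟩
      2 * s * k₀         ∎
      where
      l : ∀ k s → k * s + k * s ≡ 2 * s * k
      l = ℕ-ring
    n^2p≤ : n ^ (2 * p) ≤ (2 * s) ^ (8 * p) * k₀ ^ (2 * t)
    n^2p≤ = begin
      n ^ (2 * p)                                ≡⟨ trans (cong (n ^_) (*-comm 2 p)) (sym (^-*-assoc n p 2)) ⟩
      (n ^ p) ^ 2                                ≤⟨ ^-monoˡ-≤ 2 n^p≤ ⟩
      (N ^ t) ^ 2                                ≡⟨ trans (^-*-assoc N t 2) (cong (N ^_) (*-comm t 2)) ⟩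
      N ^ (2 * t)                                ≤⟨ ^-monoˡ-≤ (2 * t) N≤2sk₀ ⟩
      (2 * s * k₀) ^ (2 * t)                     ≡⟨ ^-distribʳ-* (2 * s) k₀ (2 * t) ⟩
      (2 * s) ^ (2 * t) * k₀ ^ (2 * t)           ≤⟨ *-monoˡ-≤ (k₀ ^ (2 * t)) (^-monoʳ-≤ (2 * s) {{>-nonZero 1≤2s}} 2t≤8p) ⟩
      (2 * s) ^ (8 * p) * k₀ ^ (2 * t)           ∎
      where
      2t≤8p : 2 * t ≤ 8 * p
      2t≤8p = ≤-trans (*-monoʳ-≤ 2 (≤-trans (n≤1+n t) (≤-reflexive t≡))) (≤-reflexive (sym (*-assoc 2 4 p)))
    card≤ : length (E B₀ k₀) ≤ 3 * k₀ * n
    card≤ = ≤-trans (E-card-bound (A≤n ∘ B₀⊆A) k₀) (≤-trans (+-monoˡ-≤ (k₀ * n + k₀ * n) (1≤* 1≤k₀ 1≤n)) (≤-reflexive (l k₀ n)))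
      where
      l : ∀ k n → k * n + (k * n + k * n) ≡ 3 * k * n
      l = ℕ-ring
    bound : length (E B₀ k₀) ^ (2 * p) * U ≤ k₀ ^ p′
    bound = begin
      length (E B₀ k₀) ^ (2 * p) * U
        ≤⟨ *-monoˡ-≤ U (^-monoˡ-≤ (2 * p) card≤) ⟩
      (3 * k₀ * n) ^ (2 * p) * U
        ≡⟨ cong (_* U) (trans (^-distribʳ-* (3 * k₀) n (2 * p)) (cong (_* n ^ (2 * p)) (^-distribʳ-* 3 k₀ (2 * p)))) ⟩
      3 ^ (2 * p) * k₀ ^ (2 * p) * n ^ (2 * p) * U
        ≤⟨ *-monoˡ-≤ U (*-monoʳ-≤ (3 ^ (2 * p) * k₀ ^ (2 * p)) n^2p≤) ⟩
      3 ^ (2 * p) * k₀ ^ (2 * p) * ((2 * s) ^ (8 * p) * k₀ ^ (2 * t)) * U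
        ≡⟨ l (3 ^ (2 * p)) (k₀ ^ (2 * p)) ((2 * s) ^ (8 * p)) (k₀ ^ (2 * t)) U ⟩
      k₀ ^ (2 * p) * (k₀ ^ (2 * t) * V₀)
        ≤⟨ *-monoʳ-≤ (k₀ ^ (2 * p)) (*-monoʳ-≤ (k₀ ^ (2 * t)) (≤-trans V₀≤k₀ (≤-reflexive (sym (*-identityʳ k₀))))) ⟩
      k₀ ^ (2 * p) * (k₀ ^ (2 * t) * k₀ ^ 1)
        ≡⟨ trans (cong (k₀ ^ (2 * p) *_) (sym (^-distribˡ-+-* k₀ (2 * t) 1))) (trans (sym (^-distribˡ-+-* k₀ (2 * p) (2 * t + 1))) (cong (k₀ ^_) (sym p′≡′))) ⟩
      k₀ ^ p′ ∎
      where
      l : ∀ c k s k′ U → c * k * (s * k′) * U ≡ k * (k′ * (c * s * U))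
      l = ℕ-ring

  [2sV₀]⁴≤ : (2 * s * V₀) ^ 4 ≤ h ^ growth p D
  [2sV₀]⁴≤ = begin
    (2 * s * V₀) ^ 4     ≤⟨ ^-monoˡ-≤ 4 (*-mono-≤ 2s≤ (*-mono-≤ (*-mono-≤ (^-monoˡ-≤ (2 * p) 3≤h) (^-monoˡ-≤ (8 * p) 2s≤)) ≤-refl)) ⟩
    (h ^ i * (h ^ (2 * p) * (h ^ i) ^ (8 * p) * (h ^ (2 * W + 2)) ^ (10 * p))) ^ 4
      ≡⟨ cong (_^ 4) (trans (cong (h ^ i *_) (trans (cong₂ _*_ (trans (cong (h ^ (2 * p) *_) (^-*-assoc h i (8 * p))) (sym (^-distribˡ-+-* h (2 * p) (i * (8 * p)))))
           (^-*-assoc h (2 * W + 2) (10 * p))) (sym (^-distribˡ-+-* h (2 * p + i * (8 * p)) ((2 * W + 2) * (10 * p))))))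
           (sym (^-distribˡ-+-* h i (2 * p + i * (8 * p) + (2 * W + 2) * (10 * p))))) ⟩
    (h ^ (i + (2 * p + i * (8 * p) + (2 * W + 2) * (10 * p)))) ^ 4
      ≡⟨ ^-*-assoc h (i + (2 * p + i * (8 * p) + (2 * W + 2) * (10 * p))) 4 ⟩
    h ^ growth p D       ∎
    where
    open ≤-Reasoning
    i : ℕ
    i = 1 + (2 * W + 5)
    3≤h : 3 ≤ h
    3≤h = ≤-trans (m≤m+n 3 157) (≤-trans (*-monoʳ-≤ 16 (m≤n+m 10 D)) 16D≤h)
    2s≤ : 2 * s ≤ h ^ i
    2s≤ = *-monoˡ-≤ s (≤-trans (n≤1+n 2) 3≤h)

-- With K = 2 G and t = l / K, eventually 8 l + 32 < (t + 1)². The left side is then below (t + 1) ^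
-- K ≤ 2 ^ (t K) ≤ 2 ^ l.
polynomial<exponential : ∀ G → 1 ≤ G → ∃[ l₀ ] (∀ l → l₀ ≤ l → (8 * l + 32) ^ G < 2 ^ l)
polynomial<exponential G 1≤G = K * (40 * K) , λ l l₀≤l → bound l l₀≤l
  where
  K : ℕ
  K = 2 * G
  1≤K : 1 ≤ K
  1≤K = ≤-trans 1≤G (m≤n*m G 2)
  instance
    K≢0 : NonZero K
    K≢0 = >-nonZero 1≤K
  bound : ∀ l → K * (40 * K) ≤ l → (8 * l + 32) ^ G < 2 ^ l
  bound l l₀≤l = begin-strict
    (8 * l + 32) ^ G           <⟨ ^-monoˡ-< G {{>-nonZero 1≤G}} base ⟩
    (suc t * suc t) ^ G        ≡⟨ ^-distribʳ-* (suc t) (suc t) G ⟩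
    suc t ^ G * suc t ^ G      ≤⟨ *-mono-≤ (^-monoˡ-≤ G (n<2^n t)) (^-monoˡ-≤ G (n<2^n t)) ⟩
    (2 ^ t) ^ G * (2 ^ t) ^ G  ≡⟨ trans (sym (^-distribˡ-+-* (2 ^ t) G G)) (trans (^-*-assoc 2 t (G + G)) (cong (λ g → 2 ^ (t * (G + g))) (sym (+-identityʳ G)))) ⟩
    2 ^ (t * K)                ≤⟨ ^-monoʳ-≤ 2 (m/n*n≤m l K) ⟩
    2 ^ l                      ∎
    where
    open ≤-Reasoning
    t : ℕ
    t = l / K
    40K≤t : 40 * K ≤ t
    40K≤t = subst (_≤ t) (m*n/n≡m (40 * K) K) (/-mono-≤ (≤-trans (≤-reflexive (*-comm (40 * K) K)) l₀≤l) (≤-refl {K}))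
    l<K[1+t] : l < suc t * K
    l<K[1+t] = subst (_< suc t * K) (sym (m≡m%n+[m/n]*n l K)) (+-monoˡ-< (t * K) (m%n<n l K))
    1≤l : 1 ≤ l
    1≤l = ≤-trans (*-mono-≤ 1≤K (*-mono-≤ {1} {40} (s≤s z≤n) 1≤K)) l₀≤l
    base : 8 * l + 32 < suc t * suc t
    base = begin-strict
      8 * l + 32                ≤⟨ +-monoʳ-≤ (8 * l) (*-monoʳ-≤ 32 1≤l) ⟩
      8 * l + 32 * l            ≡⟨ *-distribʳ-+ l 8 32 ⟨
      40 * l                    <⟨ *-monoʳ-< 40 l<K[1+t] ⟩
      40 * (suc t * K)          ≡⟨ e t K ⟩
      suc t * (40 * K)          ≤⟨ *-monoʳ-≤ (suc t) (≤-trans 40K≤t (n≤1+n t)) ⟩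
      suc t * suc t             ∎
      where
      e : ∀ t k → 40 * ((1 + t) * k) ≡ (1 + t) * (40 * k)
      e = ℕ-ring

-- With l the integer part of the binary logarithm of n, the power of two is taken between 4 l + 16
-- and 8 l + 32: the lower end gives the bound on (4 (n + 1)) ^ 4, the upper end keeps its G-th
-- power below n.
logarithmic-scale : ∀ G c → 1 ≤ G → ∃[ N ] (∀ n → N ≤ n → ∃[ e ] c ≤ 2 ^ e × (4 * suc n) ^ 4 ≤ 2 ^ (2 ^ e) × (2 ^ e) ^ G < n)
logarithmic-scale G c 1≤G = 2 ^ (l₀ + c) , λ n N≤n → from-log n N≤n (log 1 2 n ≤-refl ≤-refl (≤-trans (m^n>0 2 (l₀ + c)) N≤n))
  where
  open ≤-Reasoning
  l₀ : ℕ
  l₀ = proj₁ (polynomial<exponential G 1≤G)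
  from-log : ∀ n → 2 ^ (l₀ + c) ≤ n → ∃[ l ] 1 * 2 ^ l ≤ n × n < 1 * 2 ^ suc l →
    ∃[ e ] c ≤ 2 ^ e × (4 * suc n) ^ 4 ≤ 2 ^ (2 ^ e) × (2 ^ e) ^ G < n
  from-log n N≤n (l , lo , hi) = from-log₂ (log 1 2 (4 * l + 16) ≤-refl ≤-refl (≤-trans (s≤s z≤n) (m≤n+m 16 (4 * l))))
    where
    hi′ : n < 2 ^ suc l
    hi′ = <-≤-trans hi (≤-reflexive (*-identityˡ (2 ^ suc l)))
    l≥ : l₀ + c ≤ l
    l≥ = ≮⇒≥ λ l< → <-irrefl refl (<-≤-trans hi′ (≤-trans (^-monoʳ-≤ 2 l<) N≤n))
    from-log₂ : ∃[ e ] 1 * 2 ^ e ≤ 4 * l + 16 × 4 * l + 16 < 1 * 2 ^ suc e → ∃[ e ] c ≤ 2 ^ e × (4 * suc n) ^ 4 ≤ 2 ^ (2 ^ e) × (2 ^ e) ^ G < n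
    from-log₂ (e , lo₂ , hi₂) = suc e , c≤ , n⁴≤ , small
      where
      4l+16≤ : 4 * l + 16 ≤ 2 ^ suc e
      4l+16≤ = ≤-trans (<⇒≤ hi₂) (≤-reflexive (*-identityˡ (2 ^ suc e)))
      c≤ : c ≤ 2 ^ suc e
      c≤ = ≤-trans (≤-trans (m≤n+m c l₀) l≥) (≤-trans (≤-trans (m≤n*m l 4) (m≤m+n (4 * l) 16)) 4l+16≤)
      n⁴≤ : (4 * suc n) ^ 4 ≤ 2 ^ (2 ^ suc e)
      n⁴≤ = begin
        (4 * suc n) ^ 4         ≤⟨ ^-monoˡ-≤ 4 (*-monoʳ-≤ 4 hi′) ⟩
        (4 * 2 ^ suc l) ^ 4     ≡⟨ cong (_^ 4) (sym (^-distribˡ-+-* 2 2 (suc l))) ⟩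
        (2 ^ (2 + suc l)) ^ 4   ≡⟨ ^-*-assoc 2 (2 + suc l) 4 ⟩
        2 ^ ((2 + suc l) * 4)   ≤⟨ ^-monoʳ-≤ 2 (≤-trans (≤-trans (m≤m+n ((2 + suc l) * 4) 4) (≤-reflexive (l₁ l))) 4l+16≤) ⟩
        2 ^ (2 ^ suc e)         ∎
        where
        l₁ : ∀ l → (3 + l) * 4 + 4 ≡ 4 * l + 16
        l₁ = ℕ-ring
      small : (2 ^ suc e) ^ G < n
      small = begin-strict
        (2 ^ suc e) ^ G       ≤⟨ ^-monoˡ-≤ G (≤-trans (*-monoʳ-≤ 2 (≤-trans (≤-reflexive (sym (*-identityˡ (2 ^ e)))) lo₂)) (≤-reflexive (l₁ l))) ⟩
        (8 * l + 32) ^ G      <⟨ proj₂ (polynomial<exponential G 1≤G) l (≤-trans (m≤m+n l₀ c) l≥) ⟩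
        2 ^ l                 ≤⟨ ≤-trans (≤-reflexive (sym (*-identityˡ (2 ^ l)))) lo ⟩
        n                     ∎
        where
        l₁ : ∀ l → 2 * (4 * l + 16) ≡ 8 * l + 32
        l₁ = ℕ-ring

abstract
  -- Opaque, so that neither `depth p D` nor 4 ^ D is ever unfolded at this huge numeral; only the
  -- inequality matters.
  dimension : ∃[ D ] 8 ^ 21 ≤ D
  dimension = 8 ^ 21 , ≤-refl

-- The fraction p / q > 1/4 plays the part of 1/4 + ε. A counterexample for q is one for 4 p - 1 ≥ q
-- as well, since |A| ^ (4 p - 1) ≥ |A| ^ q > n ^ p.
upper-bound : ∀ p q → 0 < q → q < 4 * p →
  ∃[ N ] ((n : ℕ) → N ≤ n → (A : List ℕ) → SubsetOfRange n A → NonAveraging A → length A ^ q ≤ n ^ p)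
upper-bound p q 0<q q<4p = proj₁ scale , λ n N≤n A (uA , range) nonavg → at n A uA range nonavg (proj₂ scale n N≤n)
  where
  1≤p : 1 ≤ p
  1≤p = n≢0⇒n>0 λ p≡0 → n≮0 (subst (q <_) (trans (cong (4 *_) p≡0) (*-zeroʳ 4)) q<4p)
  p′ t D G : ℕ
  p′ = pred (10 * p)
  t  = pred (4 * p)
  D  = proj₁ dimension
  G  = growth p D
  p′≡ : suc p′ ≡ 10 * p
  p′≡ = suc-pred (10 * p) {{m*n≢0 10 p {{_}} {{>-nonZero 1≤p}}}}
  t≡ : suc t ≡ 4 * p
  t≡ = suc-pred (4 * p) {{m*n≢0 4 p {{_}} {{>-nonZero 1≤p}}}}
  scale : ∃[ N ] (∀ n → N ≤ n → ∃[ e ] 16 * (D + 10) + 16 * 4 ^ D ≤ 2 ^ e × (4 * suc n) ^ 4 ≤ 2 ^ (2 ^ e) × (2 ^ e) ^ G < n)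
  scale = logarithmic-scale G (16 * (D + 10) + 16 * 4 ^ D) (s≤s z≤n)
  at : ∀ n A → Unique A → All (λ x → 1 ≤ x × x ≤ n) A → NonAveraging A →
    ∃[ e ] 16 * (D + 10) + 16 * 4 ^ D ≤ 2 ^ e × (4 * suc n) ^ 4 ≤ 2 ^ (2 ^ e) × (2 ^ e) ^ G < n → length A ^ q ≤ n ^ p
  at n A uA range nonavg (e , c≤ , n⁴≤ , h^G<n) with length A ^ q ≤? n ^ p
  ... | yes le = le
  ... | no ¬le = ⊥-elim (no-large-set large t≡ uA (λ b∈ → proj₂ (All.lookup range b∈)) nonavg 1≤A
          (≤-trans (<⇒≤ (≰⇒> ¬le)) (^-monoʳ-≤ (length A) {{>-nonZero 1≤A}} (≤-pred (≤-trans q<4p (≤-reflexive (sym t≡))))))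
          (≤-<-trans ([2sV₀]⁴≤ large t≡) h^G<n))
    where
    large : Large p p′ e D n
    large = record { p′≡ = p′≡ ; 1≤p = 1≤p ; 8^21≤D = proj₂ dimension
                   ; 16D≤h = ≤-trans (m≤m+n _ (16 * 4 ^ D)) c≤ ; 4^D≤h = ≤-trans (m≤n+m _ (16 * (D + 10))) c≤ ; n⁴≤ = n⁴≤ }
    1≤A : 1 ≤ length A
    1≤A = n≢0⇒n>0 λ A≡0 → ¬le (≤-trans (≤-reflexive (trans (cong (_^ q) A≡0) (zero-power q 0<q))) z≤n)
      where
      zero-power : ∀ q → 0 < q → 0 ^ q ≡ 0
      zero-power (suc q) _ = refl

-- The lower bound: points on a parabola

2xy<x²+y²-< : ∀ x y → x < y → 2 * (x * y) < x * x + y * y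
2xy<x²+y²-< x y x<y with m≤n⇒∃[o]m+o≡n x<y
... | o , refl = ≤-trans (m<m+n _ (s≤s (z≤n {o * o + 2 * o}))) (≤-reflexive (e x o))
  where
  e : ∀ x o → 2 * (x * (1 + x + o)) + (1 + (o * o + 2 * o)) ≡ x * x + (1 + x + o) * (1 + x + o)
  e = ℕ-ring

2xy<x²+y² : ∀ x y → x ≢ y → 2 * (x * y) < x * x + y * y
2xy<x²+y² x y x≢y with <-cmp x y
... | tri≈ _ x≡y _ = contradiction x≡y x≢y
... | tri< x<y _ _ = 2xy<x²+y²-< x y x<y
... | tri> _ _ y<x = subst₂ _<_ (cong (2 *_) (*-comm y x)) (+-comm (y * y) (x * x)) (2xy<x²+y²-< y x y<x)

digits-< : ∀ {M r q q′} r′ → r < M → q < q′ → r + M * q < r′ + M * q′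
digits-< {M} {r} {q} {q′} r′ r<M q<q′ = <-≤-trans (+-monoˡ-< (M * q) r<M)
  (≤-trans (≤-reflexive (sym (*-suc M q))) (≤-trans (*-monoʳ-≤ M q<q′) (m≤n+m (M * q′) r′)))

digits : ∀ {M r r′ q q′} → r < M → r′ < M → r + M * q ≡ r′ + M * q′ → r ≡ r′ × q ≡ q′
digits {M} {r} {r′} {q} {q′} r<M r′<M e with <-cmp q q′
... | tri≈ _ refl _ = +-cancelʳ-≡ (M * q) r r′ e , refl
... | tri< q<q′ _ _ = contradiction e (<⇒≢ (digits-< r′ r<M q<q′))
... | tri> _ _ q>q′ = contradiction (sym e) (<⇒≢ (digits-< r r′<M q>q′))

module Parabola (m : ℕ) where

  -- At most m numbers up to m have sum at most m², so the lower digits never carry.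
  modulus : ℕ
  modulus = suc (m * m)

  φ : ℕ → ℕ
  φ x = x + modulus * (x * x)

  φ-mono-< : ∀ {x y} → x < y → φ x < φ y
  φ-mono-< x<y = +-mono-<-≤ x<y (*-monoʳ-≤ modulus (*-mono-≤ (<⇒≤ x<y) (<⇒≤ x<y)))

  φ-injective : ∀ {x y} → φ x ≡ φ y → x ≡ y
  φ-injective {x} {y} e with <-cmp x y
  ... | tri< x<y _ _ = contradiction e (<⇒≢ (φ-mono-< x<y))
  ... | tri≈ _ x≡y _ = x≡y
  ... | tri> _ _ x>y = contradiction (sym e) (<⇒≢ (φ-mono-< x>y))

  A : List ℕ
  A = map (φ ∘ suc) (upTo m)

  A-length : length A ≡ m
  A-length = trans (length-map (φ ∘ suc) (upTo m)) (length-upTo m)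

  ∈A⁻ : ∀ {y} → y ∈ A → ∃[ x ] x ≤ m × y ≡ φ x
  ∈A⁻ y∈ with ∈-map⁻ (φ ∘ suc) y∈
  ... | x , x∈ , e = suc x , ∈-upTo⁻ x∈ , e

  A-range : ∀ {n} → 3 * m ^ 4 ≤ n → SubsetOfRange n A
  A-range {n} 3m⁴≤n = Unique.map⁺ (suc-injective ∘ φ-injective) (Unique.upTo⁺ m) ,
      All.map⁺ (All.tabulate λ x∈ → s≤s z≤n , ≤-trans (φ≤ (∈-upTo⁻ x∈)) 3m⁴≤n)
    where
    open ≤-Reasoning
    φ≤ : ∀ {x} → x < m → φ (suc x) ≤ 3 * m ^ 4
    φ≤ {x} x<m = begin
      φ (suc x)                                        ≤⟨ +-mono-≤ x<m (*-monoʳ-≤ modulus (*-mono-≤ x<m x<m)) ⟩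
      m + modulus * (m * m)                            ≡⟨ e₁ m ⟩
      m + m * m + m * m * (m * m)                      ≤⟨ +-monoˡ-≤ _ (+-mono-≤ (≤-trans (grow m 1≤m) (grow (m * m) (1≤* 1≤m 1≤m))) (grow (m * m) (1≤* 1≤m 1≤m))) ⟩
      m * m * (m * m) + m * m * (m * m) + m * m * (m * m) ≡⟨ e₂ m ⟩
      3 * m ^ 4                                        ∎
      where
      1≤m : 1 ≤ m
      1≤m = ≤-trans (s≤s z≤n) x<m
      e₁ : ∀ m → m + (1 + m * m) * (m * m) ≡ m + m * m + m * m * (m * m)
      e₁ = ℕ-ring
      e₂ : ∀ m → m * m * (m * m) + m * m * (m * m) + m * m * (m * m) ≡ 3 * (m * (m * (m * (m * 1))))
      e₂ = ℕ-ring

  squares : List ℕ → List ℕ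
  squares = map (λ x → x * x)

  sum-φ : ∀ X → sum (map φ X) ≡ sum X + modulus * sum (squares X)
  sum-φ []      = sym (*-zeroʳ modulus)
  sum-φ (x ∷ X) = trans (cong (λ z → φ x + z) (sum-φ X)) (e x modulus (sum X) (sum (squares X)))
    where
    e : ∀ x M s q → x + M * (x * x) + (s + M * q) ≡ x + s + M * (x * x + q)
    e = ℕ-ring

  -- The difference of the two sides is the sum of (x - x₀)² over X.
  variance-positive : ∀ x₀ X → (∀ {x} → x ∈ X → x ≢ x₀) → 1 ≤ length X → 2 * (sum X * x₀) < sum (squares X) + length X * (x₀ * x₀)
  variance-positive x₀ (x ∷ [])     ≢x₀ _ = ≤-trans (≤-trans (s≤s (≤-reflexive (e₁ x x₀))) (2xy<x²+y² x x₀ (≢x₀ (here refl)))) (≤-reflexive (e₂ x x₀))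
    where
    e₁ : ∀ x y → 2 * ((x + 0) * y) ≡ 2 * (x * y)
    e₁ = ℕ-ring
    e₂ : ∀ x y → x * x + y * y ≡ x * x + 0 + (y * y + 0)
    e₂ = ℕ-ring
  variance-positive x₀ (x ∷ x′ ∷ X) ≢x₀ _ = begin-strict
      2 * ((x + S) * x₀)                                                   ≡⟨ e₁ x S x₀ ⟩
      2 * (x * x₀) + 2 * (S * x₀)                                          <⟨ +-mono-< (2xy<x²+y² x x₀ (≢x₀ (here refl))) (variance-positive x₀ (x′ ∷ X) (≢x₀ ∘ there) (s≤s z≤n)) ⟩
      x * x + x₀ * x₀ + (S₂ + suc (length X) * (x₀ * x₀))                  ≡⟨ e₂ (x * x) (x₀ * x₀) S₂ (suc (length X) * (x₀ * x₀)) ⟩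
      x * x + S₂ + (x₀ * x₀ + suc (length X) * (x₀ * x₀))                  ∎
    where
    open ≤-Reasoning
    S S₂ : ℕ
    S  = sum (x′ ∷ X)
    S₂ = sum (squares (x′ ∷ X))
    e₁ : ∀ x s y → 2 * ((x + s) * y) ≡ 2 * (x * y) + 2 * (s * y)
    e₁ = ℕ-ring
    e₂ : ∀ a b c d → a + b + (c + d) ≡ a + c + (b + d)
    e₂ = ℕ-ring

  preimages : ∀ S → (∀ {y} → y ∈ S → y ∈ A) → ∃[ X ] S ≡ map φ X × (∀ {x} → x ∈ X → x ≤ m)
  preimages []      S⊆A = [] , refl , λ ()
  preimages (y ∷ S) S⊆A with ∈A⁻ (S⊆A (here refl)) | preimages S (S⊆A ∘ there)
  ... | x , x≤m , refl | X , refl , X≤m = x ∷ X , refl , λ { (here refl) → x≤m ; (there x∈) → X≤m x∈ }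

  A-nonaveraging : NonAveraging A
  A-nonaveraging (a , S , a∈ , S⊆A , a∉ , S≢[] , avg) with ∈A⁻ a∈ | preimages S (λ y∈ → Any-resp-⊆ S⊆A y∈)
  ... | x₀ , x₀≤m , refl | X , refl , X≤m = <-irrefl variance (variance-positive x₀ X ≢x₀ 1≤X)
    where
    open ≤-Reasoning
    k : ℕ
    k = length X
    1≤X : 1 ≤ k
    1≤X = n≢0⇒n>0 λ k≡0 → S≢[] (cong (map φ) (length≡0 X k≡0))
      where
      length≡0 : ∀ (X : List ℕ) → length X ≡ 0 → X ≡ []
      length≡0 [] _ = refl
    ≢x₀ : ∀ {x} → x ∈ X → x ≢ x₀
    ≢x₀ x∈ refl = a∉ (∈-map⁺ φ x∈)
    k≤m : k ≤ m
    k≤m = ≤-trans (≤-reflexive (sym (length-map φ X))) (≤-trans (length-mono-≤ S⊆A) (≤-reflexive A-length))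
    sum≤ : ∀ X → (∀ {x} → x ∈ X → x ≤ m) → sum X ≤ length X * m
    sum≤ []      h = z≤n
    sum≤ (x ∷ X) h = +-mono-≤ (h (here refl)) (sum≤ X (h ∘ there))
    equation : sum X + modulus * sum (squares X) ≡ k * x₀ + modulus * (k * (x₀ * x₀))
    equation = trans (sym (sum-φ X)) (trans (sym avg) (trans (cong (_* φ x₀) (length-map φ X)) (e k x₀ modulus)))
      where
      e : ∀ k x M → k * (x + M * (x * x)) ≡ k * x + M * (k * (x * x))
      e = ℕ-ring
    both : sum X ≡ k * x₀ × sum (squares X) ≡ k * (x₀ * x₀)
    both = digits (s≤s (≤-trans (sum≤ X X≤m) (*-monoˡ-≤ m k≤m))) (s≤s (*-mono-≤ k≤m x₀≤m)) equation
    -- X has mean x₀ and mean square x₀², hence no variance.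
    variance : 2 * (sum X * x₀) ≡ sum (squares X) + k * (x₀ * x₀)
    variance = trans (cong (λ s → 2 * (s * x₀)) (proj₁ both)) (trans (e k x₀) (cong (_+ k * (x₀ * x₀)) (sym (proj₂ both))))
      where
      e : ∀ k x → 2 * (k * x * x) ≡ k * (x * x) + k * (x * x)
      e = ℕ-ring

-- m is about (n / 3) ^ (1/4). The constant 48 = 3 · 2 ^ 4 comes from m + 1 ≤ 2 m, and since q ≥ 4 p
-- + 1 the spare factor m absorbs 48 ^ p.
lower-bound : ∀ p q → 0 < q → 4 * p < q →
  ∃[ N ] ((n : ℕ) → N ≤ n → ∃[ A ] (SubsetOfRange n A × NonAveraging A × n ^ p ≤ length A ^ q))
lower-bound p q 0<q 4p<q = N , λ n N≤n → at n N≤n (last-below (λ m → 3 * m ^ 4) n (suc n) z≤n (n<3[1+n]⁴ n))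
  where
  c N : ℕ
  c = 48 ^ p
  N = 3 * c ^ 4
  n<3[1+n]⁴ : ∀ n → n < 3 * suc n ^ 4
  n<3[1+n]⁴ n = ≤-trans (m≤m*n (suc n) (suc n ^ 3) {{m^n≢0 (suc n) 3}}) (m≤n*m (suc n ^ 4) 3)
  at : ∀ n → N ≤ n → ∃[ m ] 3 * m ^ 4 ≤ n × n < 3 * suc m ^ 4 → ∃[ A ] (SubsetOfRange n A × NonAveraging A × n ^ p ≤ length A ^ q)
  at n N≤n (m , lo , hi) = A , A-range lo , A-nonaveraging , (begin
      n ^ p                     ≤⟨ ^-monoˡ-≤ p (<⇒≤ hi) ⟩
      (3 * suc m ^ 4) ^ p       ≤⟨ ^-monoˡ-≤ p (*-monoʳ-≤ 3 (^-monoˡ-≤ 4 (+-monoˡ-≤ m 1≤m))) ⟩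
      (3 * (m + m) ^ 4) ^ p     ≡⟨ cong (_^ p) (e m) ⟩
      (48 * m ^ 4) ^ p          ≡⟨ ^-distribʳ-* 48 (m ^ 4) p ⟩
      c * (m ^ 4) ^ p           ≤⟨ *-monoˡ-≤ ((m ^ 4) ^ p) c≤m ⟩
      m * (m ^ 4) ^ p           ≡⟨ cong (m *_) (^-*-assoc m 4 p) ⟩
      m ^ suc (4 * p)           ≤⟨ ^-monoʳ-≤ m {{>-nonZero 1≤m}} 4p<q ⟩
      m ^ q                     ≡⟨ cong (_^ q) A-length ⟨
      length A ^ q              ∎)
    where
    open ≤-Reasoning
    open Parabola m
    c≤m : c ≤ m
    c≤m = ≮⇒≥ λ m<c → <-irrefl refl (<-≤-trans hi (≤-trans (*-monoʳ-≤ 3 (^-monoˡ-≤ 4 m<c)) N≤n))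
    1≤m : 1 ≤ m
    1≤m = ≤-trans (m^n>0 48 p) c≤m
    e : ∀ m → 3 * ((m + m) * ((m + m) * ((m + m) * ((m + m) * 1)))) ≡ 48 * (m * (m * (m * (m * 1))))
    e = ℕ-ring

theorem1p1 : ((p q : ℕ) → 0 < q → q < 4 * p →
    ∃[ N ] ((n : ℕ) → N ≤ n → (A : List ℕ) → SubsetOfRange n A →
    NonAveraging A → length A ^ q ≤ n ^ p))
    ×
    ((p q : ℕ) → 0 < q → 4 * p < q →
    ∃[ N ] ((n : ℕ) → N ≤ n → ∃[ A ] (SubsetOfRange n A × NonAveraging A
    × n ^ p ≤ length A ^ q)))
theorem1p1 = upper-bound , lower-bound
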